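{- Let $\widetilde{W}/W\in\{\widetilde{C}_n/C_n,\widetilde{B}_n/B_n,\widetilde{B}_n/D_n,\widetilde{D}_n/D_n\}$ and let $\lambda=(\lambda_1,\dots,\lambda_k)$ be a symmetric $(2n)$-core partition with $\lambda=\mathcal{C}(w)$ for $w=\mathcal{W}(\lambda)\in\widetilde{W}/W$. If all parts of $\lambda$ are less than or equal to $n$, then $$\ell(\mathcal{W}(\lambda))=\sum_{1\le i\le k}\max(0,\lambda_i-i+1+x_0).$$ Otherwise, for $1\le i\le n$ define $R(i)$ to be the (index of the topmost) longest row of $\lambda$ having runner number $i$ or $N-i$ labeling its rightmost box. Follow the boundary of $\lambda$ extended $n$ steps out in each direction from its center, a path which involves $n$ vertical steps and $n$ horizontal steps. Define $r(i)$ to be the (index of the) unique row of $\lambda$ ending with one of these $n$ vertical steps and whose rightmost box is labeled by the same choice of $i$ or $N-i$ as for $R(i)$. Define $d$ to be the number of rows of $\lambda$ whose box on the main diagonal has hook length greater than $2n$. Then $$\ell(\mathcal{W}(\lambda))=\sum_{i=1}^n\big(\lambda_{R(i)}-\lambda_{r(i)}\big)+(1+x_0+x_n)d+\sum_{d+1\le i\le k}\max(0,\lambda_i-i+1+x_0).$$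
   Context: Offsets: $x_0=0$ in types $\widetilde{C}/C,\widetilde{B}/D$ and $x_0=-1$ in types $\widetilde{B}/B,\widetilde{D}/D$; $x_n=0$ in types $\widetilde{C}/C,\widetilde{B}/B$ and $x_n=-1$ in types $\widetilde{B}/D,\widetilde{D}/D$. Groups. Let $N=2n+1$. A mirrored $\mathbb{Z}$-permutation is a bijection $w:\mathbb{Z}\to\mathbb{Z}$ with $w(i+N)=w(i)+N$ and $w(-i)=-w(i)$ for all $i\in\mathbb{Z}$; it is determined by $(w(1),\dots,w(n))$. Under composition these form the affine Coxeter group $\widetilde{C}_n$. Define elements by their images $(w(1),\dots,w(n))$: $s_i=(1,\dots,i-1,i+1,i,i+2,\dots,n)$ for $1\le i\le n-1$; $s_0^C=(-1,2,3,\dots,n)$; $s_0^D=(-2,-1,3,\dots,n)$; $s_n^C=(1,\dots,n-1,n+1)$; $s_n^D=(1,\dots,n-2,n+1,n+2)$. The four types are: - $\widetilde{C}/C$: $\widetilde{W}$ is all mirrored $\mathbb{Z}$-permutations, generators $s_0=s_0^C,s_1,\dots,s_{n-1},s_n=s_n^C$ ($n\ge2$). - $\widetilde{B}/B$: those with $|\{i\le0:w(i)\ge1\}|$ even, generators $s_0=s_0^D,s_1,\dots,s_{n-1},s_n=s_n^C$ ($n\ge3$). - $\widetilde{B}/D$: those with $|\{i\le n:w(i)\ge n+1\}|$ even, generators $s_0=s_0^C,s_1,\dots,s_{n-1},s_n=s_n^D$ ($n\ge3$). - $\widetilde{D}/D$: those satisfying both parity conditions, generators $s_0=s_0^D,s_1,\dots,s_{n-1},s_n=s_n^D$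 ($n\ge4$). $W$ is generated by $s_1,\dots,s_n$, and $\widetilde{W}/W$ denotes the set of minimal length representatives of the cosets $wW$. $\ell$ is Coxeter length in $\widetilde{W}$ with respect to $s_0,\dots,s_n$. Abaci and cores. An abacus has runners (columns) $1,\dots,2n$; runner $i$ has entries labeled $mN+i$ for each level $m\in\mathbb{Z}$; some entries are beads, the others gaps; reading order is the order of labels; "lowest" means largest label; the abacus is flush if no bead is preceded by a gap on its runner. $\mathcal{A}(w)$ is the flush abacus whose lowest bead in each runner is an element of $\{w(1),\dots,w(2n)\}$. $\mathcal{C}(w)$ is the partition whose southeast boundary is the lattice path obtained by reading the entries of $\mathcal{A}(w)$ in reading order, recording a north-step for each bead and an east-step for each gap (first row at the top). $w\mapsto\mathcal{C}(w)$ is a bijection from $\widetilde{W}/W$ onto the symmetric $(2n)$-cores (types $\widetilde{C}/C,\widetilde{B}/D$), or the symmetric $(2n)$-cores with an even number of main-diagonal boxes (types $\widetilde{B}/B,\widetilde{D}/D$); $\mathcal{W}$ is the inverse. A symmetric $(2n)$-core is a self-conjugate partition with no hook length divisible by $2n$. The center of the boundary of $\lambda$ is the midpoint of the southeast boundary path, i.e. the southeast corner of the lowest box on the main diagonal. Runner numbers. Each box $(i,j)$ (row $i$, column $j$) is labeled by the runner number $1+((j-i)\bmod 2n)\in\{1,\dots,2n\}$; thus the label of the last box in a row is the runner of the bead of the abacus corresponding to that row. -}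

module Defs where

open import Data.Bool.Base using (if_then_else_)
open import Data.Fin.Base as Fin using (Fin; toℕ; fromℕ<)
open import Data.Integer.Base as ℤ using (ℤ; +_; -_; 0ℤ; 1ℤ; -1ℤ; _/ℕ_; _%ℕ_)
open import Data.Integer.DivMod using (n%ℕd<d)
open import Data.List.Base using (List; []; _∷_; length; filter; foldr; map; upTo)
open import Data.List.Membership.Propositional using (_∈_)
open import Data.List.Relation.Unary.All using (All)
open import Data.List.Relation.Unary.Linked using (Linked)
open import Data.List.Relation.Unary.Unique.Propositional using (Unique)
open import Data.Nat.Base as ℕ
  using (ℕ; zero; suc; _+_; _*_; _∸_; _≤_; _<_; _≥_; _≡ᵇ_; _≤ᵇ_; NonZero)
open import Data.Nat.Divisibility using (_∣_)
open import Data.Nat.Properties using (_≤?_; _<?_; m*n≢0)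
open import Data.Product.Base using (_×_; _,_; ∃; ∃₂)
open import Data.Sum.Base using (_⊎_)
open import Function.Base using (_∘_; id)
open import Function.Bundles using (_⇔_)
open import Function.Definitions using (Bijective)
open import Relation.Binary.PropositionalEquality using (_≡_; _≗_)
open import Relation.Nullary using (¬_)
open import Relation.Nullary.Decidable using (_×-dec_)

range : ℕ → ℕ → List ℕ
range a b = map (λ i → a + i) (upTo (suc b ∸ a))

∑[_⋯_] : ℕ → ℕ → (ℕ → ℤ) → ℤ
∑[ a ⋯ b ] f = foldr ℤ._+_ 0ℤ (map f (range a b))

-- CC = C̃/C, BB = B̃/B, BD = B̃/D, DD = D̃/D
data AffineType : Set where
  CC BB BD DD : AffineType

minRank : AffineType → ℕ
minRank CC = 2
minRank BB = 3
minRank BD = 3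
minRank DD = 4

x₀ : AffineType → ℤ
x₀ CC = 0ℤ
x₀ BD = 0ℤ
x₀ BB = -1ℤ
x₀ DD = -1ℤ

xₙ : AffineType → ℤ
xₙ CC = 0ℤ
xₙ BB = 0ℤ
xₙ BD = -1ℤ
xₙ DD = -1ℤ

N : ℕ → ℕ
N n = suc (2 * n)

record MirroredPermutation (n : ℕ) (w : ℤ → ℤ) : Set where
  field
    bijective : Bijective _≡_ _≡_ w
    periodic  : ∀ i → w (i ℤ.+ + N n) ≡ w i ℤ.+ + N n
    mirrored  : ∀ i → w (- i) ≡ - w i

EvenCardinality : (ℤ → Set) → Set
EvenCardinality P =
  ∃ λ (xs : List ℤ) → Unique xs × (∀ i → (i ∈ xs) ⇔ P i) × (2 ∣ length xs)

Even₀ : (ℤ → ℤ) → Set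
Even₀ w = EvenCardinality λ i → (i ℤ.≤ 0ℤ) × (1ℤ ℤ.≤ w i)

Evenₙ : ℕ → (ℤ → ℤ) → Set
Evenₙ n w = EvenCardinality λ i → (i ℤ.≤ + n) × (+ suc n ℤ.≤ w i)

-- Group elements are functions ℤ → ℤ, compared pointwise.
InW̃ : AffineType → ℕ → (ℤ → ℤ) → Set
InW̃ CC n w = MirroredPermutation n w
InW̃ BB n w = MirroredPermutation n w × Even₀ w
InW̃ BD n w = MirroredPermutation n w × Evenₙ n w
InW̃ DD n w = MirroredPermutation n w × Even₀ w × Evenₙ n w

-- The mirrored permutation with images f 1, …, f n of 1, …, n.  On a residue
-- r in {n + 1, …, 2n} the two symmetries force w r = N - w (N - r).
fromWindow : (n : ℕ) → (ℕ → ℤ) → ℤ → ℤ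
fromWindow n f i = onResidue (i %ℕ N n) ℤ.+ (i /ℕ N n) ℤ.* + N n
  where
  onResidue : ℕ → ℤ
  onResidue zero = 0ℤ
  onResidue r@(suc _) = if r ≤ᵇ n then f r else + N n ℤ.- f (N n ∸ r)

s₀C s₀D : ℕ → ℤ
s₀C j = if j ≡ᵇ 1 then - + 1 else + j
s₀D j = if j ≡ᵇ 1 then - + 2 else if j ≡ᵇ 2 then - + 1 else + j

sₙC sₙD : ℕ → ℕ → ℤ
sₙC n j = if j ≡ᵇ n then + (n + 1) else + j
sₙD n j = if suc j ≡ᵇ n then + (n + 1) else if j ≡ᵇ n then + (n + 2) else + j

swap : ℕ → ℕ → ℤ
swap i j = if j ≡ᵇ i then + suc i else if j ≡ᵇ suc i then + i else + j

window₀ : AffineType → ℕ → ℤ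
window₀ CC = s₀C
window₀ BD = s₀C
window₀ BB = s₀D
window₀ DD = s₀D

windowₙ : AffineType → ℕ → ℕ → ℤ
windowₙ CC = sₙC
windowₙ BB = sₙC
windowₙ BD = sₙD
windowₙ DD = sₙD

generator : AffineType → (n : ℕ) → Fin (suc n) → ℤ → ℤ
generator t n i = fromWindow n
  (if toℕ i ≡ᵇ 0 then window₀ t else
   if toℕ i ≡ᵇ n then windowₙ t n else swap (toℕ i))

evaluate : AffineType → (n : ℕ) → List (Fin (suc n)) → ℤ → ℤ
evaluate t n = foldr (λ s u → generator t n s ∘ u) id

-- ℓ(w) = m
record HasLength (t : AffineType) (n : ℕ) (w : ℤ → ℤ) (m : ℕ) : Set where
  field
    word       : List (Fin (suc n))
    word-w     : evaluate t n word ≗ w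
    word-m     : length word ≡ m
    minimality : ∀ v → evaluate t n v ≗ w → m ≤ length v

-- ℓ(w) = z, for an integer expression z
LengthIs : AffineType → ℕ → (ℤ → ℤ) → ℤ → Set
LengthIs t n w z = ∃ λ m → HasLength t n w m × (+ m ≡ z)

-- Membership in the parabolic subgroup W = ⟨s₁, …, sₙ⟩.  The generators are
-- involutions, so words without inverses suffice.
InW : AffineType → (n : ℕ) → (ℤ → ℤ) → Set
InW t n u = ∃ λ (v : List (Fin n)) → evaluate t n (map Fin.suc v) ≗ u

-- w ∈ W̃/W, i.e. w has minimal length in its coset wW
MinimalRepresentative : AffineType → ℕ → (ℤ → ℤ) → Set
MinimalRepresentative t n w =
  InW̃ t n w ×
  (∀ u → InW t n u → ∀ {a b} → HasLength t n w a → HasLength t n (w ∘ u) b → a ≤ b)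

-- Rows and columns are numbered from 1.
record Partition : Set where
  field
    parts      : List ℕ
    decreasing : Linked _≥_ parts
    positive   : All (0 <_) parts

open Partition public

-- The i-th entry of a list; 0 past the end (and at the junk index 0).
entry : List ℕ → ℕ → ℕ
entry []       _             = 0
entry (x ∷ xs) zero          = 0
entry (x ∷ xs) (suc zero)    = x
entry (x ∷ xs) (suc (suc i)) = entry xs (suc i)

row : Partition → ℕ → ℕ
row μ = entry (parts μ)

column : Partition → ℕ → ℕ
column μ j = length (filter (j ≤?_) (parts μ))

numRows : Partition → ℕ
numRows μ = length (parts μ)

IsRow : Partition → ℕ → Set
IsRow μ i = (1 ≤ i) × (i ≤ numRows μ)

IsBox : Partition → ℕ → ℕ → Set
IsBox μ i j = IsRow μ i × (1 ≤ j) × (j ≤ row μ i)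

hook : Partition → ℕ → ℕ → ℕ
hook μ i j = (row μ i ∸ j) + (column μ j ∸ i) + 1

SelfConjugate : Partition → Set
SelfConjugate μ = ∀ i → 1 ≤ i → row μ i ≡ column μ i

IsCore : ℕ → Partition → Set
IsCore p μ = ∀ i j → IsBox μ i j → ¬ (p ∣ hook μ i j)

SymmetricCore : ℕ → Partition → Set
SymmetricCore p μ = SelfConjugate μ × IsCore p μ

diagonalBoxes : Partition → ℕ
diagonalBoxes μ = length (filter (λ i → i ≤? row μ i) (range 1 (numRows μ)))

-- d, when p = 2n
longDiagonalHooks : ℕ → Partition → ℕ
longDiagonalHooks p μ =
  length (filter (λ i → (i ≤? row μ i) ×-dec (p <? hook μ i i)) (range 1 (numRows μ)))

-- (x , y) is the lattice point x columns right of and y rows below the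
-- northwest corner of the diagram.
Point : Set
Point = ℕ × ℕ

data Direction : Set where
  north east : Direction

data Step : Direction → Point → Point → Set where
  go-north : ∀ {x y} → Step north (x , suc y) (x , y)
  go-east  : ∀ {x y} → Step east  (x , y) (suc x , y)

-- The boundary is continued down the left axis and right along the top axis:
-- row μ (y + 1) ≤ x ≤ row μ y, with row 0 regarded as infinitely long.
OnBoundary : Partition → Point → Set
OnBoundary μ (x , y) = (row μ (suc y) ≤ x) × ((y ≡ 0) ⊎ (x ≤ row μ y))

-- Step t leads from point t to point (t + 1).  Any bi-infinite path of this
-- kind traverses the whole boundary, so it is unique up to a shift of t.
record BoundaryPath (μ : Partition) (direction : ℤ → Direction) : Set where
  field
    point      : ℤ → Point
    onBoundary : ∀ t → OnBoundary μ (point t)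
    step       : ∀ t → Step (direction t) (point t) (point (ℤ.suc t))

open BoundaryPath public

centre : Partition → Point
centre μ = diagonalBoxes μ , diagonalBoxes μ

-- Row i ends with one of the vertical steps of the boundary lying within n
-- steps of the centre (in either direction).
EndsNearCentre : ℕ → Partition → ℕ → Set
EndsNearCentre n μ i =
  ∃₂ λ (direction : ℤ → Direction) (p : BoundaryPath μ direction) →
    (point p 0ℤ ≡ centre μ) ×
    (∃ λ t → (- + n ℤ.≤ t) × (t ℤ.< + n) ×
             (point p t ≡ (row μ i , i)) ×
             (point p (ℤ.suc t) ≡ (row μ i , i ∸ 1)))

data Mark : Set where
  bead gap : Mark

-- r : Fin (2 * n) stands for runner r + 1; the integer is the level.
Abacus : ℕ → Set
Abacus n = Fin (2 * n) → ℤ → Mark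

label : (n : ℕ) → Fin (2 * n) → ℤ → ℤ
label n r m = m ℤ.* + N n ℤ.+ + suc (toℕ r)

Flush : (n : ℕ) → Abacus n → Set
Flush n A = ∀ r {m m′} → m′ ℤ.< m → A r m ≡ bead → A r m′ ≡ bead

LowestBead : (n : ℕ) → Abacus n → Fin (2 * n) → ℤ → Set
LowestBead n A r m = (A r m ≡ bead) × (∀ m′ → A r m′ ≡ bead → m′ ℤ.≤ m)

-- A = 𝒜(w)
IsAbacusOf : (n : ℕ) → (ℤ → ℤ) → Abacus n → Set
IsAbacusOf n w A =
  Flush n A ×
  (∀ r → ∃ λ m → LowestBead n A r m ×
    (∃ λ j → (1 ≤ j) × (j ≤ 2 * n) × (label n r m ≡ w (+ j))))

-- The t-th entry in reading order: labels increase, skipping multiples of N.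
readingOrder : (n : ℕ) .{{_ : NonZero n}} → Abacus n → ℤ → Mark
readingOrder n A t = A (fromℕ< (n%ℕd<d t (2 * n) {{2n≢0}})) (_/ℕ_ t (2 * n) {{2n≢0}})
  where
  2n≢0 : NonZero (2 * n)
  2n≢0 = m*n≢0 2 n

stepFor : Mark → Direction
stepFor bead = north
stepFor gap  = east

-- μ = 𝒞(w)
IsPartitionOf : (n : ℕ) .{{_ : NonZero n}} → (ℤ → ℤ) → Partition → Set
IsPartitionOf n w μ =
  ∃ λ (A : Abacus n) → IsAbacusOf n w A × BoundaryPath μ (stepFor ∘ readingOrder n A)

runnerNumber : (n : ℕ) .{{_ : NonZero n}} → ℕ → ℕ → ℕ
runnerNumber n i j = 1 + _%ℕ_ (+ j ℤ.- + i) (2 * n) {{m*n≢0 2 n}}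

rowRunner : (n : ℕ) .{{_ : NonZero n}} → Partition → ℕ → ℕ
rowRunner n μ i = runnerNumber n i (row μ i)

RowOnRunners : (n : ℕ) .{{_ : NonZero n}} → Partition → ℕ → ℕ → Set
RowOnRunners n μ i a =
  IsRow μ a × ((rowRunner n μ a ≡ i) ⊎ (rowRunner n μ a ≡ N n ∸ i))

-- a = R(i)
IsR : (n : ℕ) .{{_ : NonZero n}} → Partition → ℕ → ℕ → Set
IsR n μ i a =
  RowOnRunners n μ i a ×
  (∀ b → RowOnRunners n μ i b →
     (row μ b ≤ row μ a) × (row μ b ≡ row μ a → a ≤ b))

CentralRowOnRunner : (n : ℕ) .{{_ : NonZero n}} → Partition → ℕ → ℕ → Set
CentralRowOnRunner n μ c b = IsRow μ b × EndsNearCentre n μ b × (rowRunner n μ b ≡ c)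

-- b = r(i), where a = R(i)
Isr : (n : ℕ) .{{_ : NonZero n}} → Partition → ℕ → ℕ → Set
Isr n μ a b =
  CentralRowOnRunner n μ (rowRunner n μ a) b ×
  (∀ b′ → CentralRowOnRunner n μ (rowRunner n μ a) b′ → b′ ≡ b)

diagonalExcess : AffineType → Partition → ℕ → ℤ
diagonalExcess t μ i = 0ℤ ℤ.⊔ (+ row μ i ℤ.- + i ℤ.+ 1ℤ ℤ.+ x₀ t)

{-# OPTIONS --safe #-}
-- Let m be the vector of the levels of the lowest beads on the runners 1, …, n.  Left
-- multiplication by a generator permutes, negates or reflects (x ↦ 1 - x) coordinates
-- of m, and changes the number F(m) of reflecting hyperplanes that separate the point m
-- from the fundamental alcove by at most one.  If m ≠ 0, some generator lowers F: the
-- only other dominant vector, (1, 0, …, 0), is excluded by the parity conditions.  If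
-- m = 0, then w lies in W, by the same descent applied to N - 2 w⁻¹ in place of m.  Hence
-- F(m) is the length of a minimal representative.
--
-- For the core, columns count the gaps before, and rows the beads after, a boundary
-- step.  Both counts are sums over one period of the boundary, which telescope as the
-- step moves.  So λ_{R(i)} - λ_{r(i)} splits into contributions of pairs of runners, and
-- for every pair these add up to the corresponding terms of F(m).
module Submission where

open import Defs
open import Data.Bool.Base as Bool using (true; false; if_then_else_)
open import Data.Empty using (⊥; ⊥-elim)
open import Data.Fin.Base as Fin using (Fin; toℕ; fromℕ<)
import Data.Fin.Properties as Fin
open import Data.Integer.Base as ℤ
  using (ℤ; _+_; _-_; +_; -[1+_]; +[1+_]; -_; 0ℤ; 1ℤ; -1ℤ; ∣_∣; _/ℕ_; _%ℕ_; +≤+; -≤+; +<+; -<+)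
open import Data.Integer.DivMod using (n%ℕd<d; a≡a%ℕn+[a/ℕn]*n)
import Data.Integer.Properties as ℤ
open import Data.Integer.Tactic.RingSolver using (solve-∀)
open import Data.List.Base
  using (List; []; _∷_; length; map; _++_; reverse; applyUpTo; foldr; filter; upTo)
open import Data.List.Membership.Propositional using (_∈_)
open import Data.List.Membership.Propositional.Properties
  using (∈-++⁺ˡ; ∈-++⁺ʳ; ∈-++⁻; ∈-applyUpTo⁺; ∈-applyUpTo⁻)
open import Data.List.Membership.Propositional.Properties.WithK using (unique∧set⇒bag)
import Data.List.Properties as List
open import Data.List.Relation.Binary.BagAndSetEquality using (∼bag⇒↭)
open import Data.List.Relation.Binary.Permutation.Propositional.Properties using (↭-length)
open import Data.List.Relation.Unary.All using (All; []; _∷_)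
import Data.List.Relation.Unary.AllPairs as AllPairs
open import Data.List.Relation.Unary.Linked using (Linked; []; [-]; _∷_)
open import Data.List.Relation.Unary.Unique.Propositional using (Unique)
import Data.List.Relation.Unary.Unique.Propositional.Properties as Unique
open import Data.Nat.Base as ℕ using (ℕ; zero; suc; _*_; _≤_; _<_; z≤n; s≤s; NonZero; _≡ᵇ_)
open import Data.Nat.Divisibility using (divides)
open import Data.Nat.Induction using (<-rec)
import Data.Nat.Properties as ℕ
open import Data.Product.Base using (_×_; _,_; ∃; ∃₂; proj₁; proj₂)
open import Data.Sum.Base using (_⊎_; inj₁; inj₂)
open import Function.Base using (_∘_; id)
open import Function.Bundles using (Equivalence; mk⇔)
open import Relation.Binary.PropositionalEquality
  using (_≡_; _≢_; _≗_; refl; sym; trans; cong; cong₂; subst; subst₂; module ≡-Reasoning)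
open import Relation.Nullary using (¬_; Dec; yes; no)
import Relation.Nullary.Decidable as Dec
open import Relation.Nullary.Decidable using (_×-dec_)
open ≡-Reasoning

-- Finite sums and pair weights

-- Left multiplication of `w` by a generator `s` precomposes `w⁻¹` with `s`. So a function of `w⁻¹`
-- with suitable reflection laws at the ends of the window gives a vector on which generators act by
-- swaps and reflections. One analysis serves three vectors: levels for the length, excesses for the
-- second parity condition, heights for sorting inside `W`. A minimal representative is given only
-- by comparison inside its coset, so its length is squeezed. Descent yields `w = v x` with `v` a
-- word of `F(m)` letters and `x` in `W`; then `w x⁻¹` has length `F(m)`, and minimality bounds the
-- length of `w` by it. As a letter changes `F` by at most one, no word for `w` is shorter. In the
-- core, runners `i` and `N - i` are mirror images, and one of them has a bead in the central
-- window. The last bead on the two lies a whole number of periods later; these numbers add up to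
-- `d`. For `j < i` the gaps seen from both rows give the pair term of `F`, up to one unit that is
-- missing when the central bead for `i` lies after the centre. The last sum supplies it.

+-cancelʳ : ∀ {a b} c → a + c ≡ b + c → a ≡ b
+-cancelʳ {a} {b} c eq = trans (sym (e a c)) (trans (cong (_- c) eq) (e b c))
  where
  e : ∀ a c → a + c - c ≡ a
  e = solve-∀

0≤-gap : ∀ {a b} → a ℤ.≤ b → 0ℤ ℤ.≤ b - a
0≤-gap = ℤ.i≤j⇒0≤j-i

0≤-gap< : ∀ {a b} → a ℤ.< b → 0ℤ ℤ.≤ b - a - 1ℤ
0≤-gap< {a} {b} a<b =
  subst (ℤ._≤_ 0ℤ) (eq a b) (ℤ.i≤j⇒0≤j-i (ℤ.i<j⇒suc[i]≤j a<b))
  where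
  eq : ∀ a b → b - (1ℤ + a) ≡ b - a - 1ℤ
  eq = solve-∀

infixl 6 _⊞_
_⊞_ : ∀ {a b} → 0ℤ ℤ.≤ a → 0ℤ ℤ.≤ b → 0ℤ ℤ.≤ a + b
_⊞_ = ℤ.+-mono-≤

-- Inequalities are proved by certificate: the difference is rewritten by the ring solver as a sum
-- of terms known to be nonnegative.
≤-by : ∀ {a b e} → 0ℤ ℤ.≤ e → b - a ≡ e → a ℤ.≤ b
≤-by 0≤e eq = ℤ.0≤i-j⇒j≤i (subst (ℤ._≤_ 0ℤ) (sym eq) 0≤e)

<-by : ∀ {a b e} → 0ℤ ℤ.≤ e → b - a - 1ℤ ≡ e → a ℤ.< b
<-by {a} {b} 0≤e eq = ℤ.suc[i]≤j⇒i<j (≤-by 0≤e (trans (rearrange a b) eq))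
  where
  rearrange : ∀ a b → b - (1ℤ + a) ≡ b - a - 1ℤ
  rearrange = solve-∀

-- Contradictions use the dual certificate: nonnegative gaps taken from the hypotheses add up to a
-- negative numeral.
negative-absurd : ∀ {k e} → 0ℤ ℤ.≤ e → e ≡ -[1+ k ] → ⊥
negative-absurd 0≤e refl with 0≤e
... | ()

≤0⊎1≤ : ∀ v → (v ℤ.≤ 0ℤ) ⊎ (1ℤ ℤ.≤ v)
≤0⊎1≤ (+ zero)  = inj₁ ℤ.≤-refl
≤0⊎1≤ +[1+ k ]  = inj₂ (+≤+ (s≤s z≤n))
≤0⊎1≤ -[1+ k ]  = inj₁ -≤+

0≤+ : ∀ n → 0ℤ ℤ.≤ + n
0≤+ n = +≤+ z≤n

≤-or-> : ∀ a b → (a ℤ.≤ b) ⊎ (b ℤ.< a)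
≤-or-> a b with a ℤ.≤? b
... | yes p = inj₁ p
... | no ¬p = inj₂ (ℤ.≰⇒> ¬p)

-- g v counts the integers k with 0 < k < v or v < k ≤ 0: the hyperplanes of one
-- direction separating a lattice point from the fundamental alcove.
g : ℤ → ℤ
g (+ zero) = 0ℤ
g +[1+ k ] = + k
g -[1+ k ] = +[1+ k ]

g-pos : ∀ {v} → 1ℤ ℤ.≤ v → g v ≡ v - 1ℤ
g-pos {+[1+ k ]} p = refl
g-pos {+ zero} (+≤+ ())

g-nonpos : ∀ {v} → v ℤ.≤ 0ℤ → g v ≡ - v
g-nonpos {+ zero}   p = refl
g-nonpos {+[1+ k ]} (+≤+ ())
g-nonpos { -[1+ k ]} p = refl

g-nonneg : ∀ v → 0ℤ ℤ.≤ g v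
g-nonneg (+ zero) = +≤+ z≤n
g-nonneg +[1+ k ] = +≤+ z≤n
g-nonneg -[1+ k ] = +≤+ z≤n

-- The map `k ↦ 1 - k` exchanges the integers counted for `v` and for `1 - v`; it preserves the
-- strip between `0` and `1` in which the alcove lies.
g-reflect : ∀ v → g (1ℤ - v) ≡ g v
g-reflect v with ≤0⊎1≤ v
... | inj₁ v≤0 = trans (g-pos (≤-by (0≤-gap v≤0) (e v))) (trans (f v) (sym (g-nonpos v≤0)))
  where
  e : ∀ v → 1ℤ - v - 1ℤ ≡ 0ℤ - v
  e = solve-∀
  f : ∀ v → 1ℤ - v - 1ℤ ≡ - v
  f = solve-∀
... | inj₂ 1≤v = trans (g-nonpos (≤-by (0≤-gap 1≤v) (e v))) (trans (f v) (sym (g-pos 1≤v)))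
  where
  e : ∀ v → 0ℤ - (1ℤ - v) ≡ v - 1ℤ
  e = solve-∀
  f : ∀ v → - (1ℤ - v) ≡ v - 1ℤ
  f = solve-∀

-- Negation is the reflection in the wall `0` of the strip. It matches the other hyperplanes by
-- `k ↦ - k`, so only the wall itself, which separates a negative `v` from the strip, is lost.
g-negate-< : ∀ {v} → v ℤ.< 0ℤ → g v ≡ 1ℤ + g (- v)
g-negate-< { -[1+ k ]} p = refl
g-negate-< {+ k} (+<+ ())

g-negate-≤ : ∀ v → g v ℤ.≤ 1ℤ + g (- v)
g-negate-≤ (+ zero)    = +≤+ z≤n
g-negate-≤ +[1+ k ] = +≤+ (ℕ.≤-trans (ℕ.n≤1+n k) (ℕ.n≤1+n (suc k)))
g-negate-≤ -[1+ k ]    = ℤ.≤-refl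

private
  2-as-reflection : ∀ v → - (1ℤ - v) ≡ 1ℤ - (+ 2 - v)
  2-as-reflection = solve-∀

-- Reflection in the wall `1` is negation conjugated by `v ↦ 1 - v`, so its laws follow from those
-- of negation.
g-reflect₂ : ∀ v → g (- (1ℤ - v)) ≡ g (+ 2 - v)
g-reflect₂ v = trans (cong g (2-as-reflection v)) (g-reflect (+ 2 - v))

g-reflect₂-> : ∀ {v} → 1ℤ ℤ.< v → g v ≡ 1ℤ + g (+ 2 - v)
g-reflect₂-> {v} 1<v = trans (sym (g-reflect v))
  (trans (g-negate-< (<-by (0≤-gap< 1<v) (e v))) (cong (_+_ 1ℤ) (g-reflect₂ v)))
  where
  e : ∀ v → 0ℤ - (1ℤ - v) - 1ℤ ≡ v - 1ℤ - 1ℤ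
  e = solve-∀

g-reflect₂-≤ : ∀ v → g v ℤ.≤ 1ℤ + g (+ 2 - v)
g-reflect₂-≤ v =
  subst₂ ℤ._≤_ (g-reflect v) (cong (_+_ 1ℤ) (g-reflect₂ v)) (g-negate-≤ (1ℤ - v))

Σ : ℕ → (ℕ → ℤ) → ℤ
Σ zero    f = 0ℤ
Σ (suc n) f = Σ n f + f n

Σ-cong : ∀ n {f f′} → (∀ i → i < n → f i ≡ f′ i) → Σ n f ≡ Σ n f′
Σ-cong zero    eq = refl
Σ-cong (suc n) eq =
  cong₂ _+_ (Σ-cong n λ i i<n → eq i (ℕ.m<n⇒m<1+n i<n)) (eq n ℕ.≤-refl)

private
  interchange : ∀ a b c d → (a + b) + (c + d) ≡ (a + c) + (b + d)
  interchange = solve-∀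

Σ-+ : ∀ n f f′ → Σ n (λ i → f i + f′ i) ≡ Σ n f + Σ n f′
Σ-+ zero    f f′ = refl
Σ-+ (suc n) f f′ =
  trans (cong (_+ (f n + f′ n)) (Σ-+ n f f′)) (interchange (Σ n f) (Σ n f′) (f n) (f′ n))

Σ-* : ∀ n c f → Σ n (λ i → c ℤ.* f i) ≡ c ℤ.* Σ n f
Σ-* zero    c f = sym (ℤ.*-zeroʳ c)
Σ-* (suc n) c f =
  trans (cong (_+ c ℤ.* f n) (Σ-* n c f)) (sym (ℤ.*-distribˡ-+ c (Σ n f) (f n)))

Σ-cons : ∀ n f → Σ (suc n) f ≡ f 0 + Σ n (f ∘ suc)
Σ-cons zero    f = ℤ.+-comm 0ℤ (f 0)
Σ-cons (suc n) f = trans (cong (_+ f (suc n)) (Σ-cons n f))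
  (ℤ.+-assoc (f 0) (Σ n (f ∘ suc)) (f (suc n)))

Σ-nonneg : ∀ n f → (∀ i → i < n → 0ℤ ℤ.≤ f i) → 0ℤ ℤ.≤ Σ n f
Σ-nonneg zero    f 0≤f = ℤ.≤-refl
Σ-nonneg (suc n) f 0≤f =
  Σ-nonneg n f (λ i i<n → 0≤f i (ℕ.m<n⇒m<1+n i<n)) ⊞ 0≤f n ℕ.≤-refl

Σ-zero : ∀ n f → (∀ i → i < n → f i ≡ 0ℤ) → Σ n f ≡ 0ℤ
Σ-zero zero    f eq = refl
Σ-zero (suc n) f eq =
  cong₂ _+_ (Σ-zero n f λ i i<n → eq i (ℕ.m<n⇒m<1+n i<n)) (eq n ℕ.≤-refl)

-- A relation on the entries below `n` instead of an operation on vectors: the vectors to come are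
-- restrictions of functions on the integers, whose entries from `n` on may change as well.
record Swapped (n j : ℕ) (x x′ : ℕ → ℤ) : Set where
  field
    inside : suc j < n
    at-j   : x′ j ≡ x (suc j)
    at-1+j : x′ (suc j) ≡ x j
    fixed  : ∀ i → i < n → i ≢ j → i ≢ suc j → x′ i ≡ x i

module _ where
  open Swapped

  Swapped-map : ∀ {n j x x′} (f : ℤ → ℤ) → Swapped n j x x′ → Swapped n j (f ∘ x) (f ∘ x′)
  Swapped-map f s .inside = inside s
  Swapped-map f s .at-j   = cong f (at-j s)
  Swapped-map f s .at-1+j = cong f (at-1+j s)
  Swapped-map f s .fixed i i<n i≢j i≢1+j = cong f (fixed s i i<n i≢j i≢1+j)

  Swapped-init : ∀ {n j x x′} → suc j < n → Swapped (suc n) j x x′ → Swapped n j x x′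
  Swapped-init 1+j<n s .inside = 1+j<n
  Swapped-init 1+j<n s .at-j   = at-j s
  Swapped-init 1+j<n s .at-1+j = at-1+j s
  Swapped-init 1+j<n s .fixed i i<n = fixed s i (ℕ.m<n⇒m<1+n i<n)

  Swapped-below : ∀ {n j x x′} → Swapped n j x x′ → ∀ i → i < j → x′ i ≡ x i
  Swapped-below s i i<j =
    fixed s i (ℕ.<-trans i<j (ℕ.<-trans ℕ.≤-refl (inside s))) (ℕ.<⇒≢ i<j)
      (ℕ.<⇒≢ (ℕ.m<n⇒m<1+n i<j))

  Swapped-beyond : ∀ {n j x x′} → Swapped (suc n) j x x′ → suc j < n → x′ n ≡ x n
  Swapped-beyond s 1+j<n =
    fixed s _ ℕ.≤-refl (λ { refl → ℕ.<-asym 1+j<n ℕ.≤-refl }) (λ { refl → ℕ.<-irrefl refl 1+j<n })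

  Σ-Swapped : ∀ n {j x x′} → Swapped n j x x′ → Σ n x′ ≡ Σ n x
  Σ-Swapped (suc n) {j} {x} {x′} s with ℕ.m<1+n⇒m<n∨m≡n (inside s)
  ... | inj₁ 1+j<n = cong₂ _+_ (Σ-Swapped n (Swapped-init 1+j<n s)) (Swapped-beyond s 1+j<n)
  ... | inj₂ refl  = begin
    Σ j x′ + x′ j + x′ (suc j)
      ≡⟨ cong₂ _+_ (cong₂ _+_ (Σ-cong j (Swapped-below s)) (at-j s)) (at-1+j s) ⟩
    Σ j x + x (suc j) + x j
      ≡⟨ exchange (Σ j x) (x (suc j)) (x j) ⟩
    Σ j x + x j + x (suc j) ∎
    where
    exchange : ∀ a b c → a + b + c ≡ a + c + b
    exchange = solve-∀

-- `Σ` unfolds at its last term, so a change at the front has to be carried along by induction, as a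
-- balance of old and new entries.
Σ-firstTwo : ∀ n {x x′} → (∀ i → suc (suc i) < suc (suc n) → x′ (suc (suc i)) ≡ x (suc (suc i))) →
  Σ (suc (suc n)) x′ + (x 0 + x 1) ≡ Σ (suc (suc n)) x + (x′ 0 + x′ 1)
Σ-firstTwo zero {x} {x′} eq = e (x 0) (x 1) (x′ 0) (x′ 1)
  where
  e : ∀ a b c d → 0ℤ + c + d + (a + b) ≡ 0ℤ + a + b + (c + d)
  e = solve-∀
Σ-firstTwo (suc n) {x} {x′} eq = begin
  S′ + x′ k + (x 0 + x 1)   ≡⟨ cong (λ z → S′ + z + (x 0 + x 1)) (eq n ℕ.≤-refl) ⟩
  S′ + x k + (x 0 + x 1)    ≡⟨ e S′ (x k) (x 0 + x 1) ⟩
  S′ + (x 0 + x 1) + x k    ≡⟨ cong (_+ x k) (Σ-firstTwo n λ i i<n → eq i (ℕ.m<n⇒m<1+n i<n)) ⟩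
  S + (x′ 0 + x′ 1) + x k   ≡⟨ e S (x′ 0 + x′ 1) (x k) ⟩
  S + x k + (x′ 0 + x′ 1)   ∎
  where
  k = suc (suc n)
  S = Σ k x
  S′ = Σ k x′
  e : ∀ a b c → a + b + c ≡ a + c + b
  e = solve-∀

-- Every pair occurs once, with the smaller index first. `P` is not assumed symmetric, and this is
-- why exchanging two neighbours can change the weight.
weight : (ℤ → ℤ) → (ℤ → ℤ → ℤ) → ℕ → (ℕ → ℤ) → ℤ
weight h P n x = Σ n λ j → h (x j) + Σ j λ i → P (x i) (x j)

module Weight (h : ℤ → ℤ) (P : ℤ → ℤ → ℤ) where
  private
    H : ℕ → (ℕ → ℤ) → ℤ
    H = weight h P

  weight-cong : ∀ n {x x′} → (∀ i → i < n → x′ i ≡ x i) → H n x′ ≡ H n x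
  weight-cong n eq = Σ-cong n λ j j<n →
    cong₂ _+_ (cong h (eq j j<n))
      (Σ-cong j λ i i<j → cong₂ P (eq i (ℕ.<-trans i<j j<n)) (eq j j<n))

  -- All other pair terms are only permuted. The balance, new weight plus old local term equals old
  -- weight plus new local term, recurs in the next four lemmas, so that the five kinds of moves can
  -- be treated uniformly.
  weight-Swapped : ∀ n {j x x′} → Swapped n j x x′ →
    H n x′ + P (x j) (x (suc j)) ≡ H n x + P (x (suc j)) (x j)
  weight-Swapped (suc n) {j} {x} {x′} s with ℕ.m<1+n⇒m<n∨m≡n (Swapped.inside s)
  ... | inj₁ 1+j<n = begin
    H n x′ + T x′ + p  ≡⟨ cong (λ z → H n x′ + z + p) T-eq ⟩
    H n x′ + T x + p   ≡⟨ e (H n x′) (T x) p ⟩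
    H n x′ + p + T x   ≡⟨ cong (_+ T x) (weight-Swapped n s₁) ⟩
    H n x + q + T x    ≡⟨ e (H n x) q (T x) ⟩
    H n x + T x + q    ∎
    where
    s₁ = Swapped-init 1+j<n s
    p = P (x j) (x (suc j))
    q = P (x (suc j)) (x j)
    T : (ℕ → ℤ) → ℤ
    T y = h (y n) + Σ n λ i → P (y i) (y n)
    T-eq : T x′ ≡ T x
    T-eq = cong₂ _+_ (cong h (Swapped-beyond s 1+j<n))
      (trans (Σ-cong n λ i _ → cong (P (x′ i)) (Swapped-beyond s 1+j<n))
             (Σ-Swapped n (Swapped-map (λ v → P v (x n)) s₁)))
    e : ∀ a b c → a + b + c ≡ a + c + b
    e = solve-∀
  ... | inj₂ refl = begin
    H j x′ + (h (x′ j) + Σ j (λ i → P (x′ i) (x′ j)))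
      + (h (x′ (suc j)) + (Σ j (λ i → P (x′ i) (x′ (suc j))) + P (x′ j) (x′ (suc j)))) + p
        ≡⟨ cong (_+ p) (cong₂ _+_
             (cong₂ _+_ (weight-cong j below)
               (cong₂ _+_ (cong h at-j) (Σ-cong j λ i i<j → cong₂ P (below i i<j) at-j)))
             (cong₂ _+_ (cong h at-1+j)
               (cong₂ _+_ (Σ-cong j λ i i<j → cong₂ P (below i i<j) at-1+j)
                 (cong₂ P at-j at-1+j)))) ⟩
    H j x + (h b + B) + (h a + (A + q)) + p
        ≡⟨ e (H j x) (h a) (h b) A B p q ⟩
    H j x + (h a + A) + (h b + (B + p)) + q ∎
    where
    open Swapped s using (at-j; at-1+j)
    below = Swapped-below s
    a = x j
    b = x (suc j)
    p = P a b
    q = P b a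
    A = Σ j λ i → P (x i) a
    B = Σ j λ i → P (x i) b
    e : ∀ H ha hb A B p q →
      H + (hb + B) + (ha + (A + q)) + p ≡ H + (ha + A) + (hb + (B + p)) + q
    e = solve-∀

  weight-last : ∀ k {x x′} → (∀ i → i < k → x′ i ≡ x i) →
    (∀ a → P a (x′ k) ≡ P a (x k)) →
    H (suc k) x′ + h (x k) ≡ H (suc k) x + h (x′ k)
  weight-last k {x} {x′} eq P-eq = begin
    H k x′ + (h (x′ k) + Σ k (λ i → P (x′ i) (x′ k))) + h (x k)
      ≡⟨ cong (_+ h (x k)) (cong₂ (λ y z → y + (h (x′ k) + z)) (weight-cong k eq)
           (Σ-cong k λ i i<k → trans (P-eq (x′ i)) (cong (λ y → P y (x k)) (eq i i<k)))) ⟩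
    H k x + (h (x′ k) + S) + h (x k)
      ≡⟨ e (H k x) (h (x′ k)) S (h (x k)) ⟩
    H k x + (h (x k) + S) + h (x′ k) ∎
    where
    S = Σ k λ i → P (x i) (x k)
    e : ∀ a b c d → a + (b + c) + d ≡ a + (d + c) + b
    e = solve-∀

  -- A reflection of shape D also exchanges the two coordinates, so their pair terms with an earlier
  -- coordinate are preserved only in sum.
  weight-lastTwo : ∀ k {x x′} → (∀ i → i < k → x′ i ≡ x i) →
    (∀ a → P a (x′ k) + P a (x′ (suc k)) ≡ P a (x k) + P a (x (suc k))) →
    H (suc (suc k)) x′ + (h (x k) + h (x (suc k)) + P (x k) (x (suc k))) ≡
    H (suc (suc k)) x + (h (x′ k) + h (x′ (suc k)) + P (x′ k) (x′ (suc k)))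
  weight-lastTwo k {x} {x′} eq P-eq = begin
    H k x′ + (c + C) + (d + (D + r)) + (a + b + p)
      ≡⟨ e₁ (H k x′) c C d D r (a + b + p) ⟩
    H k x′ + (C + D) + (c + d + r) + (a + b + p)
      ≡⟨ cong₂ (λ y z → y + z + (c + d + r) + (a + b + p)) (weight-cong k eq) CD≡AB ⟩
    H k x + (A + B) + (c + d + r) + (a + b + p)
      ≡⟨ e₂ (H k x) a b A B p (c + d + r) ⟩
    H k x + (a + A) + (b + (B + p)) + (c + d + r) ∎
    where
    a = h (x k)
    b = h (x (suc k))
    c = h (x′ k)
    d = h (x′ (suc k))
    p = P (x k) (x (suc k))
    r = P (x′ k) (x′ (suc k))
    A = Σ k λ i → P (x i) (x k)
    B = Σ k λ i → P (x i) (x (suc k))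
    C = Σ k λ i → P (x′ i) (x′ k)
    D = Σ k λ i → P (x′ i) (x′ (suc k))
    CD≡AB : C + D ≡ A + B
    CD≡AB = begin
      C + D ≡⟨ sym (Σ-+ k _ _) ⟩
      Σ k (λ i → P (x′ i) (x′ k) + P (x′ i) (x′ (suc k)))
        ≡⟨ Σ-cong k (λ i i<k → trans (P-eq (x′ i))
             (cong (λ y → P y (x k) + P y (x (suc k))) (eq i i<k))) ⟩
      Σ k (λ i → P (x i) (x k) + P (x i) (x (suc k))) ≡⟨ Σ-+ k _ _ ⟩
      A + B ∎
    e₁ : ∀ H c C d D r z →
      H + (c + C) + (d + (D + r)) + z ≡ H + (C + D) + (c + d + r) + z
    e₁ = solve-∀
    e₂ : ∀ H a b A B p z →
      H + (A + B) + z + (a + b + p) ≡ H + (a + A) + (b + (B + p)) + z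
    e₂ = solve-∀

  weight-first : ∀ k {x x′} → (∀ i → i < k → x′ (suc i) ≡ x (suc i)) →
    (∀ b → P (x′ 0) b ≡ P (x 0) b) →
    H (suc k) x′ + h (x 0) ≡ H (suc k) x + h (x′ 0)
  weight-first zero {x} {x′} eq P-eq = e (h (x 0)) (h (x′ 0))
    where
    e : ∀ a b → 0ℤ + (b + 0ℤ) + a ≡ 0ℤ + (a + 0ℤ) + b
    e = solve-∀
  weight-first (suc k) {x} {x′} eq P-eq = begin
    H (suc k) x′ + T x′ + h (x 0) ≡⟨ e (H (suc k) x′) (T x′) (h (x 0)) ⟩
    H (suc k) x′ + h (x 0) + T x′
      ≡⟨ cong₂ _+_ (weight-first k (λ i i<k → eq i (ℕ.m<n⇒m<1+n i<k)) P-eq)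
           (cong₂ _+_ (cong h (eq k ℕ.≤-refl))
             (Σ-cong (suc k) λ i i<1+k → trans (cong (P (x′ i)) (eq k ℕ.≤-refl)) (P-eq′ i i<1+k))) ⟩
    H (suc k) x + h (x′ 0) + T x ≡⟨ e (H (suc k) x) (h (x′ 0)) (T x) ⟩
    H (suc k) x + T x + h (x′ 0) ∎
    where
    T : (ℕ → ℤ) → ℤ
    T y = h (y (suc k)) + Σ (suc k) λ i → P (y i) (y (suc k))
    P-eq′ : ∀ i → i < suc k → P (x′ i) (x (suc k)) ≡ P (x i) (x (suc k))
    P-eq′ zero    _           = P-eq _
    P-eq′ (suc i) (s≤s i<k) = cong (λ y → P y (x (suc k))) (eq i (ℕ.m<n⇒m<1+n i<k))
    e : ∀ a b c → a + b + c ≡ a + c + b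
    e = solve-∀

  weight-firstTwo : ∀ k {x x′} → (∀ i → i < k → x′ (suc (suc i)) ≡ x (suc (suc i))) →
    (∀ b → P (x′ 0) b + P (x′ 1) b ≡ P (x 0) b + P (x 1) b) →
    H (suc (suc k)) x′ + (h (x 0) + h (x 1) + P (x 0) (x 1)) ≡
    H (suc (suc k)) x + (h (x′ 0) + h (x′ 1) + P (x′ 0) (x′ 1))
  weight-firstTwo zero {x} {x′} eq P-eq =
    e (h (x 0)) (h (x 1)) (P (x 0) (x 1)) (h (x′ 0)) (h (x′ 1)) (P (x′ 0) (x′ 1))
    where
    e : ∀ a b p c d r →
      0ℤ + (c + 0ℤ) + (d + (0ℤ + r)) + (a + b + p) ≡
      0ℤ + (a + 0ℤ) + (b + (0ℤ + p)) + (c + d + r)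
    e = solve-∀
  weight-firstTwo (suc k) {x} {x′} eq P-eq = begin
    H l x′ + T x′ + z ≡⟨ e (H l x′) (T x′) z ⟩
    H l x′ + z + T x′
      ≡⟨ cong₂ _+_ (weight-firstTwo k (λ i i<k → eq i (ℕ.m<n⇒m<1+n i<k)) P-eq)
           (cong₂ _+_ (cong h (eq k ℕ.≤-refl))
             (trans (Σ-cong l λ i _ → cong (P (x′ i)) (eq k ℕ.≤-refl)) S-eq)) ⟩
    H l x + z′ + T x ≡⟨ e (H l x) z′ (T x) ⟩
    H l x + T x + z′ ∎
    where
    l = suc (suc k)
    z  = h (x 0) + h (x 1) + P (x 0) (x 1)
    z′ = h (x′ 0) + h (x′ 1) + P (x′ 0) (x′ 1)
    T : (ℕ → ℤ) → ℤ
    T y = h (y l) + Σ l λ i → P (y i) (y l)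
    S-eq : Σ l (λ i → P (x′ i) (x l)) ≡ Σ l (λ i → P (x i) (x l))
    S-eq = +-cancelʳ (P (x 0) (x l) + P (x 1) (x l)) (begin
      Σ l (λ i → P (x′ i) (x l)) + (P (x 0) (x l) + P (x 1) (x l))
        ≡⟨ Σ-firstTwo k (λ { i (s≤s (s≤s i<k)) →
             cong (λ y → P y (x l)) (eq i (ℕ.m<n⇒m<1+n i<k)) }) ⟩
      Σ l (λ i → P (x i) (x l)) + (P (x′ 0) (x l) + P (x′ 1) (x l))
        ≡⟨ cong (_+_ (Σ l (λ i → P (x i) (x l)))) (P-eq (x l)) ⟩
      Σ l (λ i → P (x i) (x l)) + (P (x 0) (x l) + P (x 1) (x l)) ∎)
    e : ∀ a b c → a + b + c ≡ a + c + b
    e = solve-∀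

-- Weights of level vectors

data Shape : Set where
  C D : Shape

startShape endShape : AffineType → Shape
startShape CC = C
startShape BB = D
startShape BD = C
startShape DD = D
endShape CC = C
endShape BB = C
endShape BD = D
endShape DD = D

offset : Shape → ℤ
offset C = 0ℤ
offset D = -1ℤ

x₀-offset : ∀ t → x₀ t ≡ offset (startShape t)
x₀-offset CC = refl
x₀-offset BB = refl
x₀-offset BD = refl
x₀-offset DD = refl

xₙ-offset : ∀ t → xₙ t ≡ offset (endShape t)
xₙ-offset CC = refl
xₙ-offset BB = refl
xₙ-offset BD = refl
xₙ-offset DD = refl

-- Counts the separating hyperplanes orthogonal to one coordinate axis.
axisWeight : AffineType → ℤ → ℤ
axisWeight t a = (1ℤ + x₀ t) ℤ.* + ∣ a ∣ + (1ℤ + xₙ t) ℤ.* g a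

-- The hyperplanes of the two directions `e_i - e_j` and `e_i + e_j`, at all integer heights.
pairWeight : ℤ → ℤ → ℤ
pairWeight a b = g (a - b) + g (a + b)

-- This is `F`. The types differ only in the axis terms: shape D at the start removes the
-- hyperplanes at half-integers, shape D at the end those at integers.
coweight : AffineType → ℕ → (ℕ → ℤ) → ℤ
coweight t = weight (axisWeight t) pairWeight

∣∣-nonpos : ∀ {v} → v ℤ.≤ 0ℤ → + ∣ v ∣ ≡ - v
∣∣-nonpos {+ zero}    p = refl
∣∣-nonpos {+[1+ k ]}  (+≤+ ())
∣∣-nonpos { -[1+ k ]} p = refl

∣∣-reflect-pos : ∀ {v} → 1ℤ ℤ.≤ v → + ∣ v ∣ ≡ 1ℤ + + ∣ 1ℤ - v ∣
∣∣-reflect-pos {v} 1≤v = begin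
  + ∣ v ∣                 ≡⟨ ℤ.0≤i⇒+∣i∣≡i (ℤ.≤-trans (+≤+ z≤n) 1≤v) ⟩
  v                       ≡⟨ e₁ v ⟩
  1ℤ + - (1ℤ - v)     ≡⟨ cong (_+_ 1ℤ) (sym (∣∣-nonpos {1ℤ - v} (≤-by (0≤-gap 1≤v) (e₂ v)))) ⟩
  1ℤ + + ∣ 1ℤ - v ∣   ∎
  where
  e₁ : ∀ v → v ≡ 1ℤ + - (1ℤ - v)
  e₁ = solve-∀
  e₂ : ∀ v → 0ℤ - (1ℤ - v) ≡ v - 1ℤ
  e₂ = solve-∀

∣∣-reflect-≤ : ∀ v → + ∣ v ∣ ℤ.≤ 1ℤ + + ∣ 1ℤ - v ∣
∣∣-reflect-≤ v with ≤0⊎1≤ v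
... | inj₂ 1≤v = ℤ.≤-reflexive (∣∣-reflect-pos 1≤v)
... | inj₁ v≤0 = subst₂ ℤ._≤_ (sym (∣∣-nonpos v≤0))
  (cong (_+_ 1ℤ) (sym (ℤ.0≤i⇒+∣i∣≡i (0≤-gap (ℤ.≤-trans v≤0 (+≤+ z≤n))))))
  (≤-by (0≤+ 2) (e v))
  where
  e : ∀ v → 1ℤ + (1ℤ - v) - (- v) ≡ + 2
  e = solve-∀

axisWeight-nonneg : ∀ t a → 0ℤ ℤ.≤ axisWeight t a
axisWeight-nonneg CC a = subst (ℤ._≤_ 0ℤ)
  (sym (cong₂ _+_ (ℤ.*-identityˡ (+ ∣ a ∣)) (ℤ.*-identityˡ (g a)))) (0≤+ ∣ a ∣ ⊞ g-nonneg a)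
axisWeight-nonneg BB a = subst (ℤ._≤_ 0ℤ)
  (sym (cong (_+_ 0ℤ) (ℤ.*-identityˡ (g a)))) (0≤+ 0 ⊞ g-nonneg a)
axisWeight-nonneg BD a = subst (ℤ._≤_ 0ℤ)
  (sym (cong (_+ 0ℤ) (ℤ.*-identityˡ (+ ∣ a ∣)))) (0≤+ ∣ a ∣ ⊞ 0≤+ 0)
axisWeight-nonneg DD a = ℤ.≤-refl

coweight-nonneg : ∀ t n x → 0ℤ ℤ.≤ coweight t n x
coweight-nonneg t n x = Σ-nonneg n _ λ j _ →
  axisWeight-nonneg t (x j) ⊞
  Σ-nonneg j _ λ i _ → g-nonneg (x i - x j) ⊞ g-nonneg (x i + x j)

coweight-zero : ∀ t n → coweight t n (λ _ → 0ℤ) ≡ 0ℤ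
coweight-zero t n = Σ-zero n _ λ j _ →
  cong₂ _+_ (cong₂ _+_ (ℤ.*-zeroʳ (1ℤ + x₀ t)) (ℤ.*-zeroʳ (1ℤ + xₙ t)))
    (Σ-zero j _ λ _ _ → refl)

-- Reflections in the walls of the alcove: `x j = x (j + 1)`, then `x = 0` or `x + y = 0` for the
-- last coordinates, and `x = 1/2` or `x + y = 1` for the first ones.
data Move (t : AffineType) (n : ℕ) (x x′ : ℕ → ℤ) : Set where
  inner  : ∀ j → Swapped n j x x′ → Move t n x x′
  endC   : ∀ k → endShape t ≡ C → n ≡ suc k → (∀ i → i < k → x′ i ≡ x i) →
           x′ k ≡ - x k → Move t n x x′
  endD   : ∀ k → endShape t ≡ D → n ≡ suc (suc k) → (∀ i → i < k → x′ i ≡ x i) →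
           x′ k ≡ - x (suc k) → x′ (suc k) ≡ - x k → Move t n x x′
  startC : ∀ k → startShape t ≡ C → n ≡ suc k → (∀ i → i < k → x′ (suc i) ≡ x (suc i)) →
           x′ 0 ≡ 1ℤ - x 0 → Move t n x x′
  startD : ∀ k → startShape t ≡ D → n ≡ suc (suc k) →
           (∀ i → i < k → x′ (suc (suc i)) ≡ x (suc (suc i))) →
           x′ 0 ≡ 1ℤ - x 1 → x′ 1 ≡ 1ℤ - x 0 → Move t n x x′

-- The wall of the move separates the vector from the alcove. For an integer, lying beyond `1/2`
-- means being at least `1`.
Descends : ∀ {t n x x′} → Move t n x x′ → Set
Descends {x = x} (inner j _)         = x j ℤ.< x (suc j)
Descends {x = x} (endC k _ _ _ _)   = x k ℤ.< 0ℤ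
Descends {x = x} (endD k _ _ _ _ _) = x k + x (suc k) ℤ.< 0ℤ
Descends {x = x} (startC _ _ _ _ _) = 1ℤ ℤ.≤ x 0
Descends {x = x} (startD _ _ _ _ _ _) = 1ℤ ℤ.< x 0 + x 1

-- How a move changes the weight

module _ {t : AffineType} where
  open Weight (axisWeight t) pairWeight

  private
    -- `a` and `b` are the terms of the weight touched by a move, before and after it. `bounded`
    -- yields the lower bound on lengths, `drop` the descent.
    record Exchange (w w′ : ℤ) (P : Set) : Set where
      constructor exchange
      field
        {a b}    : ℤ
        balanced : w′ + a ≡ w + b
        bounded  : a ℤ.≤ 1ℤ + b
        drop     : P → a ≡ 1ℤ + b

    scaled-≤ : ∀ {c} u {a b} → c ≡ 1ℤ → a ℤ.≤ 1ℤ + b → u + c ℤ.* a ℤ.≤ 1ℤ + (u + c ℤ.* b)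
    scaled-≤ u {a} {b} refl a≤1+b = ≤-by (0≤-gap a≤1+b) (e u a b)
      where
      e : ∀ u a b → 1ℤ + (u + 1ℤ ℤ.* b) - (u + 1ℤ ℤ.* a) ≡ 1ℤ + b - a
      e = solve-∀

    scaled-≡ : ∀ {c} u {a b} → c ≡ 1ℤ → a ≡ 1ℤ + b → u + c ℤ.* a ≡ 1ℤ + (u + c ℤ.* b)
    scaled-≡ u {a} {b} refl refl = e u b
      where
      e : ∀ u b → u + 1ℤ ℤ.* (1ℤ + b) ≡ 1ℤ + (u + 1ℤ ℤ.* b)
      e = solve-∀

    pairWeight-negʳ : ∀ a b → pairWeight a (- b) ≡ pairWeight a b
    pairWeight-negʳ a b =
      trans (ℤ.+-comm (g (a - - b)) _) (cong (λ v → g (a - b) + g (a + v)) (ℤ.neg-involutive b))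

    pairWeight-reflectˡ : ∀ a b → pairWeight (1ℤ - a) b ≡ pairWeight a b
    pairWeight-reflectˡ a b = trans (cong₂ _+_
        (trans (cong g (e₁ a b)) (g-reflect (a + b)))
        (trans (cong g (e₂ a b)) (g-reflect (a - b))))
      (ℤ.+-comm (g (a + b)) _)
      where
      e₁ : ∀ a b → 1ℤ - a - b ≡ 1ℤ - (a + b)
      e₁ = solve-∀
      e₂ : ∀ a b → 1ℤ - a + b ≡ 1ℤ - (a - b)
      e₂ = solve-∀

    -- With shape D at the end the integer hyperplanes are absent, and the half-integer ones are
    -- symmetric about `0`.
    axisWeight-end-D : endShape t ≡ D → ∀ a → axisWeight t (- a) ≡ axisWeight t a
    axisWeight-end-D eq a = cong₂ _+_
      (cong (λ v → (1ℤ + x₀ t) ℤ.* + v) (ℤ.∣-i∣≡∣i∣ a))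
      (trans (vanish (g (- a))) (sym (vanish (g a))))
      where
      vanish : ∀ v → (1ℤ + xₙ t) ℤ.* v ≡ 0ℤ
      vanish v rewrite xₙ-offset t | eq = ℤ.*-zeroˡ v

    axisWeight-start-D : startShape t ≡ D → ∀ a → axisWeight t (1ℤ - a) ≡ axisWeight t a
    axisWeight-start-D eq a = cong₂ _+_
      (trans (vanish (+ ∣ 1ℤ - a ∣)) (sym (vanish (+ ∣ a ∣))))
      (cong (ℤ._*_ (1ℤ + xₙ t)) (g-reflect a))
      where
      vanish : ∀ v → (1ℤ + x₀ t) ℤ.* v ≡ 0ℤ
      vanish v rewrite x₀-offset t | eq = ℤ.*-zeroˡ v

    end-unit : endShape t ≡ C → 1ℤ + xₙ t ≡ 1ℤ
    end-unit eq rewrite xₙ-offset t | eq = refl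

    start-unit : startShape t ≡ C → 1ℤ + x₀ t ≡ 1ℤ
    start-unit eq rewrite x₀-offset t | eq = refl

    Move-exchange : ∀ {n x x′} (m : Move t n x x′) →
      Exchange (coweight t n x) (coweight t n x′) (Descends m)
    Move-exchange {n} {x} (inner j s) = exchange (weight-Swapped n s)
      (≤-by (0≤-gap (g-negate-≤ (a - b))) e)
      (λ a<b → trans (cong (_+ g (a + b)) (g-negate-< {a - b} (<-by (0≤-gap< a<b) (e₃ a b))))
        (trans (ℤ.+-assoc 1ℤ (g (- (a - b))) _) (cong (_+_ 1ℤ) swapped)))
      where
      a = x j
      b = x (suc j)
      swapped : g (- (a - b)) + g (a + b) ≡ pairWeight b a
      swapped = cong₂ (λ u v → g u + g v) (e₁ a b) (ℤ.+-comm a b)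
        where
        e₁ : ∀ a b → - (a - b) ≡ b - a
        e₁ = solve-∀
      e : 1ℤ + pairWeight b a - pairWeight a b ≡ 1ℤ + g (- (a - b)) - g (a - b)
      e = trans (cong (λ u → 1ℤ + u - pairWeight a b) (sym swapped))
        (e₂ (g (- (a - b))) (g (a + b)) (g (a - b)))
        where
        e₂ : ∀ p q r → 1ℤ + (p + q) - (r + q) ≡ 1ℤ + p - r
        e₂ = solve-∀
      e₃ : ∀ a b → 0ℤ - (a - b) - 1ℤ ≡ b - a - 1ℤ
      e₃ = solve-∀
    Move-exchange {x = x} {x′} (endC k shape refl below last) = exchange
      (weight-last k below (λ a → trans (cong (pairWeight a) last) (pairWeight-negʳ a (x k))))
      (subst (λ u → axisWeight t (x k) ℤ.≤ 1ℤ + u) (sym negated)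
        (scaled-≤ (c ℤ.* + ∣ x k ∣) (end-unit shape) (g-negate-≤ (x k))))
      (λ x<0 → trans (scaled-≡ (c ℤ.* + ∣ x k ∣) (end-unit shape) (g-negate-< x<0))
        (cong (_+_ 1ℤ) (sym negated)))
      where
      c = 1ℤ + x₀ t
      negated : axisWeight t (x′ k) ≡ c ℤ.* + ∣ x k ∣ + (1ℤ + xₙ t) ℤ.* g (- x k)
      negated = trans (cong (axisWeight t) last)
        (cong (λ u → c ℤ.* + u + (1ℤ + xₙ t) ℤ.* g (- x k)) (ℤ.∣-i∣≡∣i∣ (x k)))
    Move-exchange {x = x} {x′} (endD k shape refl below last₁ last₂) = exchange
      (weight-lastTwo k below λ a → trans
        (cong₂ (λ u v → pairWeight a u + pairWeight a v) last₁ last₂)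
        (trans (cong₂ _+_ (pairWeight-negʳ a _) (pairWeight-negʳ a _)) (ℤ.+-comm (pairWeight a _) _)))
      (subst (λ u → h (x k) + h (x (suc k)) + pairWeight a b ℤ.≤ 1ℤ + u) (sym negated)
        (≤-by (0≤-gap (g-negate-≤ (a + b))) (e₂ (h a) (h b) (g (a - b)) (g (a + b)) (g (- (a + b))))))
      (λ a+b<0 → trans (cong (λ u → h a + h b + (g (a - b) + u)) (g-negate-< a+b<0))
        (trans (e₃ (h a) (h b) (g (a - b)) (g (- (a + b)))) (cong (_+_ 1ℤ) (sym negated))))
      where
      h = axisWeight t
      a = x k
      b = x (suc k)
      negated : h (x′ k) + h (x′ (suc k)) + pairWeight (x′ k) (x′ (suc k)) ≡
                h b + h a + (g (a - b) + g (- (a + b)))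
      negated = trans (cong₂ (λ u v → h u + h v + pairWeight u v) last₁ last₂)
        (cong₂ _+_ (cong₂ _+_ (axisWeight-end-D shape b) (axisWeight-end-D shape a))
          (cong₂ (λ u v → g u + g v) (p a b) (q a b)))
        where
        p : ∀ a b → - b - - a ≡ a - b
        p = solve-∀
        q : ∀ a b → - b + - a ≡ - (a + b)
        q = solve-∀
      e₂ : ∀ ha hb d s s′ →
        1ℤ + (hb + ha + (d + s′)) - (ha + hb + (d + s)) ≡ 1ℤ + s′ - s
      e₂ = solve-∀
      e₃ : ∀ ha hb d s → ha + hb + (d + (1ℤ + s)) ≡ 1ℤ + (hb + ha + (d + s))
      e₃ = solve-∀
    Move-exchange {x = x} {x′} (startC k shape refl above first) = exchange
      (weight-first k above (λ b → trans (cong (λ u → pairWeight u b) first) (pairWeight-reflectˡ (x 0) b)))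
      (subst₂ (λ u v → u ℤ.≤ 1ℤ + v) (ℤ.+-comm (c ℤ.* g (x 0)) _) (sym reflected)
        (scaled-≤ (c ℤ.* g (x 0)) (start-unit shape) (∣∣-reflect-≤ (x 0))))
      (λ 1≤x → trans (ℤ.+-comm _ (c ℤ.* g (x 0)))
        (trans (scaled-≡ (c ℤ.* g (x 0)) (start-unit shape) (∣∣-reflect-pos 1≤x))
          (cong (_+_ 1ℤ) (sym reflected))))
      where
      c = 1ℤ + xₙ t
      reflected : axisWeight t (x′ 0) ≡ c ℤ.* g (x 0) + (1ℤ + x₀ t) ℤ.* + ∣ 1ℤ - x 0 ∣
      reflected = trans (cong (axisWeight t) first)
        (trans (cong (λ u → (1ℤ + x₀ t) ℤ.* + ∣ 1ℤ - x 0 ∣ + c ℤ.* u) (g-reflect (x 0)))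
          (ℤ.+-comm _ (c ℤ.* g (x 0))))
    Move-exchange {x = x} {x′} (startD k shape refl above first₁ first₂) = exchange
      (weight-firstTwo k above λ b → trans
        (cong₂ (λ u v → pairWeight u b + pairWeight v b) first₁ first₂)
        (trans (cong₂ _+_ (pairWeight-reflectˡ (x 1) b) (pairWeight-reflectˡ (x 0) b))
          (ℤ.+-comm (pairWeight (x 1) b) (pairWeight (x 0) b))))
      (subst (λ u → h a + h b + pairWeight a b ℤ.≤ 1ℤ + u) (sym reflected)
        (≤-by (0≤-gap (g-reflect₂-≤ (a + b))) (e₂ (h a) (h b) (g (a - b)) (g (a + b)) (g (+ 2 - (a + b))))))
      (λ 1<a+b → trans (cong (λ u → h a + h b + (g (a - b) + u)) (g-reflect₂-> 1<a+b))
        (trans (e₃ (h a) (h b) (g (a - b)) (g (+ 2 - (a + b)))) (cong (_+_ 1ℤ) (sym reflected))))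
      where
      h = axisWeight t
      a = x 0
      b = x 1
      reflected : h (x′ 0) + h (x′ 1) + pairWeight (x′ 0) (x′ 1) ≡
                  h b + h a + (g (a - b) + g (+ 2 - (a + b)))
      reflected = trans (cong₂ (λ u v → h u + h v + pairWeight u v) first₁ first₂)
        (cong₂ _+_ (cong₂ _+_ (axisWeight-start-D shape b) (axisWeight-start-D shape a))
          (cong₂ (λ u v → g u + g v) (p a b) (q a b)))
        where
        p : ∀ a b → 1ℤ - b - (1ℤ - a) ≡ a - b
        p = solve-∀
        q : ∀ a b → 1ℤ - b + (1ℤ - a) ≡ + 2 - (a + b)
        q = solve-∀
      e₂ : ∀ ha hb d s s′ →
        1ℤ + (hb + ha + (d + s′)) - (ha + hb + (d + s)) ≡ 1ℤ + s′ - s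
      e₂ = solve-∀
      e₃ : ∀ ha hb d s → ha + hb + (d + (1ℤ + s)) ≡ 1ℤ + (hb + ha + (d + s))
      e₃ = solve-∀

  coweight-Move-≤ : ∀ {n x x′} → Move t n x x′ → coweight t n x ℤ.≤ 1ℤ + coweight t n x′
  coweight-Move-≤ {n} {x} {x′} m with Move-exchange m
  ... | exchange {a} {b} balanced bounded _ = ≤-by (0≤-gap bounded) (begin
    1ℤ + w′ - w                       ≡⟨ e₁ w w′ a ⟩
    1ℤ + (w′ + a) - a - w         ≡⟨ cong (λ u → 1ℤ + u - a - w) balanced ⟩
    1ℤ + (w + b) - a - w          ≡⟨ e₂ w a b ⟩
    1ℤ + b - a                        ∎)
    where
    w = coweight t n x
    w′ = coweight t n x′
    e₁ : ∀ w w′ a → 1ℤ + w′ - w ≡ 1ℤ + (w′ + a) - a - w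
    e₁ = solve-∀
    e₂ : ∀ w a b → 1ℤ + (w + b) - a - w ≡ 1ℤ + b - a
    e₂ = solve-∀

  coweight-descent : ∀ {n x x′} (m : Move t n x x′) → Descends m →
    coweight t n x ≡ 1ℤ + coweight t n x′
  coweight-descent {n} {x} {x′} m d with Move-exchange m
  ... | exchange {a} {b} balanced _ drop = +-cancelʳ b (begin
    w + b                ≡⟨ sym balanced ⟩
    w′ + a               ≡⟨ cong (_+_ w′) (drop d) ⟩
    w′ + (1ℤ + b)      ≡⟨ e w′ b ⟩
    1ℤ + w′ + b        ∎)
    where
    w = coweight t n x
    w′ = coweight t n x′
    e : ∀ w b → w + (1ℤ + b) ≡ 1ℤ + w + b
    e = solve-∀

-- Integer points of the closed alcove

Dominant : ℕ → (ℕ → ℤ) → Set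
Dominant n x = ∀ j → suc j < n → x (suc j) ℤ.≤ x j

findAscent : ∀ n x → (∃ λ j → suc j < n × x j ℤ.< x (suc j)) ⊎ Dominant n x
findAscent n x with ℕ.anyUpTo? (λ j → (suc j ℕ.<? n) ×-dec (x j ℤ.<? x (suc j))) n
... | yes (j , _ , 1+j<n , asc) = inj₁ (j , 1+j<n , asc)
... | no ¬asc = inj₂ λ j 1+j<n →
  ℤ.≮⇒≥ λ asc → ¬asc (j , ℕ.<-trans ℕ.≤-refl 1+j<n , 1+j<n , asc)

Dominant-antitone : ∀ {n x} → Dominant n x → ∀ {i j} → i ≤ j → j < n → x j ℤ.≤ x i
Dominant-antitone dom {i} {j} i≤j j<n with ℕ.m≤n⇒m<n∨m≡n i≤j
... | inj₂ refl = ℤ.≤-refl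
Dominant-antitone dom {i} {suc j} i≤j j<n | inj₁ (s≤s i≤j′) =
  ℤ.≤-trans (dom j j<n) (Dominant-antitone dom i≤j′ (ℕ.<-trans ℕ.≤-refl j<n))

EndOK StartOK : Shape → ℕ → (ℕ → ℤ) → Set
EndOK C n x = ∀ k → n ≡ suc k → 0ℤ ℤ.≤ x k
EndOK D n x = ∀ k → n ≡ suc (suc k) → 0ℤ ℤ.≤ x k + x (suc k)
StartOK C n x = x 0 ℤ.≤ 0ℤ
StartOK D n x = x 0 + x 1 ℤ.≤ 1ℤ

Terminal : ℕ → (ℕ → ℤ) → Set
Terminal n x = (x 0 ≡ 1ℤ) × (∀ i → suc i < n → x (suc i) ≡ 0ℤ)

private
  second-nonpos : ∀ s {n x} → Dominant (suc (suc n)) x → StartOK s (suc (suc n)) x → x 1 ℤ.≤ 0ℤ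
  second-nonpos C dom x≤0 = ℤ.≤-trans (dom 0 (s≤s (s≤s z≤n))) x≤0
  second-nonpos D {x = x} dom x+y≤1 with ≤0⊎1≤ (x 1)
  ... | inj₁ y≤0 = y≤0
  ... | inj₂ 1≤y = ⊥-elim (negative-absurd
    (0≤-gap 1≤y ⊞ 0≤-gap 1≤y ⊞ 0≤-gap (dom 0 (s≤s (s≤s z≤n))) ⊞ 0≤-gap x+y≤1) (e (x 0) (x 1)))
    where
    e : ∀ x y → y - 1ℤ + (y - 1ℤ) + (x - y) + (1ℤ - (x + y)) ≡ -1ℤ
    e = solve-∀

  all-nonneg : ∀ s {n x} → Dominant (suc (suc n)) x → EndOK s (suc (suc n)) x →
    (s ≡ D → 1 ≤ n) → x 1 ℤ.≤ 0ℤ → ∀ i → i < suc (suc n) → 0ℤ ℤ.≤ x i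
  all-nonneg C {n} dom end _ y≤0 i (s≤s i≤1+n) =
    ℤ.≤-trans (end (suc n) refl) (Dominant-antitone dom i≤1+n ℕ.≤-refl)
  all-nonneg D {n} {x} dom end 1≤n y≤0 i (s≤s i≤1+n) =
    ℤ.≤-trans last (Dominant-antitone dom i≤1+n ℕ.≤-refl)
    where
    e : ∀ a b → b - 0ℤ ≡ (a + b - 0ℤ) + (0ℤ - a)
    e = solve-∀
    last : 0ℤ ℤ.≤ x (suc n)
    last = ≤-by (0≤-gap (end n refl) ⊞
      0≤-gap (ℤ.≤-trans (Dominant-antitone dom (1≤n refl) (ℕ.m<n⇒m<1+n ℕ.≤-refl)) y≤0)) (e (x n) (x (suc n)))

-- The nonzero vector survives only if the wall `x + y = 1` replaces `x = 1/2`. If merely the sum of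
-- the last two coordinates is bounded below, the penultimate one must be at most `x 1`, hence
-- nonpositive, for the last to be nonnegative; this is where three coordinates enter.
terminal-cases : ∀ s s′ {n x} → 2 ≤ n → (s′ ≡ D → 3 ≤ n) → Dominant n x → EndOK s′ n x → StartOK s n x →
  (∀ i → i < n → x i ≡ 0ℤ) ⊎ (s ≡ D × Terminal n x)
terminal-cases s s′ {suc (suc n)} {x} (s≤s (s≤s _)) 3≤n dom end start = cases s start
  where
  y≤0 : x 1 ℤ.≤ 0ℤ
  y≤0 = second-nonpos s dom start
  0≤x : ∀ i → i < suc (suc n) → 0ℤ ℤ.≤ x i
  0≤x = all-nonneg s′ dom end (λ eq → ℕ.≤-pred (ℕ.≤-pred (3≤n eq))) y≤0
  rest : ∀ i → suc i < suc (suc n) → x (suc i) ≡ 0ℤ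
  rest i i< = ℤ.≤-antisym (ℤ.≤-trans (Dominant-antitone dom (s≤s z≤n) i<) y≤0) (0≤x (suc i) i<)
  zeros : x 0 ℤ.≤ 0ℤ → ∀ i → i < suc (suc n) → x i ≡ 0ℤ
  zeros x≤0 zero    i< = ℤ.≤-antisym x≤0 (0≤x 0 i<)
  zeros x≤0 (suc i) i< = rest i i<
  cases : ∀ s → StartOK s (suc (suc n)) x →
    (∀ i → i < suc (suc n) → x i ≡ 0ℤ) ⊎ (s ≡ D × Terminal (suc (suc n)) x)
  cases C x≤0 = inj₁ (zeros x≤0)
  cases D x+y≤1 with ≤0⊎1≤ (x 0)
  ... | inj₁ x≤0 = inj₁ (zeros x≤0)
  ... | inj₂ 1≤x = inj₂ (refl , ℤ.≤-antisym
    (subst (ℤ._≤ 1ℤ) (trans (cong (_+_ (x 0)) (rest 0 (s≤s (s≤s z≤n)))) (ℤ.+-identityʳ (x 0))) x+y≤1)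
    1≤x , rest)

-- Parity of coordinate sums

Even : ℤ → Set
Even z = ∃ λ k → z ≡ k + k

¬Even-1 : ¬ Even 1ℤ
¬Even-1 (+ suc k , eq) with trans eq (cong (λ z → + suc z) (ℕ.+-suc k k))
... | ()

Even-+ : ∀ {a b} → Even a → Even b → Even (a + b)
Even-+ (k , refl) (l , refl) = k + l , e k l
  where
  e : ∀ k l → k + k + (l + l) ≡ k + l + (k + l)
  e = solve-∀

Even-neg : ∀ {a} → Even a → Even (- a)
Even-neg (k , refl) = - k , ℤ.neg-distrib-+ k k

data ParityMove (n : ℕ) (x x′ : ℕ → ℤ) : Set where
  inner    : ∀ j → Swapped n j x x′ → ParityMove n x x′
  last     : ∀ k → n ≡ suc k → (∀ i → i < k → x′ i ≡ x i) → x′ k ≡ - x k → ParityMove n x x′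
  lastTwo  : ∀ c k → n ≡ suc (suc k) → (∀ i → i < k → x′ i ≡ x i) →
             x′ k ≡ c - x (suc k) → x′ (suc k) ≡ c - x k → ParityMove n x x′
  first    : ∀ k → n ≡ suc k → (∀ i → i < k → x′ (suc i) ≡ x (suc i)) → x′ 0 ≡ - x 0 →
             ParityMove n x x′
  firstTwo : ∀ c k → n ≡ suc (suc k) → (∀ i → i < k → x′ (suc (suc i)) ≡ x (suc (suc i))) →
             x′ 0 ≡ c - x 1 → x′ 1 ≡ c - x 0 → ParityMove n x x′

Even-ParityMove : ∀ {n x x′} → ParityMove n x x′ → Even (Σ n x) → Even (Σ n x′)
Even-ParityMove {n} (inner j s) even = subst Even (sym (Σ-Swapped n s)) even
Even-ParityMove {x = x} {x′} (last k refl below eq) even =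
  subst Even (sym (trans (cong₂ _+_ (Σ-cong k below) eq) (e (Σ k x) (x k))))
    (Even-+ even (- x k , refl))
  where
  e : ∀ s a → s + - a ≡ s + a + (- a + - a)
  e = solve-∀
Even-ParityMove {x = x} {x′} (lastTwo c k refl below eq₁ eq₂) even =
  subst Even (sym (trans (cong₂ _+_ (cong₂ _+_ (Σ-cong k below) eq₁) eq₂)
      (e (Σ k x) c (x k) (x (suc k)))))
    (Even-+ even (c - x k - x (suc k) , refl))
  where
  e : ∀ s c a b → s + (c - b) + (c - a) ≡ s + a + b + ((c - a - b) + (c - a - b))
  e = solve-∀
Even-ParityMove {x = x} {x′} (first k refl above eq) even =
  subst Even (sym (trans (Σ-cons k x′) (trans (cong₂ _+_ eq (Σ-cong k above)) (e (x 0) (Σ k (x ∘ suc))))))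
    (Even-+ (subst Even (Σ-cons k x) even) (- x 0 , refl))
  where
  e : ∀ a s → - a + s ≡ a + s + (- a + - a)
  e = solve-∀
Even-ParityMove {x = x} {x′} (firstTwo c k refl above eq₁ eq₂) even =
  subst Even (sym (begin
    S′                                           ≡⟨ e₁ S′ (x 0) (x 1) ⟩
    S′ + (x 0 + x 1) - (x 0 + x 1)
      ≡⟨ cong (_- (x 0 + x 1)) (Σ-firstTwo k (λ { i (s≤s (s≤s i<k)) → above i i<k })) ⟩
    S + (x′ 0 + x′ 1) - (x 0 + x 1)
      ≡⟨ cong₂ (λ u v → S + (u + v) - (x 0 + x 1)) eq₁ eq₂ ⟩
    S + ((c - x 1) + (c - x 0)) - (x 0 + x 1)
      ≡⟨ e₂ S c (x 0) (x 1) ⟩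
    S + ((c - x 0 - x 1) + (c - x 0 - x 1)) ∎))
    (Even-+ even (c - x 0 - x 1 , refl))
  where
  S = Σ (suc (suc k)) x
  S′ = Σ (suc (suc k)) x′
  e₁ : ∀ s a b → s ≡ s + (a + b) - (a + b)
  e₁ = solve-∀
  e₂ : ∀ s c a b → s + ((c - b) + (c - a)) - (a + b) ≡
    s + ((c - a - b) + (c - a - b))
  e₂ = solve-∀

-- Mirrored permutations

module Division (d : ℕ) .{{_ : NonZero d}} where
  private
    quotient-≤ : ∀ {r r′ q q′} → r < d → + r + q ℤ.* + d ≡ + r′ + q′ ℤ.* + d → q′ ℤ.≤ q
    quotient-≤ {r} {r′} {q} {q′} r<d eq with ≤-or-> q′ q
    ... | inj₁ q′≤q = q′≤q
    ... | inj₂ q<q′ = ⊥-elim (negative-absurd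
      (scaled ⊞ 0≤-gap< (+<+ r<d) ⊞ 0≤+ r′)
      (trans (e₁ (+ r) (+ r′) q q′ (+ d)) (trans (cong (λ z → z - (+ r + q ℤ.* + d) - 1ℤ) (sym eq))
        (e₂ (+ r + q ℤ.* + d)))))
      where
      scaled : 0ℤ ℤ.≤ (q′ - q - 1ℤ) ℤ.* + d
      scaled = ℤ.*-monoʳ-≤-nonNeg (+ d) (0≤-gap< q<q′)
      e₁ : ∀ r r′ q q′ d → (q′ - q - 1ℤ) ℤ.* d + (d - r - 1ℤ) + r′ ≡
        (r′ + q′ ℤ.* d) - (r + q ℤ.* d) - 1ℤ
      e₁ = solve-∀
      e₂ : ∀ z → z - z - 1ℤ ≡ -1ℤ
      e₂ = solve-∀

  quotient-unique : ∀ {r r′ q q′} → r < d → r′ < d →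
    + r + q ℤ.* + d ≡ + r′ + q′ ℤ.* + d → (r ≡ r′) × (q ≡ q′)
  quotient-unique {r} {r′} {q} {q′} r<d r′<d eq = r≡r′ , q≡q′
    where
    q≡q′ : q ≡ q′
    q≡q′ = ℤ.≤-antisym (quotient-≤ r′<d (sym eq)) (quotient-≤ r<d eq)
    r≡r′ : r ≡ r′
    r≡r′ = ℤ.+-injective (+-cancelʳ (q ℤ.* + d) (trans eq (cong (λ z → + r′ + z ℤ.* + d) (sym q≡q′))))

  division : ∀ i → i ≡ + (i %ℕ d) + (i /ℕ d) ℤ.* + d
  division i = a≡a%ℕn+[a/ℕn]*n i d

  %ℕ-unique : ∀ {i r} q → r < d → i ≡ + r + q ℤ.* + d → i %ℕ d ≡ r
  %ℕ-unique {i} q r<d eq =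
    proj₁ (quotient-unique {q = i /ℕ d} {q} (n%ℕd<d i d) r<d (trans (sym (division i)) eq))

  /ℕ-unique : ∀ {i r} q → r < d → i ≡ + r + q ℤ.* + d → i /ℕ d ≡ q
  /ℕ-unique {i} q r<d eq =
    proj₂ (quotient-unique {q = i /ℕ d} {q} (n%ℕd<d i d) r<d (trans (sym (division i)) eq))

  /ℕ-shift : ∀ i k → (i + k ℤ.* + d) /ℕ d ≡ i /ℕ d + k
  /ℕ-shift i k = /ℕ-unique (i /ℕ d + k) (n%ℕd<d i d)
    (trans (cong (_+ k ℤ.* + d) (division i)) (e (+ (i %ℕ d)) (i /ℕ d) k (+ d)))
    where
    e : ∀ r q k d → r + q ℤ.* d + k ℤ.* d ≡ r + (q + k) ℤ.* d
    e = solve-∀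

  %ℕ-shift : ∀ i k → (i + k ℤ.* + d) %ℕ d ≡ i %ℕ d
  %ℕ-shift i k = %ℕ-unique (i /ℕ d + k) (n%ℕd<d i d)
    (trans (cong (_+ k ℤ.* + d) (division i)) (e (+ (i %ℕ d)) (i /ℕ d) k (+ d)))
    where
    e : ∀ r q k d → r + q ℤ.* d + k ℤ.* d ≡ r + (q + k) ℤ.* d
    e = solve-∀

  0≤/ℕ : ∀ {i} → 0ℤ ℤ.≤ i → 0ℤ ℤ.≤ i /ℕ d
  0≤/ℕ {+ m} _ = 0≤+ _

  /ℕ-nonneg⁻¹ : ∀ {i} → 0ℤ ℤ.≤ i /ℕ d → 0ℤ ℤ.≤ i
  /ℕ-nonneg⁻¹ {i} 0≤q = subst (ℤ._≤_ 0ℤ) (sym (division i))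
    (0≤+ (i %ℕ d) ⊞ ℤ.*-monoʳ-≤-nonNeg (+ d) 0≤q)

-- Residues are taken from `0` and `±1, …, ±n`, because negation then merely exchanges the last two
-- cases.
data Class (n : ℕ) (i : ℤ) : Set where
  zeroᶜ : ∀ k → i ≡ k ℤ.* + N n → Class n i
  posᶜ  : ∀ c k → c < n → i ≡ + suc c + k ℤ.* + N n → Class n i
  negᶜ  : ∀ c k → c < n → i ≡ - + suc c + k ℤ.* + N n → Class n i

N-split : ∀ n r → r < N n → n < r → ∃ λ c → c < n × r ℕ.+ suc c ≡ N n
N-split n r r<N n<r = N n ℕ.∸ suc r , c<n , sum
  where
  sum : r ℕ.+ suc (N n ℕ.∸ suc r) ≡ N n
  sum = trans (ℕ.+-suc r _) (ℕ.m+[n∸m]≡n r<N)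
  c<n : N n ℕ.∸ suc r < n
  c<n = ℕ.+-cancelˡ-≤ n _ _ (ℕ.≤-pred (ℕ.≤-trans
    (ℕ.≤-trans (ℕ.+-monoˡ-≤ (suc (N n ℕ.∸ suc r)) n<r) (ℕ.≤-reflexive sum))
    (ℕ.≤-reflexive (cong (λ z → suc (n ℕ.+ z)) (ℕ.+-identityʳ n)))))

classify : ∀ n i → Class n i
classify n i = go (i %ℕ N n) refl
  where
  open Division (N n)
  q = i /ℕ N n
  eq : ∀ {r} → i %ℕ N n ≡ r → i ≡ + r + q ℤ.* + N n
  eq refl = division i
  go : ∀ r → i %ℕ N n ≡ r → Class n i
  go zero    r-eq = zeroᶜ q (trans (eq r-eq) (ℤ.+-identityˡ _))
  go (suc c) r-eq with suc c ℕ.≤? n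
  ... | yes c<n = posᶜ c q c<n (eq r-eq)
  ... | no c≮n with N-split n (suc c) (subst (_< N n) r-eq (n%ℕd<d i (N n))) (ℕ.≰⇒> c≮n)
  ...   | c′ , c′<n , sum = negᶜ c′ (q + 1ℤ) c′<n (trans (eq r-eq)
    (trans (e₁ (+ suc c) (+ suc c′) q (+ N n)) (trans
      (cong (λ z → - + suc c′ + z + q ℤ.* + N n) (cong +_ sum)) (e₂ (- + suc c′) q (+ N n)))))
    where
    e₁ : ∀ a b q d → a + q ℤ.* d ≡ - b + (a + b) + q ℤ.* d
    e₁ = solve-∀
    e₂ : ∀ b q d → b + d + q ℤ.* d ≡ b + (q + 1ℤ) ℤ.* d
    e₂ = solve-∀

-- Bijectivity is kept separate: for the generators it comes from involutivity, whose proof already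
-- relies on these two symmetries.
record Mirrored (n : ℕ) (f : ℤ → ℤ) : Set where
  field
    periodic : ∀ i → f (i + + N n) ≡ f i + + N n
    odd      : ∀ i → f (- i) ≡ - f i

module _ {n : ℕ} where
  open Mirrored

  private
    d : ℤ
    d = + N n

  at-0 : ∀ {f} → Mirrored n f → f 0ℤ ≡ 0ℤ
  at-0 {f} mir = go (f 0ℤ) (odd mir 0ℤ)
    where
    go : ∀ v → v ≡ - v → v ≡ 0ℤ
    go (+ zero)  _ = refl
    go +[1+ k ] ()
    go -[1+ k ] ()

  private
    shift-+ : ∀ {f} → Mirrored n f → ∀ i k → f (i + + k ℤ.* d) ≡ f i + + k ℤ.* d
    shift-+ {f} mir i zero = trans (cong f (e i d)) (sym (e (f i) d))
      where
      e : ∀ i d → i + 0ℤ ℤ.* d ≡ i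
      e = solve-∀
    shift-+ {f} mir i (suc k) = begin
      f (i + + suc k ℤ.* d)    ≡⟨ cong f (e i (+ k) d) ⟩
      f (i + + k ℤ.* d + d)  ≡⟨ periodic mir _ ⟩
      f (i + + k ℤ.* d) + d  ≡⟨ cong (_+ d) (shift-+ mir i k) ⟩
      f i + + k ℤ.* d + d    ≡⟨ sym (e (f i) (+ k) d) ⟩
      f i + + suc k ℤ.* d      ∎
      where
      e : ∀ i k d → i + (1ℤ + k) ℤ.* d ≡ i + k ℤ.* d + d
      e = solve-∀

  shift : ∀ {f} → Mirrored n f → ∀ i k → f (i + k ℤ.* d) ≡ f i + k ℤ.* d
  shift mir i (+ k) = shift-+ mir i k
  shift {f} mir i k@(-[1+ k′ ]) = begin
    f (i + k ℤ.* d)                          ≡⟨ e₁ (f (i + k ℤ.* d)) k d ⟩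
    f (i + k ℤ.* d) + (- k) ℤ.* d + k ℤ.* d
      ≡⟨ cong (_+ k ℤ.* d) (sym (shift-+ mir (i + k ℤ.* d) (suc k′))) ⟩
    f (i + k ℤ.* d + (- k) ℤ.* d) + k ℤ.* d
      ≡⟨ cong (λ z → f z + k ℤ.* d) (e₂ i k d) ⟩
    f i + k ℤ.* d ∎
    where
    e₁ : ∀ z k d → z ≡ z + (- k) ℤ.* d + k ℤ.* d
    e₁ = solve-∀
    e₂ : ∀ i k d → i + k ℤ.* d + (- k) ℤ.* d ≡ i
    e₂ = solve-∀

  at-multiple : ∀ {f} → Mirrored n f → ∀ k → f (k ℤ.* d) ≡ k ℤ.* d
  at-multiple {f} mir k = begin
    f (k ℤ.* d)          ≡⟨ cong f (sym (ℤ.+-identityˡ _)) ⟩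
    f (0ℤ + k ℤ.* d)   ≡⟨ shift mir 0ℤ k ⟩
    f 0ℤ + k ℤ.* d     ≡⟨ cong (_+ k ℤ.* d) (at-0 mir) ⟩
    0ℤ + k ℤ.* d       ≡⟨ ℤ.+-identityˡ _ ⟩
    k ℤ.* d              ∎

  -- Every integer is congruent to `0` or, up to sign, to a window element. Identities between group
  -- elements, and later their decidability, are thereby reduced to `n` values.
  Mirrored-ext : ∀ {f f′} → Mirrored n f → Mirrored n f′ →
    (∀ c → c < n → f (+ suc c) ≡ f′ (+ suc c)) → f ≗ f′
  Mirrored-ext {f} {f′} mir mir′ eq i with classify n i
  ... | zeroᶜ k refl = trans (at-multiple mir k) (sym (at-multiple mir′ k))
  ... | posᶜ c k c<n refl = trans (shift mir (+ suc c) k)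
    (trans (cong (_+ k ℤ.* d) (eq c c<n)) (sym (shift mir′ (+ suc c) k)))
  ... | negᶜ c k c<n refl = trans (shift mir (- + suc c) k)
    (trans (cong (_+ k ℤ.* d) (trans (odd mir (+ suc c)) (trans (cong -_ (eq c c<n)) (sym (odd mir′ (+ suc c))))))
      (sym (shift mir′ (- + suc c) k)))

  Mirrored-id : Mirrored n id
  Mirrored-id .periodic i = refl
  Mirrored-id .odd i = refl

  Mirrored-∘ : ∀ {f f′} → Mirrored n f → Mirrored n f′ → Mirrored n (f ∘ f′)
  Mirrored-∘ {f} mir mir′ .periodic i = trans (cong f (periodic mir′ i)) (periodic mir _)
  Mirrored-∘ {f} mir mir′ .odd i = trans (cong f (odd mir′ i)) (odd mir _)

  Mirrored-inverse : ∀ {f f⁻¹} → Mirrored n f → (∀ i → f (f⁻¹ i) ≡ i) → (∀ i → f⁻¹ (f i) ≡ i) →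
    Mirrored n f⁻¹
  Mirrored-inverse {f} {f⁻¹} mir inv inv′ .periodic i = begin
    f⁻¹ (i + d)               ≡⟨ cong (λ z → f⁻¹ (z + d)) (sym (inv i)) ⟩
    f⁻¹ (f (f⁻¹ i) + d)       ≡⟨ cong f⁻¹ (sym (periodic mir (f⁻¹ i))) ⟩
    f⁻¹ (f (f⁻¹ i + d))       ≡⟨ inv′ _ ⟩
    f⁻¹ i + d                 ∎
  Mirrored-inverse {f} {f⁻¹} mir inv inv′ .odd i = begin
    f⁻¹ (- i)               ≡⟨ cong (λ z → f⁻¹ (- z)) (sym (inv i)) ⟩
    f⁻¹ (- f (f⁻¹ i))       ≡⟨ cong f⁻¹ (sym (odd mir (f⁻¹ i))) ⟩
    f⁻¹ (f (- f⁻¹ i))       ≡⟨ inv′ _ ⟩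
    - f⁻¹ i                 ∎

private
  -- A copy of the local function of `fromWindow`, which cannot be named from outside.
  residueValue : ℕ → (ℕ → ℤ) → ℕ → ℤ
  residueValue n f zero      = 0ℤ
  residueValue n f r@(suc _) = if r ℕ.≤ᵇ n then f r else + N n - f (N n ℕ.∸ r)

  fromWindow-residue : ∀ n f i →
    fromWindow n f i ≡ residueValue n f (i %ℕ N n) + (i /ℕ N n) ℤ.* + N n
  fromWindow-residue n f i with i %ℕ N n
  ... | zero  = refl
  ... | suc r = refl

  fromWindow-at : ∀ n f {i r} q → r < N n → i ≡ + r + q ℤ.* + N n →
    fromWindow n f i ≡ residueValue n f r + q ℤ.* + N n
  fromWindow-at n f {i} q r<N eq = trans (fromWindow-residue n f i)
    (cong₂ (λ r q → residueValue n f r + q ℤ.* + N n) (%ℕ-unique q r<N eq) (/ℕ-unique q r<N eq))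
    where open Division (N n)

  residueValue-low : ∀ n f c → c < n → residueValue n f (suc c) ≡ f (suc c)
  residueValue-low n f c c<n with suc c ℕ.≤ᵇ n in eq
  ... | true  = refl
  ... | false = ⊥-elim (subst Bool.T eq (ℕ.≤⇒≤ᵇ c<n))

  residueValue-high : ∀ n f c → c < n → residueValue n f (N n ℕ.∸ suc c) ≡ + N n - f (suc c)
  residueValue-high n f c c<n = go (N n ℕ.∸ suc c) refl
    where
    1+c≤N : suc c ≤ N n
    1+c≤N = ℕ.≤-trans c<n (ℕ.m≤n⇒m≤1+n (ℕ.m≤m+n n _))
    n<r : n < N n ℕ.∸ suc c
    n<r = ℕ.+-cancelʳ-≤ (suc c) _ _ (ℕ.≤-trans (ℕ.+-monoʳ-≤ (suc n) c<n)
      (ℕ.≤-reflexive (trans (cong (λ z → suc (n ℕ.+ z)) (sym (ℕ.+-identityʳ n))) (sym (ℕ.m∸n+n≡m 1+c≤N)))))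
    go : ∀ r → N n ℕ.∸ suc c ≡ r → residueValue n f r ≡ + N n - f (suc c)
    go zero    r-eq = ⊥-elim (ℕ.n≮0 (subst (n <_) r-eq n<r))
    go (suc r) r-eq with suc r ℕ.≤ᵇ n in eq
    ... | true  = ⊥-elim (ℕ.<⇒≱ n<r (subst (_≤ n) (sym r-eq) (ℕ.≤ᵇ⇒≤ (suc r) n (subst Bool.T (sym eq) _))))
    ... | false = cong (λ z → + N n - f z) (trans (cong (N n ℕ.∸_) (sym r-eq)) (ℕ.m∸[m∸n]≡n 1+c≤N))

  fromWindow-pos : ∀ n f c k → c < n →
    fromWindow n f (+ suc c + k ℤ.* + N n) ≡ f (suc c) + k ℤ.* + N n
  fromWindow-pos n f c k c<n = trans
    (fromWindow-at n f k (s≤s (ℕ.≤-trans c<n (ℕ.m≤m+n n _))) refl)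
    (cong (_+ k ℤ.* + N n) (residueValue-low n f c c<n))

  fromWindow-neg : ∀ n f c k → c < n →
    fromWindow n f (- + suc c + k ℤ.* + N n) ≡ - f (suc c) + k ℤ.* + N n
  fromWindow-neg n f c k c<n = trans
    (fromWindow-at n f (k - 1ℤ) r<N
      (trans (e₁ (- + suc c) k (+ N n)) (cong (_+ (k - 1ℤ) ℤ.* + N n) r-eq)))
    (trans (cong (_+ (k - 1ℤ) ℤ.* + N n) (residueValue-high n f c c<n)) (e₂ (f (suc c)) k (+ N n)))
    where
    r<N : N n ℕ.∸ suc c < N n
    r<N = s≤s (ℕ.m∸n≤m _ c)
    1+c≤N : suc c ≤ N n
    1+c≤N = ℕ.≤-trans c<n (ℕ.m≤n⇒m≤1+n (ℕ.m≤m+n n _))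
    r-eq : - + suc c + + N n ≡ + (N n ℕ.∸ suc c)
    r-eq = trans (ℤ.-m+n≡n⊖m (suc c) (N n)) (ℤ.⊖-≥ 1+c≤N)
    e₁ : ∀ a k d → a + k ℤ.* d ≡ a + d + (k - 1ℤ) ℤ.* d
    e₁ = solve-∀
    e₂ : ∀ a k d → d - a + (k - 1ℤ) ℤ.* d ≡ - a + k ℤ.* d
    e₂ = solve-∀

  fromWindow-zero : ∀ n f k → fromWindow n f (k ℤ.* + N n) ≡ k ℤ.* + N n
  fromWindow-zero n f k = trans
    (fromWindow-at n f {k ℤ.* + N n} k (s≤s z≤n) (sym (ℤ.+-identityˡ (k ℤ.* + N n))))
    (ℤ.+-identityˡ (k ℤ.* + N n))

fromWindow-window : ∀ n f c → c < n → fromWindow n f (+ suc c) ≡ f (suc c)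
fromWindow-window n f c c<n = trans (cong (fromWindow n f) (sym (e (+ suc c) (+ N n))))
  (trans (fromWindow-pos n f c 0ℤ c<n) (e (f (suc c)) (+ N n)))
  where
  e : ∀ a d → a + 0ℤ ℤ.* d ≡ a
  e = solve-∀

Mirrored-fromWindow : ∀ n f → Mirrored n (fromWindow n f)
Mirrored-fromWindow n f = record { periodic = periodic; odd = odd }
  where
  F = fromWindow n f
  d = + N n
  e₀ : ∀ a k d → a + k ℤ.* d + d ≡ a + (k + 1ℤ) ℤ.* d
  e₀ = solve-∀
  e₁ : ∀ k d → k ℤ.* d + d ≡ (k + 1ℤ) ℤ.* d
  e₁ = solve-∀
  e₂ : ∀ a k d → - (a + k ℤ.* d) ≡ - a + (- k) ℤ.* d
  e₂ = solve-∀
  e₃ : ∀ a k d → - (- a + k ℤ.* d) ≡ a + (- k) ℤ.* d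
  e₃ = solve-∀
  periodic : ∀ i → F (i + d) ≡ F i + d
  periodic i with classify n i
  ... | zeroᶜ k refl = trans (cong F (e₁ k d)) (trans (fromWindow-zero n f (k + 1ℤ))
    (trans (sym (e₁ k d)) (cong (_+ d) (sym (fromWindow-zero n f k)))))
  ... | posᶜ c k c<n refl = trans (cong F (e₀ (+ suc c) k d)) (trans (fromWindow-pos n f c (k + 1ℤ) c<n)
    (trans (sym (e₀ (f (suc c)) k d)) (cong (_+ d) (sym (fromWindow-pos n f c k c<n)))))
  ... | negᶜ c k c<n refl = trans (cong F (e₀ (- + suc c) k d)) (trans (fromWindow-neg n f c (k + 1ℤ) c<n)
    (trans (sym (e₀ (- f (suc c)) k d)) (cong (_+ d) (sym (fromWindow-neg n f c k c<n)))))
  odd : ∀ i → F (- i) ≡ - F i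
  odd i with classify n i
  ... | zeroᶜ k refl = trans (cong F (ℤ.neg-distribˡ-* k d)) (trans (fromWindow-zero n f (- k))
    (trans (sym (ℤ.neg-distribˡ-* k d)) (cong -_ (sym (fromWindow-zero n f k)))))
  ... | posᶜ c k c<n refl = trans (cong F (e₂ (+ suc c) k d)) (trans (fromWindow-neg n f c (- k) c<n)
    (trans (sym (e₂ (f (suc c)) k d)) (cong -_ (sym (fromWindow-pos n f c k c<n)))))
  ... | negᶜ c k c<n refl = trans (cong F (e₃ (+ suc c) k d)) (trans (fromWindow-pos n f c (- k) c<n)
    (trans (sym (e₃ (f (suc c)) k d)) (cong -_ (sym (fromWindow-neg n f c k c<n)))))

-- The generators

moveWindow : AffineType → ℕ → ℕ → ℕ → ℤ
moveWindow t n k = if k ≡ᵇ 0 then window₀ t else if k ≡ᵇ n then windowₙ t n else swap k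

-- generator t n i is, by computation, move t n (toℕ i).
move : AffineType → ℕ → ℕ → ℤ → ℤ
move t n k = fromWindow n (moveWindow t n k)

Mirrored-move : ∀ t n k → Mirrored n (move t n k)
Mirrored-move t n k = Mirrored-fromWindow n (moveWindow t n k)

record IsInner (n j : ℕ) (s : ℤ → ℤ) : Set where
  field
    inside : suc j < n
    at-j   : s (+ suc j) ≡ + suc (suc j)
    at-1+j : s (+ suc (suc j)) ≡ + suc j
    fixed  : ∀ c → c < n → c ≢ j → c ≢ suc j → s (+ suc c) ≡ + suc c

data IsStart (n : ℕ) (s : ℤ → ℤ) : Shape → Set where
  startC : s (+ 1) ≡ - + 1 → (∀ c → suc c < n → s (+ suc (suc c)) ≡ + suc (suc c)) → IsStart n s C
  startD : s (+ 1) ≡ - + 2 → s (+ 2) ≡ - + 1 →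
           (∀ c → suc (suc c) < n → s (+ suc (suc (suc c))) ≡ + suc (suc (suc c))) → IsStart n s D

-- The images `n + 1` and `n + 2` are written in the form `- c + N`, at which `EndReflects`
-- evaluates a function.
data IsEnd (s : ℤ → ℤ) : ℕ → Shape → Set where
  endC : ∀ {k} → s (+ suc k) ≡ - + suc k + + N (suc k) →
         (∀ c → c < k → s (+ suc c) ≡ + suc c) → IsEnd s (suc k) C
  endD : ∀ {k} → s (+ suc k) ≡ - + suc (suc k) + + N (suc (suc k)) →
         s (+ suc (suc k)) ≡ - + suc k + + N (suc (suc k)) →
         (∀ c → c < k → s (+ suc c) ≡ + suc c) → IsEnd s (suc (suc k)) D

private
  ≡ᵇ-refl : ∀ m → (m ≡ᵇ m) ≡ true
  ≡ᵇ-refl zero    = refl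
  ≡ᵇ-refl (suc m) = ≡ᵇ-refl m

  ≢⇒≡ᵇ-false : ∀ {m k} → m ≢ k → (m ≡ᵇ k) ≡ false
  ≢⇒≡ᵇ-false {m} {k} m≢k with m ≡ᵇ k in eq
  ... | true  = ⊥-elim (m≢k (ℕ.≡ᵇ⇒≡ m k (subst Bool.T (sym eq) _)))
  ... | false = refl

  swap-left : ∀ i → swap i i ≡ + suc i
  swap-left i rewrite ≡ᵇ-refl i = refl

  swap-right : ∀ i → swap i (suc i) ≡ + i
  swap-right i rewrite ≢⇒≡ᵇ-false (ℕ.1+n≢n {i}) | ≡ᵇ-refl i = refl

  swap-other : ∀ i j → j ≢ i → j ≢ suc i → swap i j ≡ + j
  swap-other i j j≢i j≢1+i rewrite ≢⇒≡ᵇ-false j≢i | ≢⇒≡ᵇ-false j≢1+i = refl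

  sₙC-last : ∀ k → sₙC (suc k) (suc k) ≡ - + suc k + + N (suc k)
  sₙC-last k rewrite ≡ᵇ-refl k = trans (ℤ.pos-+ (suc k) 1) (trans (e (+ suc k))
      (cong (λ z → - + suc k + (1ℤ + (+ suc k + z))) (cong +_ (sym (ℕ.+-identityʳ (suc k))))))
    where
    e : ∀ k → k + 1ℤ ≡ - k + (1ℤ + (k + k))
    e = solve-∀

  sₙC-other : ∀ n j → j ≢ n → sₙC n j ≡ + j
  sₙC-other n j j≢n rewrite ≢⇒≡ᵇ-false j≢n = refl

  sₙD-last : ∀ k → sₙD (suc (suc k)) (suc (suc k)) ≡ - + suc k + + N (suc (suc k))
  sₙD-last k rewrite ≢⇒≡ᵇ-false (ℕ.1+n≢n {k}) | ≡ᵇ-refl k =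
    trans (ℤ.pos-+ (suc (suc k)) 2) (trans (e (+ suc k))
      (cong (λ z → - + suc k + (1ℤ + (+ suc (suc k) + z))) (cong +_ (sym (ℕ.+-identityʳ (suc (suc k)))))))
    where
    e : ∀ k → 1ℤ + k + + 2 ≡ - k + (1ℤ + ((1ℤ + k) + (1ℤ + k)))
    e = solve-∀

  sₙD-penultimate : ∀ k → sₙD (suc (suc k)) (suc k) ≡ - + suc (suc k) + + N (suc (suc k))
  sₙD-penultimate k rewrite ≡ᵇ-refl k =
    trans (ℤ.pos-+ (suc (suc k)) 1) (trans (e (+ suc (suc k)))
      (cong (λ z → - + suc (suc k) + (1ℤ + (+ suc (suc k) + z)))
        (cong +_ (sym (ℕ.+-identityʳ (suc (suc k)))))))
    where
    e : ∀ k → k + 1ℤ ≡ - k + (1ℤ + (k + k))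
    e = solve-∀

  sₙD-other : ∀ n j → suc j ≢ n → j ≢ n → sₙD n j ≡ + j
  sₙD-other n j 1+j≢n j≢n rewrite ≢⇒≡ᵇ-false 1+j≢n | ≢⇒≡ᵇ-false j≢n = refl

  moveWindow-inner : ∀ t n j → suc j < n → moveWindow t n (suc j) ≡ swap (suc j)
  moveWindow-inner t n j 1+j<n rewrite ≢⇒≡ᵇ-false (ℕ.<⇒≢ 1+j<n) = refl

  moveWindow-end : ∀ t n → moveWindow t (suc n) (suc n) ≡ windowₙ t (suc n)
  moveWindow-end t n rewrite ≡ᵇ-refl n = refl

  isEndC : ∀ n → IsEnd (fromWindow (suc n) (sₙC (suc n))) (suc n) C
  isEndC k = endC
    (trans (fromWindow-window (suc k) (sₙC (suc k)) k ℕ.≤-refl) (sₙC-last k))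
    (λ c c<k → trans (fromWindow-window (suc k) (sₙC (suc k)) c (ℕ.m<n⇒m<1+n c<k))
      (sₙC-other (suc k) (suc c) (ℕ.<⇒≢ (s≤s c<k))))

  isEndD : ∀ k → IsEnd (fromWindow (suc (suc k)) (sₙD (suc (suc k)))) (suc (suc k)) D
  isEndD k = endD
    (trans (fromWindow-window n (sₙD n) k (ℕ.m<n⇒m<1+n ℕ.≤-refl)) (sₙD-penultimate k))
    (trans (fromWindow-window n (sₙD n) (suc k) ℕ.≤-refl) (sₙD-last k))
    (λ c c<k → trans (fromWindow-window n (sₙD n) c (ℕ.m<n⇒m<1+n (ℕ.m<n⇒m<1+n c<k)))
      (sₙD-other n (suc c) (ℕ.<⇒≢ (s≤s (s≤s c<k))) (ℕ.<⇒≢ (s≤s (ℕ.m<n⇒m<1+n c<k)))))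
    where n = suc (suc k)

  isStartC : ∀ n → IsStart (suc n) (fromWindow (suc n) s₀C) C
  isStartC n = startC (fromWindow-window (suc n) s₀C 0 (s≤s z≤n))
    (λ c c<n → fromWindow-window (suc n) s₀C (suc c) c<n)

  isStartD : ∀ n → IsStart (suc (suc n)) (fromWindow (suc (suc n)) s₀D) D
  isStartD n = startD (fromWindow-window (suc (suc n)) s₀D 0 (s≤s z≤n))
    (fromWindow-window (suc (suc n)) s₀D 1 (s≤s (s≤s z≤n)))
    (λ c c<n → fromWindow-window (suc (suc n)) s₀D (suc (suc c)) c<n)

isInner : ∀ t n j → suc j < n → IsInner n j (move t n (suc j))
isInner t n j 1+j<n rewrite moveWindow-inner t n j 1+j<n = record
  { inside = 1+j<n
  ; at-j   = trans (fromWindow-window n (swap (suc j)) j (ℕ.<-trans ℕ.≤-refl 1+j<n)) (swap-left (suc j))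
  ; at-1+j = trans (fromWindow-window n (swap (suc j)) (suc j) 1+j<n) (swap-right (suc j))
  ; fixed  = λ c c<n c≢j c≢1+j → trans (fromWindow-window n (swap (suc j)) c c<n)
      (swap-other (suc j) (suc c) (c≢j ∘ ℕ.suc-injective) (c≢1+j ∘ ℕ.suc-injective))
  }

isStart : ∀ t n → IsStart (suc (suc n)) (move t (suc (suc n)) 0) (startShape t)
isStart CC n = isStartC (suc n)
isStart BB n = isStartD n
isStart BD n = isStartC (suc n)
isStart DD n = isStartD n

isEnd : ∀ t n → IsEnd (move t (suc (suc n)) (suc (suc n))) (suc (suc n)) (endShape t)
isEnd t n rewrite moveWindow-end t (suc n) = go t
  where
  go : ∀ t → IsEnd (fromWindow (suc (suc n)) (windowₙ t (suc (suc n)))) (suc (suc n)) (endShape t)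
  go CC = isEndC (suc n)
  go BB = isEndC (suc n)
  go BD = isEndD n
  go DD = isEndD n

data Kind (t : AffineType) (n : ℕ) : ℕ → (ℤ → ℤ) → Set where
  inner : ∀ {s} j → IsInner n j s → Kind t n (suc j) s
  start : ∀ {s} → IsStart n s (startShape t) → Kind t n 0 s
  end   : ∀ {s} → IsEnd s n (endShape t) → Kind t n n s

kind : ∀ t {n} → 2 ≤ n → ∀ k → k ≤ n → Kind t n k (move t n k)
kind t {suc (suc n)} (s≤s (s≤s _)) zero _ = start (isStart t n)
kind t {suc (suc n)} (s≤s (s≤s _)) (suc j) j<n with ℕ.m≤n⇒m<n∨m≡n j<n
... | inj₁ 1+j<n = inner j (isInner t _ j 1+j<n)
... | inj₂ refl  = end (isEnd t n)

private
  fold-back : ∀ {n s} → Mirrored n s → ∀ v → s (- v + + N n) ≡ - s v + + N n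
  fold-back mir v = trans (Mirrored.periodic mir (- v)) (cong (_+ _) (Mirrored.odd mir v))

  unfold : ∀ v d → - (- v + d) + d ≡ v
  unfold = solve-∀

-- Only the windows of the generators are known, and `Mirrored-ext` makes them sufficient.
-- Involutivity then supplies the inverses used by `apply` and for reversed words.
kind-involutive : ∀ {t n k s} → 2 ≤ n → Mirrored n s → Kind t n k s → ∀ v → s (s v) ≡ v
kind-involutive {n = n} {s = s} 2≤n mir kd = Mirrored-ext (Mirrored-∘ mir mir) Mirrored-id (go kd)
  where
  open Mirrored mir
  twice : ∀ {v v′} → s v ≡ v′ → s v′ ≡ v → s (s v) ≡ v
  twice eq eq′ = trans (cong s eq) eq′
  goStart : ∀ {sh} → IsStart n s sh → ∀ c → c < n → s (s (+ suc c)) ≡ + suc c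
  goStart (startC at-1 fix) zero    _   = twice at-1 (trans (odd (+ 1)) (cong -_ at-1))
  goStart (startC at-1 fix) (suc c) c<n = twice (fix c c<n) (fix c c<n)
  goStart (startD at-1 at-2 fix) zero          _   = twice at-1 (trans (odd (+ 2)) (cong -_ at-2))
  goStart (startD at-1 at-2 fix) (suc zero)    _   = twice at-2 (trans (odd (+ 1)) (cong -_ at-1))
  goStart (startD at-1 at-2 fix) (suc (suc c)) c<n = twice (fix c c<n) (fix c c<n)
  goEnd : ∀ {n sh} → Mirrored n s → IsEnd s n sh → ∀ c → c < n → s (s (+ suc c)) ≡ + suc c
  goEnd mir (endC {k} fin fix) c (s≤s c≤k) with ℕ.m≤n⇒m<n∨m≡n c≤k
  ... | inj₁ c<k  = twice (fix c c<k) (fix c c<k)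
  ... | inj₂ refl = twice fin (trans (fold-back mir (+ suc k))
    (trans (cong (λ z → - z + _) fin) (unfold (+ suc k) (+ N (suc k)))))
  goEnd mir (endD {k} pen fin fix) c (s≤s c≤1+k) with ℕ.m≤n⇒m<n∨m≡n c≤1+k
  ... | inj₂ refl = twice fin (trans (fold-back mir (+ suc k))
    (trans (cong (λ z → - z + _) pen) (unfold (+ suc (suc k)) (+ N (suc (suc k))))))
  ... | inj₁ (s≤s c≤k) with ℕ.m≤n⇒m<n∨m≡n c≤k
  ...   | inj₁ c<k  = twice (fix c c<k) (fix c c<k)
  ...   | inj₂ refl = twice pen (trans (fold-back mir (+ suc (suc k)))
    (trans (cong (λ z → - z + _) fin) (unfold (+ suc k) (+ N (suc (suc k))))))
  go : ∀ {k} → Kind _ n k s → ∀ c → c < n → s (s (+ suc c)) ≡ + suc c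
  go (inner j i) c c<n with c ℕ.≟ j | c ℕ.≟ suc j
  ... | yes refl | _        = twice (IsInner.at-j i) (IsInner.at-1+j i)
  ... | no  _    | yes refl = twice (IsInner.at-1+j i) (IsInner.at-j i)
  ... | no  c≢j  | no c≢1+j = twice (IsInner.fixed i c c<n c≢j c≢1+j) (IsInner.fixed i c c<n c≢j c≢1+j)
  go (start st) c c<n = goStart st c c<n
  go (end en)   c c<n = goEnd mir en c c<n

state : (ℤ → ℤ) → ℕ → ℤ
state X i = X (+ suc i)

-- A start generator brings labels `- c` into the window, an end generator labels `N - c`. These
-- laws express the values there through values on the window and so turn generators into
-- reflections.
StartReflects EndReflects : ℕ → ℤ → (ℤ → ℤ) → Set
StartReflects n e X = ∀ c → c < n → X (- + suc c) ≡ e - X (+ suc c)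
EndReflects n e X = ∀ c → c < n → X (- + suc c + + N n) ≡ e - X (+ suc c)

module _ {t : AffineType} {n : ℕ} (X : ℤ → ℤ) {s : ℤ → ℤ} where

  innerSwapped : ∀ {j} → IsInner n j s → Swapped n j (state X) (state (X ∘ s))
  innerSwapped i = record
    { inside = inside ; at-j = cong X at-j ; at-1+j = cong X at-1+j
    ; fixed = λ c c<n c≢j c≢1+j → cong X (fixed c c<n c≢j c≢1+j) }
    where open IsInner i

  private
    0- : ∀ z → 0ℤ - z ≡ - z
    0- z = ℤ.+-identityˡ (- z)

  innerMove : ∀ {j} (i : IsInner n j s) → Move t n (state X) (state (X ∘ s))
  innerMove i = inner _ (innerSwapped i)

  startMove : StartReflects n 1ℤ X → 2 ≤ n → IsStart n s (startShape t) →
    ∃ λ (m : Move t n (state X) (state (X ∘ s))) →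
      ¬ StartOK (startShape t) n (state X) → Descends m
  startMove refl-X (s≤s (s≤s {n = k} _)) = go (startShape t) refl
    where
    go : ∀ sh → startShape t ≡ sh → IsStart (suc (suc k)) s sh →
      ∃ λ (m : Move t n (state X) (state (X ∘ s))) → ¬ StartOK sh n (state X) → Descends m
    go C eq (startC at-1 fix) =
      startC (suc k) eq refl (λ i i<k → cong X (fix i (s≤s i<k)))
        (trans (cong X at-1) (refl-X 0 (s≤s z≤n))) ,
      λ ¬ok → ℤ.i<j⇒suc[i]≤j (ℤ.≰⇒> ¬ok)
    go D eq (startD at-1 at-2 fix) =
      startD k eq refl (λ i i<k → cong X (fix i (s≤s (s≤s i<k))))
        (trans (cong X at-1) (refl-X 1 (s≤s (s≤s z≤n)))) (trans (cong X at-2) (refl-X 0 (s≤s z≤n))) ,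
      ℤ.≰⇒>

  endMove : EndReflects n 0ℤ X → IsEnd s n (endShape t) →
    ∃ λ (m : Move t n (state X) (state (X ∘ s))) → ¬ EndOK (endShape t) n (state X) → Descends m
  endMove refl-X = go (endShape t) refl
    where
    go : ∀ sh → endShape t ≡ sh → IsEnd s n sh →
      ∃ λ (m : Move t n (state X) (state (X ∘ s))) → ¬ EndOK sh n (state X) → Descends m
    go C eq (endC {k} fin fix) =
      endC k eq refl (λ i i<k → cong X (fix i i<k))
        (trans (cong X fin) (trans (refl-X k ℕ.≤-refl) (0- _))) ,
      λ ¬ok → ℤ.≰⇒> λ 0≤ → ¬ok λ { _ refl → 0≤ }
    go D eq (endD {k} pen fin fix) =
      endD k eq refl (λ i i<k → cong X (fix i i<k))
        (trans (cong X pen) (trans (refl-X (suc k) ℕ.≤-refl) (0- _)))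
        (trans (cong X fin) (trans (refl-X k (ℕ.m<n⇒m<1+n ℕ.≤-refl)) (0- _))) ,
      λ ¬ok → ℤ.≰⇒> λ 0≤ → ¬ok λ { _ refl → 0≤ }

  kindMove : StartReflects n 1ℤ X → EndReflects n 0ℤ X → 2 ≤ n → ∀ {k} → Kind t n k s →
    Move t n (state X) (state (X ∘ s))
  kindMove _  _  _   (inner j i) = innerMove i
  kindMove sX _  2≤n (start st)  = proj₁ (startMove sX 2≤n st)
  kindMove _  eX _   (end en)    = proj₁ (endMove eX en)

  innerParity : ∀ {j} → IsInner n j s → ParityMove n (state X) (state (X ∘ s))
  innerParity i = inner _ (innerSwapped i)

  startParity : ∀ {sh e} → StartReflects n e X → (sh ≡ C → e ≡ 0ℤ) → 2 ≤ n → IsStart n s sh →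
    ParityMove n (state X) (state (X ∘ s))
  startParity refl-X e≡0 (s≤s (s≤s {n = k} _)) (startC at-1 fix) =
    first (suc k) refl (λ i i<k → cong X (fix i (s≤s i<k)))
      (trans (cong X at-1) (trans (refl-X 0 (s≤s z≤n)) (trans (cong (_- _) (e≡0 refl)) (0- _))))
  startParity {e = e} refl-X _ (s≤s (s≤s {n = k} _)) (startD at-1 at-2 fix) =
    firstTwo e k refl (λ i i<k → cong X (fix i (s≤s (s≤s i<k))))
      (trans (cong X at-1) (refl-X 1 (s≤s (s≤s z≤n)))) (trans (cong X at-2) (refl-X 0 (s≤s z≤n)))

  endParity : ∀ {sh e} → EndReflects n e X → (sh ≡ C → e ≡ 0ℤ) → IsEnd s n sh →
    ParityMove n (state X) (state (X ∘ s))
  endParity refl-X e≡0 (endC {k} at-end fix) =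
    last k refl (λ i i<k → cong X (fix i i<k))
      (trans (cong X at-end) (trans (refl-X k ℕ.≤-refl) (trans (cong (_- _) (e≡0 refl)) (0- _))))
  endParity {e = e} refl-X _ (endD {k} pen at-end fix) =
    lastTwo e k refl (λ i i<k → cong X (fix i i<k))
      (trans (cong X pen) (refl-X (suc k) ℕ.≤-refl)) (trans (cong X at-end) (refl-X k (ℕ.m<n⇒m<1+n ℕ.≤-refl)))

  kindParity : ∀ e e′ → StartReflects n e X → EndReflects n e′ X →
    (startShape t ≡ C → e ≡ 0ℤ) → (endShape t ≡ C → e′ ≡ 0ℤ) → 2 ≤ n → ∀ {k} → Kind t n k s →
    ParityMove n (state X) (state (X ∘ s))
  kindParity _ _ _  _  _ _  _   (inner j i) = innerParity i
  kindParity _ _ sX _  z _  2≤n (start st)  = startParity sX z 2≤n st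
  kindParity _ _ _  eX _ z′ _   (end en)    = endParity eX z′ en

-- Levels of a permutation

-- The inverse is part of the data, because all vectors attached to `w` are functions of `w⁻¹`.
record Perm (n : ℕ) : Set where
  field
    to from  : ℤ → ℤ
    to-from  : ∀ i → to (from i) ≡ i
    from-to  : ∀ i → from (to i) ≡ i
    mirrored : Mirrored n to

  mirrored-from : Mirrored n from
  mirrored-from = Mirrored-inverse mirrored to-from from-to

open Perm

idPerm : ∀ n → Perm n
idPerm n = record
  { to = id ; from = id ; to-from = λ _ → refl ; from-to = λ _ → refl ; mirrored = Mirrored-id }

toPerm : ∀ {n w} → MirroredPermutation n w → Perm n
toPerm {n} {w} mp = record
  { to = w ; from = u ; to-from = w-u ; from-to = λ i → injective (w-u (w i))
  ; mirrored = record { periodic = periodic ; odd = odd } }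
  where
  open MirroredPermutation mp using (bijective; periodic) renaming (mirrored to odd)
  injective = proj₁ bijective
  u : ℤ → ℤ
  u i = proj₁ (proj₂ bijective i)
  w-u : ∀ i → w (u i) ≡ i
  w-u i = proj₂ (proj₂ bijective i) refl

-- floorShift T x is the largest k with x + kN ≤ T.
floorShift : ℕ → ℤ → ℤ → ℤ
floorShift n T x = (T - x) /ℕ N n

module _ {n : ℕ} where
  private
    d : ℤ
    d = + N n
  open Division (N n)

  private
    1+c<N : ∀ {c} → c < n → suc c < N n
    1+c<N c<n = s≤s (ℕ.≤-trans c<n (ℕ.m≤m+n n _))

    N∸1+c<N : ∀ c → N n ℕ.∸ suc c < N n
    N∸1+c<N c = s≤s (ℕ.m∸n≤m _ c)

    N-1-c : ∀ {c} → c < n → d - + suc c ≡ + (N n ℕ.∸ suc c)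
    N-1-c {c} c<n = trans (ℤ.m-n≡m⊖n (N n) (suc c)) (ℤ.⊖-≥ (ℕ.<⇒≤ (1+c<N c<n)))

  floorShift-shift : ∀ T x → floorShift n T (x + d) ≡ floorShift n T x - 1ℤ
  floorShift-shift T x = trans (cong (_/ℕ N n) (e T x d)) (/ℕ-shift (T - x) -1ℤ)
    where
    e : ∀ T x d → T - (x + d) ≡ T - x + -1ℤ ℤ.* d
    e = solve-∀

  floorShift₀-pos : ∀ c k → c < n → floorShift n 0ℤ (+ suc c + k ℤ.* d) ≡ -1ℤ - k
  floorShift₀-pos c k c<n = /ℕ-unique (-1ℤ - k) (N∸1+c<N c)
    (trans (e (+ suc c) k d) (cong (_+ (-1ℤ - k) ℤ.* d) (N-1-c c<n)))
    where
    e : ∀ a k d → 0ℤ - (a + k ℤ.* d) ≡ d - a + (-1ℤ - k) ℤ.* d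
    e = solve-∀

  floorShift₀-neg : ∀ c k → c < n → floorShift n 0ℤ (- + suc c + k ℤ.* d) ≡ - k
  floorShift₀-neg c k c<n = /ℕ-unique (- k) (1+c<N c<n) (e (+ suc c) k d)
    where
    e : ∀ a k d → 0ℤ - (- a + k ℤ.* d) ≡ a + (- k) ℤ.* d
    e = solve-∀

  private
    neg-pos : ∀ a k d → - (a + k ℤ.* d) ≡ - a + (- k) ℤ.* d
    neg-pos = solve-∀
    neg-neg : ∀ a k d → - (- a + k ℤ.* d) ≡ a + (- k) ℤ.* d
    neg-neg = solve-∀

  -- For `x` outside the multiples of `N`, each `k` satisfies exactly one of `x + kN ≤ 0` and
  -- `- x - kN ≤ 0`. A multiple of `N` would satisfy both for one `k`.
  floorShift₀-odd : ∀ x → (∀ k → x ≢ k ℤ.* d) →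
    floorShift n 0ℤ (- x) ≡ -1ℤ - floorShift n 0ℤ x
  floorShift₀-odd x x≢ with classify n x
  ... | zeroᶜ k eq = ⊥-elim (x≢ k eq)
  ... | posᶜ c k c<n refl = trans (cong (floorShift n 0ℤ) (neg-pos (+ suc c) k d))
    (trans (floorShift₀-neg c (- k) c<n) (trans (e k) (cong (_-_ -1ℤ) (sym (floorShift₀-pos c k c<n)))))
    where
    e : ∀ k → - (- k) ≡ -1ℤ - (-1ℤ - k)
    e = solve-∀
  ... | negᶜ c k c<n refl = trans (cong (floorShift n 0ℤ) (neg-neg (+ suc c) k d))
    (trans (floorShift₀-pos c (- k) c<n) (cong (_-_ -1ℤ) (sym (floorShift₀-neg c k c<n))))

  private
    n-bound : ∀ {m} → m ≤ n → n ℕ.+ m < N n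
    n-bound m≤n = s≤s (ℕ.+-monoʳ-≤ n (ℕ.≤-trans m≤n (ℕ.≤-reflexive (sym (ℕ.+-identityʳ n)))))

  floorShiftₙ-zero : ∀ k → floorShift n (+ n) (k ℤ.* d) ≡ - k
  floorShiftₙ-zero k = /ℕ-unique (- k) (s≤s (ℕ.m≤m+n n _)) (e (+ n) k d)
    where
    e : ∀ a k d → a - k ℤ.* d ≡ a + (- k) ℤ.* d
    e = solve-∀

  floorShiftₙ-pos : ∀ c k → c < n → floorShift n (+ n) (+ suc c + k ℤ.* d) ≡ - k
  floorShiftₙ-pos c k c<n = /ℕ-unique (- k) (s≤s (ℕ.≤-trans (ℕ.m∸n≤m n (suc c)) (ℕ.m≤m+n n _)))
    (trans (e (+ n) (+ suc c) k d) (cong (_+ (- k) ℤ.* d) (trans (ℤ.m-n≡m⊖n n (suc c)) (ℤ.⊖-≥ c<n))))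
    where
    e : ∀ n a k d → n - (a + k ℤ.* d) ≡ n - a + (- k) ℤ.* d
    e = solve-∀

  floorShiftₙ-neg : ∀ c k → c < n → floorShift n (+ n) (- + suc c + k ℤ.* d) ≡ - k
  floorShiftₙ-neg c k c<n = /ℕ-unique (- k) (n-bound c<n)
    (trans (e (+ n) (+ suc c) k d) (cong (_+ (- k) ℤ.* d) (sym (ℤ.pos-+ n (suc c)))))
    where
    e : ∀ n a k d → n - (- a + k ℤ.* d) ≡ n + a + (- k) ℤ.* d
    e = solve-∀

  -- The largest `x + kN` that is at most `n` lies between `-n` and `n`. This interval is symmetric,
  -- so multiples of `N` are no exception here.
  floorShiftₙ-odd : ∀ x → floorShift n (+ n) (- x) ≡ - floorShift n (+ n) x
  floorShiftₙ-odd x with classify n x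
  ... | zeroᶜ k refl = trans (cong (floorShift n (+ n)) (ℤ.neg-distribˡ-* k d))
    (trans (floorShiftₙ-zero (- k)) (cong -_ (sym (floorShiftₙ-zero k))))
  ... | posᶜ c k c<n refl = trans (cong (floorShift n (+ n)) (neg-pos (+ suc c) k d))
    (trans (floorShiftₙ-neg c (- k) c<n) (cong -_ (sym (floorShiftₙ-pos c k c<n))))
  ... | negᶜ c k c<n refl = trans (cong (floorShift n (+ n)) (neg-neg (+ suc c) k d))
    (trans (floorShiftₙ-pos c (- k) c<n) (cong -_ (sym (floorShiftₙ-neg c k c<n))))

  small-nonmultiple : ∀ c → c < n → ∀ k → + suc c ≢ k ℤ.* d
  small-nonmultiple c c<n k eq = ℕ.1+n≢0 (proj₁ (quotient-unique {q = 0ℤ} {k} (1+c<N c<n) (s≤s z≤n)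
    (trans (e (+ suc c) d) (trans eq (sym (ℤ.+-identityˡ _))))))
    where
    e : ∀ a d → a + 0ℤ ℤ.* d ≡ a
    e = solve-∀

  nonmultiple : ∀ (p : Perm n) c → c < n → ∀ k → from p (+ suc c) ≢ k ℤ.* d
  nonmultiple p c c<n k eq = small-nonmultiple c c<n k
    (trans (sym (to-from p (+ suc c))) (trans (cong (to p) eq) (at-multiple (mirrored p) k)))

-- The label b carries a bead of the abacus of w exactly when level n w⁻¹ b ≥ 0;
-- on the window 1, …, 2n it is the level of the lowest bead of the runner.
level : ℕ → (ℤ → ℤ) → ℤ → ℤ
level n u v = 1ℤ + floorShift n 0ℤ (u v)

-- The level measured against `n` in place of `0`: it carries the parity condition at `n` as `level`
-- carries the one at `0`.
excess : ℕ → (ℤ → ℤ) → ℤ → ℤ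
excess n u v = floorShift n (+ n) (u v)

-- For w in the finite group, y = N - 2 w⁻¹ transforms under s₁, …, sₙ like a level
-- vector, so it can be sorted by the same descent.
height : ℕ → (ℤ → ℤ) → ℤ → ℤ
height n u v = + N n - (u v + u v)

module _ {n : ℕ} (p : Perm n) where
  private
    d = + N n
    u = from p
    open Mirrored (mirrored-from p)

  level-shift : ∀ v → level n u (v + d) ≡ level n u v - 1ℤ
  level-shift v = trans (cong (λ z → 1ℤ + floorShift n 0ℤ z) (periodic v))
    (trans (cong (_+_ 1ℤ) (floorShift-shift {n} 0ℤ (u v))) (sym (ℤ.+-assoc 1ℤ (floorShift n 0ℤ (u v)) -1ℤ)))

  level-start : StartReflects n 1ℤ (level n u)
  level-start c c<n = trans (cong (λ z → 1ℤ + floorShift n 0ℤ z) (odd (+ suc c)))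
    (trans (cong (_+_ 1ℤ) (floorShift₀-odd {n} (u (+ suc c)) (nonmultiple p c c<n)))
      (e (floorShift n 0ℤ (u (+ suc c)))))
    where
    e : ∀ f → 1ℤ + (-1ℤ - f) ≡ 1ℤ - (1ℤ + f)
    e = solve-∀

  level-end : EndReflects n 0ℤ (level n u)
  level-end c c<n = trans (level-shift (- + suc c))
    (trans (cong (_- 1ℤ) (level-start c c<n)) (e (level n u (+ suc c))))
    where
    e : ∀ f → 1ℤ - f - 1ℤ ≡ 0ℤ - f
    e = solve-∀

  excess-start : StartReflects n 0ℤ (excess n u)
  excess-start c c<n = trans (cong (floorShift n (+ n)) (odd (+ suc c)))
    (trans (floorShiftₙ-odd {n} (u (+ suc c))) (sym (ℤ.+-identityˡ _)))

  excess-end : EndReflects n -1ℤ (excess n u)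
  excess-end c c<n = trans (cong (floorShift n (+ n)) (periodic (- + suc c)))
    (trans (floorShift-shift {n} (+ n) (u (- + suc c)))
      (trans (cong (_- 1ℤ) (excess-start c c<n)) (e (excess n u (+ suc c)))))
    where
    e : ∀ f → 0ℤ - f - 1ℤ ≡ -1ℤ - f
    e = solve-∀

  height-end : EndReflects n 0ℤ (height n u)
  height-end c c<n = trans
    (cong (λ z → d - (z + z)) (trans (periodic (- + suc c)) (cong (_+ d) (odd (+ suc c)))))
    (e (u (+ suc c)) d)
    where
    e : ∀ v d → d - (- v + d + (- v + d)) ≡ 0ℤ - (d - (v + v))
    e = solve-∀

module _ (t : AffineType) {n : ℕ} (2≤n : 2 ≤ n) where

  apply : ∀ k → k ≤ n → Perm n → Perm n
  apply k k≤n p = record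
    { to = s ∘ to p
    ; from = from p ∘ s
    ; to-from = λ i → trans (cong s (to-from p (s i))) (inv i)
    ; from-to = λ i → trans (cong (from p) (inv (to p i))) (from-to p i)
    ; mirrored = Mirrored-∘ (Mirrored-move t n k) (mirrored p)
    }
    where
    s = move t n k
    inv = kind-involutive 2≤n (Mirrored-move t n k) (kind t 2≤n k k≤n)

  levels heights excesses : Perm n → ℕ → ℤ
  levels p   = state (level n (from p))
  heights p  = state (height n (from p))
  excesses p = state (excess n (from p))

  levelMove : ∀ p k (k≤n : k ≤ n) → Move t n (levels p) (levels (apply k k≤n p))
  levelMove p k k≤n = kindMove (level n (from p)) (level-start p) (level-end p) 2≤n (kind t 2≤n k k≤n)

  record ParityCondition (p : Perm n) : Set where
    field
      even-levels   : startShape t ≡ D → Even (Σ n (levels p))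
      even-excesses : endShape t ≡ D → Even (Σ n (excesses p))

  open ParityCondition

  private
    C≢D : ∀ {s} {A : Set} → s ≡ C → s ≡ D → A
    C≢D refl ()

  ParityCondition-step : ∀ p k (k≤n : k ≤ n) → ParityCondition p → ParityCondition (apply k k≤n p)
  ParityCondition-step p k k≤n par .even-levels eq = Even-ParityMove
    (kindParity {t} (level n (from p)) 1ℤ 0ℤ (level-start p) (level-end p) (λ eq′ → C≢D eq′ eq) (λ _ → refl) 2≤n (kind t 2≤n k k≤n))
    (even-levels par eq)
  ParityCondition-step p k k≤n par .even-excesses eq = Even-ParityMove
    (kindParity {t} (excess n (from p)) 0ℤ -1ℤ (excess-start p) (excess-end p) (λ _ → refl) (λ eq′ → C≢D eq′ eq) 2≤n (kind t 2≤n k k≤n))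
    (even-excesses par eq)

  StartOK? : ∀ sh x → Dec (StartOK sh n x)
  StartOK? C x = x 0 ℤ.≤? 0ℤ
  StartOK? D x = x 0 + x 1 ℤ.≤? 1ℤ

  private
    EndOK-dec : ∀ {n} → 2 ≤ n → ∀ sh x → Dec (EndOK sh n x)
    EndOK-dec (s≤s (s≤s {n = k} _)) C x with 0ℤ ℤ.≤? x (suc k)
    ... | yes p = yes λ { _ refl → p }
    ... | no ¬p = no λ f → ¬p (f _ refl)
    EndOK-dec (s≤s (s≤s {n = k} _)) D x with 0ℤ ℤ.≤? x k + x (suc k)
    ... | yes p = yes λ { _ refl → p }
    ... | no ¬p = no λ f → ¬p (f _ refl)

  EndOK? : ∀ sh x → Dec (EndOK sh n x)
  EndOK? = EndOK-dec 2≤n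

  module _ (X : ℤ → ℤ) where
    Descent : ℕ → Set
    Descent k = ∃ λ (m : Move t n (state X) (state (X ∘ move t n k))) → Descends m

    private
      end-kind : IsEnd (move t n n) n (endShape t)
      end-kind = go 2≤n
        where
        go : ∀ {n} → 2 ≤ n → IsEnd (move t n n) n (endShape t)
        go (s≤s (s≤s {n = k} _)) = isEnd t k

      start-kind : IsStart n (move t n 0) (startShape t)
      start-kind = go 2≤n
        where
        go : ∀ {n} → 2 ≤ n → IsStart n (move t n 0) (startShape t)
        go (s≤s (s≤s {n = k} _)) = isStart t k

    -- Kept apart from the start generator, since sorting by heights has to stay inside `W`.
    upperDescent : EndReflects n 0ℤ X →
      (∃ λ k → suc k ≤ n × Descent (suc k)) ⊎ (Dominant n (state X) × EndOK (endShape t) n (state X))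
    upperDescent eX with findAscent n (state X)
    ... | inj₁ (j , 1+j<n , asc) = inj₁ (j , ℕ.<⇒≤ 1+j<n , innerMove X (isInner t n j 1+j<n) , asc)
    ... | inj₂ dom with EndOK? (endShape t) (state X)
    ...   | yes ok = inj₂ (dom , ok)
    ...   | no ¬ok = inj₁ (last-index 2≤n (proj₁ (endMove X eX end-kind) , proj₂ (endMove X eX end-kind) ¬ok))
      where
      last-index : ∀ {m} → 2 ≤ m → Descent m → ∃ λ k → suc k ≤ m × Descent (suc k)
      last-index (s≤s _) des = _ , ℕ.≤-refl , des

    startDescent : StartReflects n 1ℤ X → Descent 0 ⊎ StartOK (startShape t) n (state X)
    startDescent sX with StartOK? (startShape t) (state X)
    ... | yes ok = inj₂ ok
    ... | no ¬ok = inj₁ (proj₁ (startMove X sX 2≤n start-kind) , proj₂ (startMove X sX 2≤n start-kind) ¬ok)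

-- Descent

private
  +-N : ∀ n → + N n ≡ 1ℤ + (+ n + + n)
  +-N n = cong (λ z → + suc (n ℕ.+ z)) (ℕ.+-identityʳ n)

+-cancelˡ-1 : ∀ {a b} → 1ℤ + a ≡ 1ℤ + b → a ≡ b
+-cancelˡ-1 {a} {b} eq = +-cancelʳ 1ℤ (trans (ℤ.+-comm a 1ℤ) (trans eq (ℤ.+-comm 1ℤ b)))

record StrictlyIncreasing (n : ℕ) (U : ℕ → ℤ) : Set where
  field
    increasing : ∀ j → suc j < n → U j ℤ.< U (suc j)
    positive   : ∀ j → j < n → 1ℤ ℤ.≤ U j

module _ {n : ℕ} {U : ℕ → ℤ} (str : StrictlyIncreasing n U) where
  open StrictlyIncreasing str renaming (positive to pos)

  private
    growth : ∀ m i → m ℕ.+ i < n → U i + + m ℤ.≤ U (m ℕ.+ i)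
    growth zero    i _ = ℤ.≤-reflexive (ℤ.+-identityʳ (U i))
    growth (suc m) i < =
      ≤-by (0≤-gap (growth m i (ℕ.<-trans ℕ.≤-refl <)) ⊞ 0≤-gap< (increasing (m ℕ.+ i) <))
        (e (U i) (+ m) (U (m ℕ.+ i)) (U (suc m ℕ.+ i)))
      where
      e : ∀ u m v v′ → v′ - (u + (1ℤ + m)) ≡ (v - (u + m)) + (v′ - v - 1ℤ)
      e = solve-∀

  -- Each step grows by at least one, so `U 0 ≥ 1` forces `U i ≥ i + 1`, and `U (n - 1) ≤ n` forces
  -- `U i ≤ i + 1`.
  increasing-bounded : ∀ {k} → n ≡ suc k → U k ℤ.≤ + n → ∀ i → i < n → U i ≡ + suc i
  increasing-bounded {k} refl Uk≤n i (s≤s i≤k) = ℤ.≤-antisym upper lower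
    where
    lower : + suc i ℤ.≤ U i
    lower = subst (λ z → + suc i ℤ.≤ U z) (ℕ.+-identityʳ i)
      (≤-by (0≤-gap (growth i 0 (subst (_< n) (sym (ℕ.+-identityʳ i)) (s≤s i≤k))) ⊞ 0≤-gap (pos 0 (s≤s z≤n)))
        (e (U 0) (+ i) (U (i ℕ.+ 0))))
      where
      e : ∀ u i v → v - (1ℤ + i) ≡ (v - (u + i)) + (u - 1ℤ)
      e = solve-∀
    m : ℕ
    m = k ℕ.∸ i
    m+i≡k : m ℕ.+ i ≡ k
    m+i≡k = ℕ.m∸n+n≡m i≤k
    upper : U i ℤ.≤ + suc i
    upper = ≤-by (0≤-gap (growth m i (subst (_< n) (sym m+i≡k) ℕ.≤-refl)) ⊞
        0≤-gap (subst₂ (λ a b → U a ℤ.≤ + suc b) (sym m+i≡k) (sym m+i≡k) Uk≤n))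
      (e (U i) (+ m) (+ i) (U (m ℕ.+ i)))
      where
      e : ∀ u m i v → (1ℤ + i) - u ≡ (v - (u + m)) + ((1ℤ + (m + i)) - v)
      e = solve-∀

half-≤ : ∀ {a b} → a + a ℤ.≤ b + b → a ℤ.≤ b
half-≤ {a} {b} 2a≤2b with ≤-or-> a b
... | inj₁ a≤b = a≤b
... | inj₂ b<a = ⊥-elim (negative-absurd (0≤-gap 2a≤2b ⊞ 0≤-gap< b<a ⊞ 0≤-gap< b<a) (e a b))
  where
  e : ∀ a b → b + b - (a + a) + (a - b - 1ℤ) + (a - b - 1ℤ) ≡ -[1+ 1 ]
  e = solve-∀

module _ {n : ℕ} where
  open Division (N n)

  floorShift₀≡-1⇒ : ∀ {x} → floorShift n 0ℤ x ≡ -1ℤ → (1ℤ ℤ.≤ x) × (x ℤ.≤ + N n)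
  floorShift₀≡-1⇒ {x} eq =
    ≤-by (0≤-gap< (+<+ (n%ℕd<d (0ℤ - x) (N n)))) (trans (cong (_- 1ℤ) x-eq) refl) ,
    ≤-by (0≤+ r) (trans (cong (_-_ (+ N n)) x-eq) (e₂ (+ N n) (+ r)))
    where
    r = (0ℤ - x) %ℕ N n
    e₁ : ∀ x → x ≡ - (0ℤ - x)
    e₁ = solve-∀
    e₃ : ∀ r d → - (r + -1ℤ ℤ.* d) ≡ d - r
    e₃ = solve-∀
    e₂ : ∀ d r → d - (d - r) ≡ r
    e₂ = solve-∀
    x-eq : x ≡ + N n - + r
    x-eq = trans (e₁ x) (trans (cong -_ (trans (division (0ℤ - x)) (cong (λ q → + r + q ℤ.* + N n) eq)))
      (e₃ (+ r) (+ N n)))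

  floorShiftₙ-low : ∀ {x} → 1ℤ ℤ.≤ x → x ℤ.≤ + n → floorShift n (+ n) x ≡ 0ℤ
  floorShiftₙ-low {+ a} _ (+≤+ a≤n) = /ℕ-unique 0ℤ (s≤s (ℕ.≤-trans (ℕ.m∸n≤m n a) (ℕ.m≤m+n n _)))
    (trans (ℤ.m-n≡m⊖n n a) (trans (ℤ.⊖-≥ a≤n) (e (+ (n ℕ.∸ a)) (+ N n))))
    where
    e : ∀ a d → a ≡ a + 0ℤ ℤ.* d
    e = solve-∀

  floorShiftₙ-high : ∀ {x} → + n ℤ.< x → x ℤ.≤ + N n → floorShift n (+ n) x ≡ -1ℤ
  floorShiftₙ-high {+ a} (+<+ n<a) (+≤+ a≤N) = /ℕ-unique -1ℤ r<N
    (trans (e (+ n) (+ a) (+ N n)) (cong (_+ -1ℤ ℤ.* + N n) (trans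
      (cong (_+_ (+ n)) (trans (ℤ.m-n≡m⊖n (N n) a) (ℤ.⊖-≥ a≤N))) (sym (ℤ.pos-+ n (N n ℕ.∸ a))))))
    where
    e : ∀ n a d → n - a ≡ n + (d - a) + -1ℤ ℤ.* d
    e = solve-∀
    r<N : n ℕ.+ (N n ℕ.∸ a) < N n
    r<N = ℕ.<-≤-trans (ℕ.+-monoˡ-< (N n ℕ.∸ a) n<a) (ℕ.≤-reflexive (ℕ.m+[n∸m]≡n a≤N))

module _ (t : AffineType) {n : ℕ} (2≤n : 2 ≤ n) (3≤n : endShape t ≡ D → 3 ≤ n) where
  private
    levelsᵗ heightsᵗ : Perm n → ℕ → ℤ
    levelsᵗ = levels t 2≤n
    heightsᵗ = heights t 2≤n
    Parity : Perm n → Set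
    Parity = ParityCondition t 2≤n
    ev : List (Fin (suc n)) → ℤ → ℤ
    ev = evaluate t n
    applyᵗ : ∀ k → k ≤ n → Perm n → Perm n
    applyᵗ = apply t 2≤n

  LevelsVanish : Perm n → Set
  LevelsVanish p = ∀ i → i < n → levels t 2≤n p i ≡ 0ℤ

  move-involutive : ∀ k → k ≤ n → ∀ v → move t n k (move t n k v) ≡ v
  move-involutive k k≤n = kind-involutive 2≤n (Mirrored-move t n k) (kind t 2≤n k k≤n)

  private
    generator-fromℕ< : ∀ {k} (k<1+n : k < suc n) v → generator t n (fromℕ< k<1+n) v ≡ move t n k v
    generator-fromℕ< k<1+n v = cong (λ j → move t n j v) (Fin.toℕ-fromℕ< k<1+n)

    coweight-step : ∀ {w w′ W} → w ≡ 1ℤ + w′ → w ≡ + suc W → w′ ≡ + W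
    coweight-step eq eq′ = +-cancelˡ-1 (trans (sym eq) eq′)

    coweight-absurd : ∀ {w w′} → 0ℤ ℤ.≤ w′ → w ≡ 1ℤ + w′ → w ≡ 0ℤ → ⊥
    coweight-absurd {w} {w′} 0≤w′ eq eq′ = negative-absurd 0≤w′
      (trans (e w′) (cong (_- 1ℤ) (trans (sym eq) eq′)))
      where
      e : ∀ w → w ≡ 1ℤ + w - 1ℤ
      e = solve-∀

  -- `rest` inherits the parity conditions, on which its membership in `W` will depend.
  record Reduction (p : Perm n) (W : ℕ) : Set where
    field
      word        : List (Fin (suc n))
      length-word : length word ≡ W
      rest        : Perm n
      factorised  : to p ≗ ev word ∘ to rest
      parity      : ParityCondition t 2≤n rest
      vanish      : LevelsVanish rest

  reduce  : ∀ W p → ParityCondition t 2≤n p → coweight t n (levels t 2≤n p) ≡ + W → Reduction p W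
  descend : ∀ W p → ParityCondition t 2≤n p → coweight t n (levels t 2≤n p) ≡ + W →
    ∀ k → k ≤ n → Descent t 2≤n (level n (from p)) k → Reduction p W

  descend zero    p par eq k k≤n (m , d) =
    ⊥-elim (coweight-absurd (coweight-nonneg t n (levelsᵗ (applyᵗ k k≤n p))) (coweight-descent m d) eq)
  descend (suc W) p par eq k k≤n (m , d) = record
    { word = fromℕ< (s≤s k≤n) ∷ word
    ; length-word = cong suc length-word
    ; rest = rest
    ; factorised = λ i → trans (sym (move-involutive k k≤n (to p i)))
        (trans (cong (move t n k) (factorised i)) (sym (generator-fromℕ< (s≤s k≤n) (ev word (to rest i)))))
    ; parity = parity
    ; vanish = vanish }
    where open Reduction (reduce W (applyᵗ k k≤n p) (ParityCondition-step t 2≤n p k k≤n par)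
            (coweight-step (coweight-descent m d) eq))

  reduce W p par eq with upperDescent t 2≤n (level n (from p)) (level-end p)
  ... | inj₁ (k , k<n , des) = descend W p par eq (suc k) k<n des
  ... | inj₂ (dom , endOK) with startDescent t 2≤n (level n (from p)) (level-start p)
  ...   | inj₁ des = descend W p par eq 0 z≤n des
  ...   | inj₂ startOK with terminal-cases (startShape t) (endShape t) 2≤n 3≤n dom endOK startOK
  ...     | inj₁ zeros = record
    { word = [] ; length-word = ℤ.+-injective (trans (sym vanishing) eq)
    ; rest = p ; factorised = λ _ → refl ; parity = par ; vanish = zeros }
    where
    vanishing : coweight t n (levelsᵗ p) ≡ 0ℤ
    vanishing = trans (weight-cong n zeros) (coweight-zero t n)
      where open Weight (axisWeight t) pairWeight
  ...     | inj₂ (start≡D , x≡1 , zeros) = ⊥-elim (¬Even-1 (subst Even Σ≡1 (even-levels start≡D)))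
    where
    open ParityCondition par
    Σ≡1′ : ∀ {n x} → 2 ≤ n → x 0 ≡ 1ℤ → (∀ i → suc i < n → x (suc i) ≡ 0ℤ) → Σ n x ≡ 1ℤ
    Σ≡1′ (s≤s {n = k} _) x≡1 zeros =
      trans (Σ-cons k _) (cong₂ _+_ x≡1 (Σ-zero k _ λ i i<k → zeros i (s≤s i<k)))
    Σ≡1 : Σ n (levelsᵗ p) ≡ 1ℤ
    Σ≡1 = Σ≡1′ 2≤n x≡1 zeros

  private
    -- Swaps and reflections with constant `0` fix the zero vector, so sorting by `s₁, …, sₙ` keeps
    -- the levels at zero.
    vanish-kind : ∀ {n k X s} → EndReflects n 0ℤ X → Kind t n (suc k) s →
      (∀ i → i < n → X (+ suc i) ≡ 0ℤ) → ∀ i → i < n → X (s (+ suc i)) ≡ 0ℤ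
    vanish-kind {n} {X = X} eX (inner j isI) zero′ i i<n with i ℕ.≟ j | i ℕ.≟ suc j
    ... | yes refl | _ = trans (cong X (IsInner.at-j isI)) (zero′ _ (IsInner.inside isI))
    ... | no _ | yes refl = trans (cong X (IsInner.at-1+j isI)) (zero′ _ (ℕ.<-trans ℕ.≤-refl (IsInner.inside isI)))
    ... | no i≢j | no i≢1+j = trans (cong X (IsInner.fixed isI i i<n i≢j i≢1+j)) (zero′ i i<n)
    vanish-kind {n} {X = X} {s} eX (end isE) zero′ = go isE
      where
      reflected : ∀ {v} c → c < n → v ≡ - + suc c + + N n → X v ≡ 0ℤ
      reflected c c<n refl = trans (eX c c<n) (cong (_-_ 0ℤ) (zero′ c c<n))
      go : ∀ {sh} → IsEnd s n sh → ∀ i → i < n → X (s (+ suc i)) ≡ 0ℤ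
      go (endC at-end fix) i (s≤s i≤k) with ℕ.m≤n⇒m<n∨m≡n i≤k
      ... | inj₁ i<k  = trans (cong X (fix i i<k)) (zero′ i (ℕ.m<n⇒m<1+n i<k))
      ... | inj₂ refl = reflected i ℕ.≤-refl at-end
      go (endD pen at-end fix) i (s≤s i≤1+k) with ℕ.m≤n⇒m<n∨m≡n i≤1+k
      ... | inj₂ refl = reflected _ (ℕ.m<n⇒m<1+n ℕ.≤-refl) at-end
      ... | inj₁ (s≤s i≤k) with ℕ.m≤n⇒m<n∨m≡n i≤k
      ...   | inj₁ i<k  = trans (cong X (fix i i<k)) (zero′ i (ℕ.m<n⇒m<1+n (ℕ.m<n⇒m<1+n i<k)))
      ...   | inj₂ refl = reflected (suc i) ℕ.≤-refl pen

  module _ (p : Perm n) (vanish : LevelsVanish p) where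
    private
      U : ℕ → ℤ
      U i = from p (+ suc i)

      bounds : ∀ i → i < n → (1ℤ ℤ.≤ U i) × (U i ℤ.≤ + N n)
      bounds i i<n = floorShift₀≡-1⇒ {n} (+-cancelˡ-1 (vanish i i<n))

      U-injective : ∀ {i j} → U i ≡ U j → i ≡ j
      U-injective {i} {j} eq = ℕ.suc-injective (ℤ.+-injective
        (trans (sym (to-from p (+ suc i))) (trans (cong (to p) eq) (to-from p (+ suc j)))))

      U-sorted : Dominant n (heightsᵗ p) → StrictlyIncreasing n U
      U-sorted dom = record
        { increasing = λ j 1+j<n → ℤ.≤∧≢⇒< (half-≤ (≤-by (0≤-gap (dom j 1+j<n)) (e (+ N n) (U j) (U (suc j)))))
            λ eq → ℕ.1+n≢n (sym (U-injective eq))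
        ; positive = λ j j<n → proj₁ (bounds j j<n) }
        where
        e : ∀ d a b → b + b - (a + a) ≡ d - (a + a) - (d - (b + b))
        e = solve-∀

      -- In shape C a nonnegative last height says `2 U ≤ N`. In shape D only the last two heights
      -- together are bounded, so the last entry might exceed `n`; then it would be the only one to
      -- do so, and the excesses would add up to `-1`, against parity.
      last-bound : ∀ sh → endShape t ≡ sh → Parity p → Dominant n (heightsᵗ p) → EndOK sh n (heightsᵗ p) →
        ∀ {k} → n ≡ suc k → U k ℤ.≤ + n
      last-bound C _ par dom ok {k} refl with ≤-or-> (U k) (+ n)
      ... | inj₁ U≤n = U≤n
      ... | inj₂ n<U = ⊥-elim (negative-absurd (0≤-gap< n<U ⊞ 0≤-gap< n<U ⊞ 0≤-gap (ok k refl))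
        (trans (cong (λ d → (U k - + n - 1ℤ) + (U k - + n - 1ℤ) + (d - (U k + U k) - 0ℤ)) (+-N n))
          (e (U k) (+ n))))
        where
        e : ∀ u n → (u - n - 1ℤ) + (u - n - 1ℤ) + (1ℤ + (n + n) - (u + u) - 0ℤ) ≡ -1ℤ
        e = solve-∀
      last-bound D eq par dom ok {zero} refl with 3≤n eq
      ... | s≤s ()
      last-bound D eq par dom ok {suc k} refl with ≤-or-> (U (suc k)) (+ n)
      ... | inj₁ U≤n = U≤n
      ... | inj₂ n<U = ⊥-elim (¬Even-1 (Even-neg (subst Even Σ≡-1 (ParityCondition.even-excesses par eq))))
        where
        a = U k
        b = U (suc k)
        str = U-sorted dom
        a+b≤N : a + b ℤ.≤ + N n
        a+b≤N = half-≤ (≤-by (0≤-gap (ok k refl)) (e (+ N n) a b))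
          where
          e : ∀ d a b → d + d - (a + b + (a + b)) ≡ d - (a + a) + (d - (b + b)) - 0ℤ
          e = solve-∀
        a≤n : a ℤ.≤ + n
        a≤n = ≤-by (0≤-gap (subst (ℤ._≤_ (a + b)) (+-N n) a+b≤N) ⊞ 0≤-gap< n<U) (e (+ n) a b)
          where
          e : ∀ n a b → n - a ≡ 1ℤ + (n + n) - (a + b) + (b - n - 1ℤ)
          e = solve-∀
        U≤a : ∀ i → i ≤ k → U i ℤ.≤ a
        U≤a i i≤k = half-≤ (≤-by (0≤-gap (Dominant-antitone dom i≤k (ℕ.m<n⇒m<1+n ℕ.≤-refl))) (e (+ N n) (U i) a))
          where
          e : ∀ d u a → a + a - (u + u) ≡ d - (u + u) - (d - (a + a))
          e = solve-∀
        Σ≡-1 : Σ n (excesses t 2≤n p) ≡ -1ℤ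
        Σ≡-1 = cong₂ _+_
          (Σ-zero (suc k) (excesses t 2≤n p) λ { i (s≤s i≤k) →
            floorShiftₙ-low {n} (proj₁ (bounds i (s≤s (ℕ.m≤n⇒m≤1+n i≤k)))) (ℤ.≤-trans (U≤a i i≤k) a≤n) })
          (floorShiftₙ-high {n} n<U (proj₂ (bounds (suc k) ℕ.≤-refl)))

    sorted⇒id : Parity p → Dominant n (heightsᵗ p) → EndOK (endShape t) n (heightsᵗ p) → to p ≗ id
    sorted⇒id par dom ok i = trans (cong (to p) (sym (from≗id i))) (to-from p i)
      where
      n≡suc : ∃ λ k → n ≡ suc k
      n≡suc = go 2≤n
        where
        go : ∀ {m} → 2 ≤ m → ∃ λ k → m ≡ suc k
        go (s≤s _) = _ , refl
      from≗id : from p ≗ id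
      from≗id = Mirrored-ext (mirrored-from p) Mirrored-id
        (increasing-bounded (U-sorted dom) (proj₂ n≡suc) (last-bound (endShape t) refl par dom ok (proj₂ n≡suc)))

  InParabolic : Perm n → Set
  InParabolic p = ∃ λ (v : List (Fin n)) → to p ≗ evaluate t n (map Fin.suc v)

  -- Here `coweight` is a termination measure. Decreasing heights mean an increasing window of
  -- `w⁻¹`, and an increasing window with zero levels and the bound on its last entry is the
  -- identity.
  parabolic : ∀ W p → ParityCondition t 2≤n p → LevelsVanish p → coweight t n (heights t 2≤n p) ≡ + W → InParabolic p
  parabolic W p par van eq with upperDescent t 2≤n (height n (from p)) (height-end p)
  ... | inj₂ (dom , ok) = [] , sorted⇒id p van par dom ok
  parabolic zero p par van eq | inj₁ (k , k<n , m , d) =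
    ⊥-elim (coweight-absurd (coweight-nonneg t n (heightsᵗ (applyᵗ (suc k) k<n p))) (coweight-descent m d) eq)
  parabolic (suc W) p par van eq | inj₁ (k , k<n , m , d)
    with parabolic W (applyᵗ (suc k) k<n p) (ParityCondition-step t 2≤n p (suc k) k<n par)
           (vanish-kind {X = level n (from p)} (level-end p) (kind t 2≤n (suc k) k<n) van) (coweight-step (coweight-descent m d) eq)
  ... | v , eq′ = fromℕ< k<n ∷ v , λ i → trans (sym (move-involutive (suc k) k<n (to p i)))
    (trans (cong (move t n (suc k)) (eq′ i))
      (cong (λ j → move t n (suc j) (ev (map Fin.suc v) i)) (sym (Fin.toℕ-fromℕ< k<n))))

-- Coxeter length

module _ (t : AffineType) (n : ℕ) where
  private
    ev : List (Fin (suc n)) → ℤ → ℤ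
    ev = evaluate t n

  evaluate-++ : ∀ v v′ → ev (v ++ v′) ≗ ev v ∘ ev v′
  evaluate-++ []      v′ i = refl
  evaluate-++ (s ∷ v) v′ i = cong (generator t n s) (evaluate-++ v v′ i)

  Mirrored-evaluate : ∀ v → Mirrored n (ev v)
  Mirrored-evaluate []      = Mirrored-id
  Mirrored-evaluate (s ∷ v) = Mirrored-∘ (Mirrored-move t n (toℕ s)) (Mirrored-evaluate v)

  Represents? : ∀ {w} → Mirrored n w → ∀ v → Dec (ev v ≗ w)
  Represents? {w} mir v = Dec.map′
    (λ eq → Mirrored-ext (Mirrored-evaluate v) mir λ c c<n → eq c<n)
    (λ eq {c} _ → eq (+ suc c))
    (ℕ.allUpTo? (λ c → ev v (+ suc c) ℤ.≟ w (+ suc c)) n)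

word? : ∀ {m} k {Q : List (Fin m) → Set} → (∀ v → Dec (Q v)) → Dec (∃ λ v → length v ≡ k × Q v)
word? zero {Q} Q? = Dec.map′ (λ q → [] , refl , q) (λ { ([] , _ , q) → q }) (Q? [])
word? (suc k) {Q} Q? = Dec.map′
  (λ { (s , v , refl , q) → s ∷ v , refl , q })
  (λ { (s ∷ v , refl , q) → s , v , refl , q })
  (Fin.any? λ s → word? k λ v → Q? (s ∷ v))

least : {P : ℕ → Set} → (∀ k → Dec (P k)) → ∀ k → P k → ∃ λ m → P m × (∀ l → P l → m ≤ l)
least {P} P? = <-rec (λ k → P k → ∃ λ m → P m × (∀ l → P l → m ≤ l)) go
  where
  go : ∀ k → (∀ {l} → l < k → P l → ∃ λ m → P m × (∀ l → P l → m ≤ l)) →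
    P k → ∃ λ m → P m × (∀ l → P l → m ≤ l)
  go k rec pk with ℕ.anyUpTo? P? k
  ... | yes (l , l<k , pl) = rec l<k pl
  ... | no ¬any = k , pk , λ l pl → ℕ.≮⇒≥ λ l<k → ¬any (l , l<k , pl)

-- A shortest word can be found constructively: there are finitely many words of each length, and
-- the window decides whether a word represents `w`.
hasLength : ∀ t n {w} → Mirrored n w → ∀ v → evaluate t n v ≗ w → ∃ (HasLength t n w)
hasLength t n mir v eq with least (λ k → word? k (Represents? t n mir)) (length v) (v , refl , eq)
... | m , (v′ , len , eq′) , min = m , record
  { word = v′ ; word-w = eq′ ; word-m = len ; minimality = λ v″ eq″ → min (length v″) (v″ , refl , eq″) }

module _ (t : AffineType) {n : ℕ} (2≤n : 2 ≤ n) where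
  private
    ev : List (Fin (suc n)) → ℤ → ℤ
    ev = evaluate t n

    involutive : ∀ (s : Fin (suc n)) v → generator t n s (generator t n s v) ≡ v
    involutive s = kind-involutive 2≤n (Mirrored-move t n (toℕ s)) (kind t 2≤n (toℕ s) (Fin.toℕ≤pred[n] s))

  evaluate-reverse : ∀ v i → ev v (ev (reverse v) i) ≡ i
  evaluate-reverse []      i = refl
  evaluate-reverse (s ∷ v) i = trans
    (cong (ev (s ∷ v)) (trans (cong (λ u → ev u i) (List.unfold-reverse s v)) (evaluate-++ t n (reverse v) (s ∷ []) i)))
    (trans (cong (generator t n s) (evaluate-reverse v (generator t n s i))) (involutive s i))

  evaluate-reverse′ : ∀ v i → ev (reverse v) (ev v i) ≡ i
  evaluate-reverse′ v i = trans (cong (λ u → ev (reverse v) (ev u i)) (sym (List.reverse-involutive v)))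
    (evaluate-reverse (reverse v) i)

  act : List (Fin (suc n)) → Perm n → Perm n
  act []      p = p
  act (s ∷ v) p = apply t 2≤n (toℕ s) (Fin.toℕ≤pred[n] s) (act v p)

  to-act : ∀ v p → to (act v p) ≗ ev v ∘ to p
  to-act []      p i = refl
  to-act (s ∷ v) p i = cong (generator t n s) (to-act v p i)

  from-unique : ∀ (p q : Perm n) → to p ≗ to q → from p ≗ from q
  from-unique p q eq i = trans (cong (from p) (sym (trans (eq (from q i)) (to-from q i)))) (from-to p (from q i))

  private
    levelsᵗ : Perm n → ℕ → ℤ
    levelsᵗ = levels t 2≤n
    cw : Perm n → ℤ
    cw p = coweight t n (levelsᵗ p)
    open Weight (axisWeight t) pairWeight using (weight-cong)

  -- `F` starts at zero, and each letter raises it by at most one.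
  coweight-act : ∀ v p → (∀ i → i < n → levels t 2≤n p i ≡ 0ℤ) →
    coweight t n (levels t 2≤n (act v p)) ℤ.≤ + length v
  coweight-act []      p zeros = ℤ.≤-reflexive (trans (weight-cong n zeros) (coweight-zero t n))
  coweight-act (s ∷ v) p zeros = ℤ.≤-trans
    -- The bound compares `q′` with the result of applying `s` once more, which is `q` again because
    -- `s` is an involution.
    (coweight-Move-≤ (levelMove t 2≤n q′ (toℕ s) (Fin.toℕ≤pred[n] s)))
    (ℤ.+-monoʳ-≤ 1ℤ (ℤ.≤-trans (ℤ.≤-reflexive (weight-cong n λ i _ →
        cong (λ z → level n (from q) z) (involutive s (+ suc i)))) (coweight-act v p zeros)))
    where
    q = act v p
    q′ = act (s ∷ v) p

  -- The start `p₀` is left free: the identity bounds words for `w`, and the remainder of the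
  -- reduction bounds words for the shortened coset element.
  coweight-≤-length : ∀ p p₀ v → (∀ i → i < n → levels t 2≤n p₀ i ≡ 0ℤ) → to p ≗ ev v ∘ to p₀ →
    coweight t n (levels t 2≤n p) ℤ.≤ + length v
  coweight-≤-length p p₀ v zeros eq = subst (ℤ._≤ + length v)
    (weight-cong n λ i _ → cong (λ z → 1ℤ + floorShift n 0ℤ z)
      (from-unique (act v p₀) p (λ j → trans (to-act v p₀ j) (sym (eq j))) (+ suc i)))
    (coweight-act v p₀ zeros)

  levels-id : ∀ i → i < n → levels t 2≤n (idPerm n) i ≡ 0ℤ
  levels-id i i<n = cong (_+_ 1ℤ) (trans (cong (floorShift n 0ℤ) (sym (e (+ suc i) (+ N n))))
    (floorShift₀-pos i 0ℤ i<n))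
    where
    e : ∀ a d → a + 0ℤ ℤ.* d ≡ a
    e = solve-∀

  -- The reduction gives `p = word rest` with `rest` in `W`, so `p rest⁻¹` has length exactly `W`.
  -- Minimality of `p` in its coset bounds its length `a` by `W`, and the estimate from the identity
  -- gives `W ≤ a`.
  length-formula : (endShape t ≡ D → 3 ≤ n) → ∀ p → ParityCondition t 2≤n p →
    (∀ u → InW t n u → ∀ {a b} → HasLength t n (to p) a → HasLength t n (to p ∘ u) b → a ≤ b) →
    LengthIs t n (to p) (coweight t n (levels t 2≤n p))
  length-formula 3≤n p par shortest = W , subst (HasLength t n (to p)) a≡W has-a , W≡
    where
    W = ∣ cw p ∣
    W≡ : + W ≡ cw p
    W≡ = ℤ.0≤i⇒+∣i∣≡i (coweight-nonneg t n (levelsᵗ p))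
    open Reduction (reduce t 2≤n 3≤n W p par (sym W≡))
    rest-parabolic : InParabolic t 2≤n 3≤n rest
    rest-parabolic = parabolic t 2≤n 3≤n _ rest parity vanish
      (sym (ℤ.0≤i⇒+∣i∣≡i (coweight-nonneg t n (heights t 2≤n rest))))
    x = proj₁ rest-parabolic
    x′ = map Fin.suc x
    rest≗ : to rest ≗ ev x′
    rest≗ = proj₂ rest-parabolic
    -- `u` is the inverse of `rest`: for involutions, reversing a word inverts it.
    u = ev (map Fin.suc (reverse x))
    u≡ : ∀ i → u i ≡ ev (reverse x′) i
    u≡ i = cong (λ v → ev v i) (List.reverse-map Fin.suc x)
    p≗ : ev (word ++ x′) ≗ to p
    p≗ i = trans (evaluate-++ t n word x′ i) (trans (cong (ev word) (sym (rest≗ i))) (sym (factorised i)))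
    p∘u : ev word ≗ to p ∘ u
    p∘u i = sym (trans (factorised (u i)) (cong (ev word)
      (trans (rest≗ (u i)) (trans (cong (ev x′) (u≡ i)) (evaluate-reverse x′ i)))))
    u∘rest : ∀ i → u (to rest i) ≡ i
    u∘rest i = trans (u≡ (to rest i)) (trans (cong (ev (reverse x′)) (rest≗ i)) (evaluate-reverse′ x′ i))
    has-W : HasLength t n (to p ∘ u) W
    has-W = record
      { word = word ; word-w = p∘u ; word-m = length-word
      ; minimality = λ v eq → ℤ.drop‿+≤+ (subst (ℤ._≤ + length v) (sym W≡)
          (coweight-≤-length p rest v vanish λ i → sym (trans (eq (to rest i)) (cong (to p) (u∘rest i))))) }
    has = hasLength t n (mirrored p) (word ++ x′) p≗
    a = proj₁ has
    has-a : HasLength t n (to p) a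
    has-a = proj₂ has
    open HasLength has-a using () renaming (word to word-a; word-w to word-a-w; word-m to word-a-m)
    W≤a : W ≤ a
    W≤a = ℤ.drop‿+≤+ (subst₂ ℤ._≤_ (sym W≡) (cong +_ word-a-m)
      (coweight-≤-length p (idPerm n) word-a levels-id λ i → sym (word-a-w i)))
    a≡W : a ≡ W
    a≡W = ℕ.≤-antisym (shortest u (reverse x , λ _ → refl) has-a has-W) W≤a

-- The parity conditions

Σ-split : ∀ m n f → Σ (n ℕ.+ m) f ≡ Σ m f + Σ n (λ i → f (i ℕ.+ m))
Σ-split m zero    f = sym (ℤ.+-identityʳ (Σ m f))
Σ-split m (suc n) f = trans (cong (_+ f (n ℕ.+ m)) (Σ-split m n f))
  (ℤ.+-assoc (Σ m f) (Σ n (λ i → f (i ℕ.+ m))) (f (n ℕ.+ m)))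

Σ-reverse : ∀ n f → Σ n f ≡ Σ n (λ i → f (n ℕ.∸ suc i))
Σ-reverse zero    f = refl
Σ-reverse (suc n) f = begin
  Σ n f + f n                             ≡⟨ ℤ.+-comm (Σ n f) (f n) ⟩
  f n + Σ n f                             ≡⟨ cong (_+_ (f n)) (Σ-reverse n f) ⟩
  f n + Σ n (λ i → f (n ℕ.∸ suc i))       ≡⟨ sym (Σ-cons n (λ i → f (n ℕ.∸ i))) ⟩
  Σ (suc n) (λ i → f (n ℕ.∸ i))             ∎

-- Pairs runner `i + 1` with its mirror image `N - (i + 1)`.
Σ-fold : ∀ n f → Σ (2 * n) f ≡ Σ n (λ i → f i + f (2 * n ℕ.∸ suc i))
Σ-fold n f = begin
  Σ (2 * n) f                                    ≡⟨ cong (λ m → Σ m f) 2n ⟩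
  Σ (n ℕ.+ n) f                                  ≡⟨ Σ-split n n f ⟩
  Σ n f + Σ n (λ i → f (i ℕ.+ n))              ≡⟨ cong (_+_ (Σ n f)) (Σ-reverse n _) ⟩
  Σ n f + Σ n (λ i → f (n ℕ.∸ suc i ℕ.+ n))
    ≡⟨ cong (_+_ (Σ n f)) (Σ-cong n λ i i<n → cong f
         (trans (sym (ℕ.+-∸-comm n i<n)) (cong (ℕ._∸ suc i) (sym 2n)))) ⟩
  Σ n f + Σ n (λ i → f (2 * n ℕ.∸ suc i))      ≡⟨ sym (Σ-+ n f _) ⟩
  Σ n (λ i → f i + f (2 * n ℕ.∸ suc i))        ∎
  where
  2n : 2 * n ≡ n ℕ.+ n
  2n = cong (ℕ._+_ n) (ℕ.+-identityʳ n)

pos : ℤ → ℕ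
pos (+ n)    = n
pos -[1+ n ] = 0

pos-negate : ∀ v → + pos v ≡ v + + pos (- v)
pos-negate (+ zero)  = refl
pos-negate +[1+ n ]  = sym (ℤ.+-identityʳ +[1+ n ])
pos-negate -[1+ n ]  = sym (ℤ.+-inverseʳ +[1+ n ])

<pos⇒ : ∀ {j} v → j < pos v → + suc j ℤ.≤ v
<pos⇒ (+ n) j<n = +≤+ j<n

⇒<pos : ∀ {j} v → + suc j ℤ.≤ v → j < pos v
⇒<pos (+ n) (+≤+ j<n) = j<n

mirror-label : ∀ {n} c → c < n → + suc (2 * n ℕ.∸ suc c) ≡ - + suc c + + N n
mirror-label {n} c c<n = sym (trans (ℤ.-m+n≡n⊖m (suc c) (N n)) (trans (ℤ.⊖-≥ (ℕ.m≤n⇒m≤1+n 1+c≤2n))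
  (cong +_ (ℕ.+-∸-assoc 1 1+c≤2n))))
  where
  1+c≤2n : suc c ≤ 2 * n
  1+c≤2n = ℕ.≤-trans c<n (ℕ.m≤m+n n _)

module _ {n : ℕ} where
  open Division (N n)

  private
    d : ℤ
    d = + N n

  floorShift-multiple : ∀ T x k → floorShift n T (x + k ℤ.* d) ≡ floorShift n T x - k
  floorShift-multiple T x k = trans (cong (_/ℕ N n) (e T x k d)) (/ℕ-shift (T - x) (- k))
    where
    e : ∀ T x k d → T - (x + k ℤ.* d) ≡ T - x + (- k) ℤ.* d
    e = solve-∀

  floorShift-≤ : ∀ T x k → k ℤ.≤ floorShift n T x → x + k ℤ.* d ℤ.≤ T
  floorShift-≤ T x k k≤ = ℤ.0≤i-j⇒j≤i (/ℕ-nonneg⁻¹ (subst (ℤ._≤_ 0ℤ) (sym (floorShift-multiple T x k)) (0≤-gap k≤)))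

  floorShift-≤⁻¹ : ∀ T x k → x + k ℤ.* d ℤ.≤ T → k ℤ.≤ floorShift n T x
  floorShift-≤⁻¹ T x k ≤T = ℤ.0≤i-j⇒j≤i (subst (ℤ._≤_ 0ℤ) (floorShift-multiple T x k) (0≤/ℕ (0≤-gap ≤T)))

  -- The two parity conditions are the cases `T = 0` and `T = n`. Crossings are counted by the
  -- residue of `w i`.
  module Crossing (p : Perm n) (T : ℤ) where
    private
      w = to p
      u = from p
      K = floorShift n T

    Crosses : ℤ → Set
    Crosses i = (i ℤ.≤ T) × (1ℤ + T ℤ.≤ w i)

    -- If `w i = r + 1 + kN`, then `i = w⁻¹ (r + 1) + kN`, and `i` crosses exactly when
    -- `K (r + 1) < k ≤ K (w⁻¹ (r + 1))`. The residue thus has as many crossings as the positive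
    -- part of `jump r`.
    jump : ℕ → ℤ
    jump r = K (u (+ suc r)) - K (+ suc r)

    private
      point-on : ℕ → ℤ → ℤ
      point-on r k = u (+ suc r) + k ℤ.* d

      w-point : ∀ r k → w (point-on r k) ≡ + suc r + k ℤ.* d
      w-point r k = trans (shift (mirrored p) (u (+ suc r)) k) (cong (_+ k ℤ.* d) (to-from p _))

      index : ℕ → ℕ → ℤ
      index r j = K (+ suc r) + 1ℤ + + j

      line : ℕ → List ℤ
      line r = applyUpTo (λ j → point-on r (index r j)) (pos (jump r))

      crossings : ℕ → List ℤ
      crossings zero    = []
      crossings (suc m) = line m ++ crossings m

      length-crossings : ∀ m → + length (crossings m) ≡ Σ m (λ r → + pos (jump r))
      length-crossings zero    = refl
      length-crossings (suc m) = begin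
        + length (line m ++ crossings m)               ≡⟨ cong +_ (List.length-++ (line m)) ⟩
        + (length (line m) ℕ.+ length (crossings m))   ≡⟨ ℤ.pos-+ (length (line m)) _ ⟩
        + length (line m) + + length (crossings m)   ≡⟨ ℤ.+-comm (+ length (line m)) (+ length (crossings m)) ⟩
        + length (crossings m) + + length (line m)
          ≡⟨ cong₂ _+_ (length-crossings m) (cong +_ (List.length-applyUpTo _ (pos (jump m)))) ⟩
        Σ m (λ r → + pos (jump r)) + + pos (jump m)  ∎

      line-residue : ∀ {i r} → suc r < N n → i ∈ line r → w i %ℕ N n ≡ suc r
      line-residue {r = r} 1+r<N i∈ with ∈-applyUpTo⁻ _ i∈
      ... | j , _ , refl = %ℕ-unique (index r j) 1+r<N (w-point r (index r j))

      crossings-residue : ∀ {i} m → m < N n → i ∈ crossings m → ∃ λ r → r < m × w i %ℕ N n ≡ suc r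
      crossings-residue (suc m) m<N i∈ with ∈-++⁻ (line m) i∈
      ... | inj₁ i∈line = m , ℕ.≤-refl , line-residue m<N i∈line
      ... | inj₂ i∈rest with crossings-residue m (ℕ.<-trans ℕ.≤-refl m<N) i∈rest
      ...   | r , r<m , eq = r , ℕ.m<n⇒m<1+n r<m , eq

      point-injective : ∀ r {k k′} → suc r < N n → point-on r k ≡ point-on r k′ → k ≡ k′
      point-injective r {k} {k′} 1+r<N eq = proj₂ (quotient-unique {q = k} {k′} 1+r<N 1+r<N
        (trans (sym (w-point r k)) (trans (cong w eq) (w-point r k′))))

      unique-line : ∀ r → suc r < N n → Unique (line r)
      unique-line r 1+r<N = Unique.applyUpTo⁺₁ _ (pos (jump r)) λ {j} {j′} j<j′ _ eq →
        ℕ.<⇒≢ j<j′ (ℤ.+-injective (cancel (K (+ suc r)) (+ j) (+ j′) (point-injective r 1+r<N eq)))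
        where
        e : ∀ k a → k + 1ℤ + a ≡ a + (k + 1ℤ)
        e = solve-∀
        cancel : ∀ k a b → k + 1ℤ + a ≡ k + 1ℤ + b → a ≡ b
        cancel k a b eq = +-cancelʳ (k + 1ℤ) (trans (sym (e k a)) (trans eq (e k b)))

      unique-crossings : ∀ m → m < N n → Unique (crossings m)
      unique-crossings zero    _   = AllPairs.[]
      unique-crossings (suc m) m<N = Unique.++⁺ (unique-line m m<N)
        (unique-crossings m (ℕ.<-trans ℕ.≤-refl m<N)) λ { (i∈line , i∈rest) →
          disjoint (line-residue m<N i∈line) (crossings-residue m (ℕ.<-trans ℕ.≤-refl m<N) i∈rest) }
        where
        disjoint : ∀ {a} → a ≡ suc m → ∃ (λ r → r < m × a ≡ suc r) → ⊥
        disjoint refl (r , r<m , eq) = ℕ.<⇒≢ r<m (sym (ℕ.suc-injective eq))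

      line-crosses : ∀ {i} r → i ∈ line r → Crosses i
      line-crosses r i∈ with ∈-applyUpTo⁻ _ i∈
      ... | j , j< , refl =
        floorShift-≤ T (u (+ suc r)) (index r j)
          (≤-by (0≤-gap (<pos⇒ (jump r) j<)) (e₁ (K (u (+ suc r))) (K (+ suc r)) (+ j))) ,
        subst (ℤ._≤_ (1ℤ + T)) (sym (w-point r (index r j))) (ℤ.i<j⇒suc[i]≤j (ℤ.≰⇒> λ ≤T →
          negative-absurd (0≤-gap (floorShift-≤⁻¹ T (+ suc r) (index r j) ≤T) ⊞ 0≤+ j) (e₂ (K (+ suc r)) (+ j))))
        where
        e₁ : ∀ a b j → a - (b + 1ℤ + j) ≡ a - b - (1ℤ + j)
        e₁ = solve-∀
        e₂ : ∀ b j → b - (b + 1ℤ + j) + j ≡ -1ℤ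
        e₂ = solve-∀

      crossings-crosses : ∀ {i} m → i ∈ crossings m → Crosses i
      crossings-crosses (suc m) i∈ with ∈-++⁻ (line m) i∈
      ... | inj₁ i∈line = line-crosses m i∈line
      ... | inj₂ i∈rest = crossings-crosses m i∈rest

      line⊆crossings : ∀ {i r} m → r < m → i ∈ line r → i ∈ crossings m
      line⊆crossings {r = r} (suc m) r<1+m i∈ with ℕ.m<1+n⇒m<n∨m≡n r<1+m
      ... | inj₁ r<m  = ∈-++⁺ʳ (line m) (line⊆crossings m r<m i∈)
      ... | inj₂ refl = ∈-++⁺ˡ i∈

      crosses-line : ∀ {i} r q → i ≡ point-on r q → Crosses i → i ∈ line r
      crosses-line r q refl (i≤T , T<wi) = subst (_∈ line r) (cong (point-on r) index≡q)
        (∈-applyUpTo⁺ (λ j → point-on r (index r j)) (⇒<pos (jump r) j<))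
        where
        a = K (u (+ suc r))
        b = K (+ suc r)
        b<q : b ℤ.< q
        b<q = ℤ.≰⇒> λ q≤b → negative-absurd
          (0≤-gap T<wi ⊞ 0≤-gap (subst (ℤ._≤ T) (sym (w-point r q)) (floorShift-≤ T (+ suc r) q q≤b)))
          (e (w (point-on r q)) T)
          where
          e : ∀ x T → x - (1ℤ + T) + (T - x) ≡ -1ℤ
          e = solve-∀
        j = pos (q - b - 1ℤ)
        j≡ : + j ≡ q - b - 1ℤ
        j≡ = go (q - b - 1ℤ) (0≤-gap< b<q)
          where
          go : ∀ v → 0ℤ ℤ.≤ v → + pos v ≡ v
          go (+ _) _ = refl
        index≡q : index r j ≡ q
        index≡q = trans (cong (_+_ (b + 1ℤ)) j≡) (e b q)
          where
          e : ∀ b q → b + 1ℤ + (q - b - 1ℤ) ≡ q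
          e = solve-∀
        j< : + suc j ℤ.≤ jump r
        j< = ≤-by (0≤-gap (floorShift-≤⁻¹ T (u (+ suc r)) q i≤T))
          (trans (cong (λ z → a - b - (1ℤ + z)) j≡) (e a b q))
          where
          e : ∀ a b q → a - b - (1ℤ + (q - b - 1ℤ)) ≡ a - q
          e = solve-∀

      crosses-crossings : ∀ {i} → Crosses i → i ∈ crossings (2 * n)
      crosses-crossings {i} cr = go (w i %ℕ N n) refl
        where
        q = w i /ℕ N n
        i≡ : i ≡ u (w i)
        i≡ = sym (from-to p i)
        go : ∀ r → w i %ℕ N n ≡ r → i ∈ crossings (2 * n)
        -- A multiple of `N` is fixed by `w` and cannot cross.
        go zero    eq = ⊥-elim (negative-absurd (0≤-gap (proj₁ cr) ⊞ 0≤-gap (proj₂ cr))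
          (trans (cong (λ z → T - z + (w i - (1ℤ + T))) i≡wi) (e T (w i))))
          where
          wi≡ : w i ≡ q ℤ.* d
          wi≡ = trans (division (w i)) (trans (cong (λ r → + r + q ℤ.* d) eq) (ℤ.+-identityˡ _))
          i≡wi : i ≡ w i
          i≡wi = trans i≡ (trans (cong u wi≡) (trans (at-multiple (mirrored-from p) q) (sym wi≡)))
          e : ∀ T x → T - x + (x - (1ℤ + T)) ≡ -1ℤ
          e = solve-∀
        go (suc r) eq = line⊆crossings (2 * n) (ℕ.≤-pred (subst (_< N n) eq (n%ℕd<d (w i) (N n))))
          (crosses-line r q (trans i≡ (trans (cong u (trans (division (w i)) (cong (λ r → + r + q ℤ.* d) eq)))
            (shift (mirrored-from p) (+ suc r) q))) cr)

    -- Mirrored residues have opposite jumps, so the positive parts of each pair add up to the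
    -- absolute value of the jump, which has the parity of the jump itself.
    even-jumps : ∀ e → EndReflects n e K → EndReflects n e (K ∘ u) →
      EvenCardinality Crosses → Even (Σ n jump)
    even-jumps e K-end Ku-end (xs , unique , members , divides k eq) =
      subst Even Σ≡ (Even-+ (k′ , len≡) (Even-neg (S , refl)))
      where
      k′ = + k
      S = Σ n λ r → + pos (- jump r)
      e₁ : ∀ e a b → e - a - (e - b) ≡ - (a - b)
      e₁ = solve-∀
      jump-mirror : ∀ c → c < n → jump (2 * n ℕ.∸ suc c) ≡ - jump c
      jump-mirror c c<n = trans
        (cong (λ v → K (u v) - K v) (mirror-label c c<n))
        (trans (cong₂ _-_ (Ku-end c c<n) (K-end c c<n)) (e₁ e (K (u (+ suc c))) (K (+ suc c))))
      same-length : length xs ≡ length (crossings (2 * n))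
      -- The list given with the hypothesis and the explicit enumeration have no repetitions and the
      -- same members, hence are permutations of each other.
      same-length = ↭-length (∼bag⇒↭ (unique∧set⇒bag unique (unique-crossings (2 * n) ℕ.≤-refl)
        (mk⇔ (crosses-crossings ∘ Equivalence.to (members _))
             (Equivalence.from (members _) ∘ crossings-crosses (2 * n)))))
      len≡ : Σ (2 * n) (λ r → + pos (jump r)) ≡ k′ + k′
      len≡ = trans (sym (length-crossings (2 * n))) (trans (cong +_ (trans (sym same-length)
        (trans eq (trans (ℕ.*-comm k 2) (cong (ℕ._+_ k) (ℕ.+-identityʳ k)))))) (ℤ.pos-+ k k))
      Σ≡ : Σ (2 * n) (λ r → + pos (jump r)) + - (S + S) ≡ Σ n jump
      Σ≡ = trans (cong (_+ - (S + S)) (begin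
        Σ (2 * n) (λ r → + pos (jump r))  ≡⟨ Σ-fold n _ ⟩
        Σ n (λ r → + pos (jump r) + + pos (jump (2 * n ℕ.∸ suc r)))
          ≡⟨ Σ-cong n (λ r r<n → cong₂ _+_ (pos-negate (jump r)) (cong (λ v → + pos v) (jump-mirror r r<n))) ⟩
        Σ n (λ r → jump r + + pos (- jump r) + + pos (- jump r))
          ≡⟨ trans (Σ-+ n _ _) (cong (_+ S) (Σ-+ n _ _)) ⟩
        Σ n jump + S + S ∎)) (e₂ (Σ n jump) S)
        where
        e₂ : ∀ j s → j + s + s + - (s + s) ≡ j
        e₂ = solve-∀

module _ {n : ℕ} (p : Perm n) where
  private
    plus-0N : ∀ c → c < n → + suc c ≡ + suc c + 0ℤ ℤ.* + N n
    plus-0N c _ = sym (e (+ suc c) (+ N n))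
      where
      e : ∀ a d → a + 0ℤ ℤ.* d ≡ a
      e = solve-∀

    floorShift₀-end : ∀ (q : Perm n) → EndReflects n -[1+ 1 ] (floorShift n 0ℤ ∘ from q)
    floorShift₀-end q c c<n = +-cancelˡ-1 (trans (level-end q c c<n) (e (floorShift n 0ℤ (from q (+ suc c)))))
      where
      e : ∀ a → 0ℤ - (1ℤ + a) ≡ 1ℤ + (-[1+ 1 ] - a)
      e = solve-∀

  -- On the window `K` is constantly `-1` for the threshold `0`, so `jump` is the level. For the
  -- threshold `n` it is constantly `0`, and `jump` is the excess.
  even-levels-of : Even₀ (to p) → Even (Σ n (state (level n (from p))))
  even-levels-of ev = subst Even (Σ-cong n λ c c<n → trans
      (cong (_-_ (floorShift n 0ℤ (from p (+ suc c)))) (trans (cong (floorShift n 0ℤ) (plus-0N c c<n)) (floorShift₀-pos c 0ℤ c<n)))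
      (ℤ.+-comm (floorShift n 0ℤ (from p (+ suc c))) 1ℤ))
    (Crossing.even-jumps p 0ℤ -[1+ 1 ] (floorShift₀-end (idPerm n)) (floorShift₀-end p) ev)

  even-excesses-of : Evenₙ n (to p) → Even (Σ n (state (excess n (from p))))
  even-excesses-of ev = subst Even (Σ-cong n λ c c<n → trans
      (cong (_-_ (excess n (from p) (+ suc c))) (trans (cong (floorShift n (+ n)) (plus-0N c c<n)) (floorShiftₙ-pos c 0ℤ c<n)))
      (ℤ.+-identityʳ _))
    (Crossing.even-jumps p (+ n) -1ℤ (excess-end (idPerm n)) (excess-end p) ev)

perm : ∀ t {n w} → InW̃ t n w → Perm n
perm CC mp       = toPerm mp
perm BB (mp , _) = toPerm mp
perm BD (mp , _) = toPerm mp
perm DD (mp , _) = toPerm mp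

perm-parity : ∀ t {n w} (2≤n : 2 ≤ n) (w∈ : InW̃ t n w) → (to (perm t w∈) ≡ w) × ParityCondition t 2≤n (perm t w∈)
perm-parity CC 2≤n mp = refl , record { even-levels = λ () ; even-excesses = λ () }
perm-parity BB 2≤n (mp , ev) = refl , record
  { even-levels = λ _ → even-levels-of (toPerm mp) ev ; even-excesses = λ () }
perm-parity BD 2≤n (mp , ev) = refl , record
  { even-levels = λ () ; even-excesses = λ _ → even-excesses-of (toPerm mp) ev }
perm-parity DD 2≤n (mp , ev₀ , evₙ) = refl , record
  { even-levels = λ _ → even-levels-of (toPerm mp) ev₀ ; even-excesses = λ _ → even-excesses-of (toPerm mp) evₙ }

-- Partitions and boundary paths

foldr-applyUpTo : ∀ n f → foldr _+_ 0ℤ (applyUpTo f n) ≡ Σ n f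
foldr-applyUpTo zero    f = refl
foldr-applyUpTo (suc n) f =
  trans (cong (_+_ (f 0)) (foldr-applyUpTo n (f ∘ suc))) (sym (Σ-cons n f))

∑-Σ : ∀ a b f → ∑[ suc a ⋯ b ] f ≡ Σ (b ℕ.∸ a) (λ i → f (suc a ℕ.+ i))
∑-Σ a b f = trans (cong (foldr _+_ 0ℤ) (trans (sym (List.map-∘ (upTo (b ℕ.∸ a)))) (List.map-upTo _ (b ℕ.∸ a))))
  (foldr-applyUpTo (b ℕ.∸ a) _)

∑-suc : ∀ a b f → a < b → ∑[ suc a ⋯ b ] f ≡ f (suc a) + ∑[ suc (suc a) ⋯ b ] f
∑-suc a b f a<b = begin
  ∑[ suc a ⋯ b ] f                                           ≡⟨ ∑-Σ a b f ⟩
  Σ (b ℕ.∸ a) (λ i → f (suc a ℕ.+ i))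
    ≡⟨ cong (λ m → Σ m (λ i → f (suc a ℕ.+ i))) (ℕ.+-∸-assoc 1 a<b) ⟩
  Σ (suc (b ℕ.∸ suc a)) (λ i → f (suc a ℕ.+ i))              ≡⟨ Σ-cons (b ℕ.∸ suc a) _ ⟩
  f (suc a ℕ.+ 0) + Σ (b ℕ.∸ suc a) (λ i → f (suc a ℕ.+ suc i))
    ≡⟨ cong₂ _+_ (cong f (ℕ.+-identityʳ (suc a))) (Σ-cong (b ℕ.∸ suc a) λ i _ → cong f (ℕ.+-suc (suc a) i)) ⟩
  f (suc a) + Σ (b ℕ.∸ suc a) (λ i → f (suc (suc a) ℕ.+ i))
    ≡⟨ cong (_+_ (f (suc a))) (sym (∑-Σ (suc a) b f)) ⟩
  f (suc a) + ∑[ suc (suc a) ⋯ b ] f                       ∎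

private
  length-filter-applyUpTo : ∀ {P : ℕ → Set} (P? : ∀ i → Dec (P i)) f k y → y ≤ k →
    (∀ i → i < k → (P (f i) → i < y) × (i < y → P (f i))) →
    length (filter P? (applyUpTo f k)) ≡ y
  length-filter-applyUpTo P? f zero    .zero z≤n eq = refl
  length-filter-applyUpTo P? f (suc k) zero y≤k eq with P? (f 0)
  ... | yes p = ⊥-elim (ℕ.n≮0 (proj₁ (eq 0 (s≤s z≤n)) p))
  ... | no _  = length-filter-applyUpTo P? (f ∘ suc) k zero z≤n λ i i<k →
    (λ p → ⊥-elim (ℕ.n≮0 (proj₁ (eq (suc i) (s≤s i<k)) p))) , λ ()
  length-filter-applyUpTo P? f (suc k) (suc y) (s≤s y≤k) eq with P? (f 0)
  ... | no ¬p = ⊥-elim (¬p (proj₂ (eq 0 (s≤s z≤n)) (s≤s z≤n)))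
  ... | yes _ = cong suc (length-filter-applyUpTo P? (f ∘ suc) k y y≤k λ i i<k →
    (λ p → ℕ.≤-pred (proj₁ (eq (suc i) (s≤s i<k)) p)) , λ i<y → proj₂ (eq (suc i) (s≤s i<k)) (s≤s i<y))

length-filter-range : ∀ {P : ℕ → Set} (P? : ∀ i → Dec (P i)) k y → y ≤ k →
  (∀ i → 1 ≤ i → i ≤ k → (P i → i ≤ y) × (i ≤ y → P i)) →
  length (filter P? (range 1 k)) ≡ y
length-filter-range P? k y y≤k eq = trans
  (cong (λ xs → length (filter P? xs)) (List.map-upTo suc k))
  (length-filter-applyUpTo P? suc k y y≤k λ i i<k → eq (suc i) (s≤s z≤n) i<k)

private
  entry-antitone : ∀ {xs} → Linked ℕ._≥_ xs → ∀ i → entry xs (suc (suc i)) ≤ entry xs (suc i)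
  entry-antitone []            i       = z≤n
  entry-antitone [-]           i       = z≤n
  entry-antitone (x≥y ∷ _)     zero    = x≥y
  entry-antitone (_ ∷ l)       (suc i) = entry-antitone l i

  entry-beyond : ∀ xs i → length xs ≤ i → entry xs (suc i) ≡ 0
  entry-beyond []       i       _         = refl
  entry-beyond (x ∷ xs) (suc i) (s≤s len≤) = entry-beyond xs i len≤

  all-≤-first : ∀ {xs m} → Linked ℕ._≥_ xs → entry xs 1 ≤ m → All (_≤ m) xs
  all-≤-first []        _   = []
  all-≤-first [-]       x≤m = x≤m ∷ []
  all-≤-first (x≥y ∷ l) x≤m = x≤m ∷ all-≤-first l (ℕ.≤-trans x≥y x≤m)

  first-≤-all : ∀ {xs m} → All (_≤ m) xs → entry xs 1 ≤ m
  first-≤-all []        = z≤n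
  first-≤-all (x≤m ∷ _) = x≤m

module _ (μ : Partition) where
  row-antitone : ∀ {i j} → 1 ≤ i → i ≤ j → row μ j ≤ row μ i
  row-antitone {suc i} {suc j} 1≤i i≤j with ℕ.m≤n⇒m<n∨m≡n i≤j
  ... | inj₂ refl = ℕ.≤-refl
  row-antitone {suc i} {suc (suc j)} 1≤i i≤j | inj₁ (s≤s i<j) =
    ℕ.≤-trans (entry-antitone (decreasing μ) j) (row-antitone 1≤i i<j)

  row-beyond : ∀ {i} → numRows μ < i → row μ i ≡ 0
  row-beyond {suc i} (s≤s k≤i) = entry-beyond (parts μ) i k≤i

  row-positive⇒≤ : ∀ {i} → 0 < row μ i → i ≤ numRows μ
  row-positive⇒≤ {i} 0<row = ℕ.≮⇒≥ λ k<i → ℕ.<⇒≢ 0<row (sym (row-beyond k<i))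

  parts-≤⇒ : ∀ {m} → All (_≤ m) (parts μ) → row μ 1 ≤ m
  parts-≤⇒ = first-≤-all

  ¬parts-≤⇒ : ∀ {m} → ¬ All (_≤ m) (parts μ) → m < row μ 1
  ¬parts-≤⇒ ¬all = ℕ.≰⇒> λ row≤ → ¬all (all-≤-first (decreasing μ) row≤)

  private
    boundary-≤ : ∀ {x y x′ y′} → OnBoundary μ (x , y) → OnBoundary μ (x′ , y′) →
      + x - + y ≡ + x′ - + y′ → y′ ≤ y
    boundary-≤ {x} {y} {x′} {y′} (row≤x , _) on′ eq = ℕ.≮⇒≥ (λ y<y′ → contra y<y′ on′)
      where
      contra : y < y′ → OnBoundary μ (x′ , y′) → ⊥
      contra y<y′ (_ , inj₁ refl) = ℕ.n≮0 y<y′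
      contra y<y′ (_ , inj₂ x′≤row) = negative-absurd
        (0≤-gap (+≤+ (ℕ.≤-trans x′≤row (ℕ.≤-trans (row-antitone (s≤s z≤n) y<y′) row≤x))) ⊞ 0≤-gap< (+<+ y<y′))
        (trans (e (+ x) (+ y) (+ x′) (+ y′)) (trans (cong (λ z → z - (+ x′ - + y′) - 1ℤ) eq)
          (e′ (+ x′ - + y′))))
        where
        e : ∀ x y x′ y′ → x - x′ + (y′ - y - 1ℤ) ≡ x - y - (x′ - y′) - 1ℤ
        e = solve-∀
        e′ : ∀ z → z - z - 1ℤ ≡ -1ℤ
        e′ = solve-∀

  -- On one diagonal, a point further down is also further right, while rows only get shorter
  -- downwards. So the diagonal determines the boundary point, and paths can be compared by content.
  boundary-unique : ∀ {x y x′ y′} → OnBoundary μ (x , y) → OnBoundary μ (x′ , y′) →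
    + x - + y ≡ + x′ - + y′ → (x , y) ≡ (x′ , y′)
  boundary-unique {x} {y} {x′} {y′} on on′ eq with ℕ.≤-antisym (boundary-≤ on′ on (sym eq)) (boundary-≤ on on′ eq)
  ... | refl = cong (_, y) (ℤ.+-injective (+-cancelʳ (- + y) eq))

  row-end-on-boundary : ∀ i → OnBoundary μ (row μ (suc i) , suc i) × OnBoundary μ (row μ (suc i) , i)
  row-end-on-boundary i =
    (entry-antitone (decreasing μ) i , inj₂ ℕ.≤-refl) , (ℕ.≤-refl , above i)
    where
    above : ∀ i → (i ≡ 0) ⊎ (row μ (suc i) ≤ row μ i)
    above zero    = inj₁ refl
    above (suc i) = inj₂ (entry-antitone (decreasing μ) i)

Step-content : ∀ {dir a b} → Step dir a b →
  + proj₁ b - + proj₂ b ≡ 1ℤ + (+ proj₁ a - + proj₂ a)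
Step-content (go-north {x} {y}) = e (+ x) (+ y)
  where
  e : ∀ x y → x - y ≡ 1ℤ + (x - (1ℤ + y))
  e = solve-∀
Step-content (go-east {x} {y}) = e (+ x) (+ y)
  where
  e : ∀ x y → 1ℤ + x - y ≡ 1ℤ + (x - y)
  e = solve-∀

private
  distance : ∀ {a b} → a ℤ.≤ b → b ≡ + pos (b - a) + a
  distance {a} {b} a≤b = trans (e a b) (cong (_+ a) (sym (go (b - a) (0≤-gap a≤b))))
    where
    e : ∀ a b → b ≡ b - a + a
    e = solve-∀
    go : ∀ v → 0ℤ ℤ.≤ v → + pos v ≡ v
    go (+ _) _ = refl

induct-up : (P : ℤ → Set) {a : ℤ} → P a → (∀ t → a ℤ.≤ t → P t → P (ℤ.suc t)) → ∀ t → a ℤ.≤ t → P t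
induct-up P {a} base next t a≤t = subst P (sym (distance a≤t)) (go (pos (t - a)))
  where
  go : ∀ m → P (+ m + a)
  go zero    = subst P (sym (ℤ.+-identityˡ a)) base
  go (suc m) = subst P (sym (ℤ.+-assoc 1ℤ (+ m) a))
    (next (+ m + a) (≤-by (0≤+ m) (e (+ m) a)) (go m))
    where
    e : ∀ m a → m + a - a ≡ m
    e = solve-∀

induct-down : (P : ℤ → Set) {b : ℤ} → P b → (∀ t → t ℤ.< b → P (ℤ.suc t) → P t) → ∀ t → t ℤ.≤ b → P t
induct-down P {b} base prev t t≤b = go (pos (b - t)) t (distance t≤b)
  where
  e : ∀ m t → m + (1ℤ + t) ≡ 1ℤ + m + t
  e = solve-∀
  e′ : ∀ m t → 1ℤ + m + t - t - 1ℤ ≡ m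
  e′ = solve-∀
  go : ∀ m t → b ≡ + m + t → P t
  go zero    t eq = subst P (trans eq (ℤ.+-identityˡ t)) base
  go (suc m) t eq = prev t
    (<-by (0≤+ m) (trans (cong (λ z → z - t - 1ℤ) eq) (e′ (+ m) t)))
    (go m (ℤ.suc t) (trans eq (sym (e (+ m) t))))

module _ {μ : Partition} {dir : ℤ → Direction} (p : BoundaryPath μ dir) where
  X Y : ℤ → ℕ
  X t = proj₁ (point p t)
  Y t = proj₂ (point p t)

  content : ℤ → ℤ
  content t = + X t - + Y t

  content-suc : ∀ t → content (ℤ.suc t) ≡ 1ℤ + content t
  content-suc t = Step-content (step p t)

  content-linear : content 0ℤ ≡ 0ℤ → ∀ t → content t ≡ t
  content-linear base t with ≤-or-> 0ℤ t
  ... | inj₁ 0≤t = induct-up (λ t → content t ≡ t) base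
    (λ t _ eq → trans (content-suc t) (cong (_+_ 1ℤ) eq)) t 0≤t
  ... | inj₂ t<0 = induct-down (λ t → content t ≡ t) base
    (λ t _ eq → +-cancelˡ-1 (trans (sym (content-suc t)) eq)) t (ℤ.<⇒≤ t<0)

  step-north : ∀ t → dir t ≡ north → (X (ℤ.suc t) ≡ X t) × (Y t ≡ suc (Y (ℤ.suc t)))
  step-north t eq with dir t | point p t | point p (ℤ.suc t) | step p t
  step-north t refl | _ | _ | _ | go-north = refl , refl

  step-east : ∀ t → dir t ≡ east → (X (ℤ.suc t) ≡ suc (X t)) × (Y (ℤ.suc t) ≡ Y t)
  step-east t eq with dir t | point p t | point p (ℤ.suc t) | step p t
  step-east t refl | _ | _ | _ | go-east = refl , refl

-- A boundary path is determined only up to a shift of time; this one serves to make time agree with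
-- the diagonal.
shiftPath : ∀ {μ dir} → BoundaryPath μ dir → ∀ c → BoundaryPath μ (λ t → dir (t + c))
shiftPath p c .point t = point p (t + c)
shiftPath p c .onBoundary t = onBoundary p (t + c)
shiftPath {dir = dir} p c .step t =
  subst (λ s → Step (dir (t + c)) (point p (t + c)) (point p s)) (sym (ℤ.+-assoc 1ℤ t c)) (step p (t + c))

-- Periodic profiles of boundary paths

-- V t is the level, relative to the entry at diagonal t of the boundary, of the
-- lowest bead on the same runner; diagonals are counted from the centre.
record Profile (n : ℕ) (V : ℤ → ℤ) : Set where
  field
    drops : ∀ t k → V (t + k ℤ.* + (2 * n)) ≡ V t - k
    reflect : ∀ t → V (-1ℤ - t) ≡ -1ℤ - V t

record Traces (V : ℤ → ℤ) (dir : ℤ → Direction) : Set where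
  field
    north-at : ∀ t → 0ℤ ℤ.≤ V t → dir t ≡ north
    east-at  : ∀ t → V t ℤ.< 0ℤ → dir t ≡ east

-- At an entry with value `v`, the runner has a bead `k` periods later exactly if `k ≤ v`. Its gaps
-- before the entry are the `k` with `v < k < 0`, its beads from the entry on those with
-- `0 ≤ k ≤ v`.
gapsAbove beadsBelow : ℤ → ℤ
gapsAbove v  = + pos (- v - 1ℤ)
beadsBelow v = + pos (v + 1ℤ)

pos-nonpos : ∀ {v} → v ℤ.≤ 0ℤ → pos v ≡ 0
pos-nonpos {+ zero}    _ = refl
pos-nonpos {+[1+ n ]}  (+≤+ ())
pos-nonpos { -[1+ n ]} _ = refl

pos-nonneg : ∀ {v} → 0ℤ ℤ.≤ v → + pos v ≡ v
pos-nonneg {+ n} _ = refl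

gapsAbove-0 : ∀ {v} → -1ℤ ℤ.≤ v → gapsAbove v ≡ 0ℤ
gapsAbove-0 {v} -1≤v = cong +_ (pos-nonpos {v = - v - 1ℤ} (≤-by (0≤-gap -1≤v) (e v)))
  where
  e : ∀ v → 0ℤ - (- v - 1ℤ) ≡ v - -1ℤ
  e = solve-∀

gapsAbove-neg : ∀ {v} → v ℤ.< 0ℤ → gapsAbove v ≡ - v - 1ℤ
gapsAbove-neg {v} v<0 = pos-nonneg {v = - v - 1ℤ} (subst (ℤ._≤_ 0ℤ) (e v) (0≤-gap< v<0))
  where
  e : ∀ v → 0ℤ - v - 1ℤ ≡ - v - 1ℤ
  e = solve-∀

beadsBelow-0 : ∀ {v} → v ℤ.≤ -1ℤ → beadsBelow v ≡ 0ℤ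
beadsBelow-0 {v} v≤-1 = cong +_ (pos-nonpos {v = v + 1ℤ} (≤-by (0≤-gap v≤-1) (e v)))
  where
  e : ∀ v → 0ℤ - (v + 1ℤ) ≡ -1ℤ - v
  e = solve-∀

beadsBelow-pos : ∀ {v} → -1ℤ ℤ.≤ v → beadsBelow v ≡ v + 1ℤ
beadsBelow-pos {v} -1≤v = pos-nonneg {v = v + 1ℤ} (subst (ℤ._≤_ 0ℤ) (e v) (0≤-gap -1≤v))
  where
  e : ∀ v → v - -1ℤ ≡ v + 1ℤ
  e = solve-∀

Σ-member : ∀ n f → (∀ i → i < n → 0ℤ ℤ.≤ f i) → ∀ i → i < n → f i ℤ.≤ Σ n f
Σ-member (suc n) f 0≤f i i<1+n with ℕ.m<1+n⇒m<n∨m≡n i<1+n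
... | inj₂ refl = ≤-by (Σ-nonneg n f λ i i<n → 0≤f i (ℕ.m<n⇒m<1+n i<n)) (e (Σ n f) (f n))
  where
  e : ∀ s a → s + a - a ≡ s
  e = solve-∀
... | inj₁ i<n = ≤-by
  (0≤-gap (Σ-member n f (λ i i<n → 0≤f i (ℕ.m<n⇒m<1+n i<n)) i i<n) ⊞ 0≤f n ℕ.≤-refl)
  (e (Σ n f) (f n) (f i))
  where
  e : ∀ s a b → s + a - b ≡ s - b + a
  e = solve-∀

module Window {n : ℕ} .{{_ : NonZero (2 * n)}} {V : ℤ → ℤ} (profile : Profile n V) where
  open Profile profile
  open Division (2 * n) using (division)

  private
    d : ℤ
    d = + (2 * n)

  windowSum : (ℤ → ℤ) → ℤ → ℤ
  windowSum f t = Σ (2 * n) λ j → f (V (t + + j))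

  -- The window loses the entry at `t` and gains the entry of the same runner one period later,
  -- whose value is one less.
  windowSum-suc : ∀ f t → windowSum f (ℤ.suc t) + f (V t) ≡ windowSum f t + f (V t - 1ℤ)
  windowSum-suc f t = begin
    windowSum f (ℤ.suc t) + f (V t)
      ≡⟨ ℤ.+-comm _ (f (V t)) ⟩
    f (V t) + windowSum f (ℤ.suc t)
      ≡⟨ cong₂ _+_ (cong (f ∘ V) (sym (ℤ.+-identityʳ t)))
           (Σ-cong (2 * n) λ j _ → cong (f ∘ V) (e₁ t (+ j))) ⟩
    f (V (t + + 0)) + Σ (2 * n) (λ j → f (V (t + + suc j)))
      ≡⟨ sym (Σ-cons (2 * n) λ j → f (V (t + + j))) ⟩
    windowSum f t + f (V (t + d))
      ≡⟨ cong (λ v → windowSum f t + f v) (trans (cong V (e₂ t d)) (drops t 1ℤ)) ⟩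
    windowSum f t + f (V t - 1ℤ) ∎
    where
    e₁ : ∀ t j → 1ℤ + t + j ≡ t + (1ℤ + j)
    e₁ = solve-∀
    e₂ : ∀ t d → t + d ≡ t + 1ℤ ℤ.* d
    e₂ = solve-∀

  windowSum-descend : ∀ f t k → windowSum f (t + k ℤ.* d) ≡ windowSum (λ v → f (v - k)) t
  windowSum-descend f t k = Σ-cong (2 * n) λ j _ →
    cong f (trans (cong V (e t k (+ j) d)) (drops (t + + j) k))
    where
    e : ∀ t k j d → t + k ℤ.* d + j ≡ t + j + k ℤ.* d
    e = solve-∀

  -- The diagonal `2n - 1 - i` is the reflection `-1 - i` moved by one period; each accounts for one
  -- of the two units in `-2`.
  V-mirror : ∀ i → i < n → V (+ (2 * n ℕ.∸ suc i)) ≡ -[1+ 1 ] - V (+ i)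
  V-mirror i i<n = trans (cong V (trans (sym (trans (ℤ.m-n≡m⊖n (2 * n) (suc i)) (ℤ.⊖-≥ 1+i≤2n))) (e₁ d (+ i))))
    (trans (drops (-1ℤ - + i) 1ℤ) (trans (cong (_- 1ℤ) (reflect (+ i))) (e₂ (V (+ i)))))
    where
    1+i≤2n : suc i ≤ 2 * n
    1+i≤2n = ℕ.≤-trans i<n (ℕ.m≤m+n n _)
    e₁ : ∀ d i → d - (1ℤ + i) ≡ -1ℤ - i + 1ℤ ℤ.* d
    e₁ = solve-∀
    e₂ : ∀ v → -1ℤ - v - 1ℤ ≡ -[1+ 1 ] - v
    e₂ = solve-∀

  windowSum-0 : ∀ f → windowSum f 0ℤ ≡ Σ n λ i → f (V (+ i)) + f (-[1+ 1 ] - V (+ i))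
  windowSum-0 f = trans (Σ-fold n (λ j → f (V (+ j))))
    (Σ-cong n λ i i<n → cong (λ v → f (V (+ i)) + f v) (V-mirror i i<n))

  windowSum-+ : ∀ f i → windowSum f (+ i) ≡ windowSum f 0ℤ + Σ i λ j → f (V (+ j) - 1ℤ) - f (V (+ j))
  windowSum-+ f zero    = sym (ℤ.+-identityʳ _)
  windowSum-+ f (suc i) = +-cancelʳ (f (V (+ i))) (trans (windowSum-suc f (+ i))
    (trans (cong (_+ f (V (+ i) - 1ℤ)) (windowSum-+ f i))
      (e (windowSum f 0ℤ) (Σ i λ j → f (V (+ j) - 1ℤ) - f (V (+ j))) (f (V (+ i) - 1ℤ)) (f (V (+ i))))))
    where
    e : ∀ w s a b → w + s + a ≡ w + (s + (a - b)) + b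
    e = solve-∀

  windowSum-− : ∀ f i → windowSum f (- + i) ≡
    windowSum f 0ℤ + Σ i λ j → f (-1ℤ - V (+ j)) - f (-[1+ 1 ] - V (+ j))
  windowSum-− f zero    = sym (ℤ.+-identityʳ _)
  windowSum-− f (suc i) = +-cancelʳ (f (-[1+ 1 ] - V (+ i))) (begin
    windowSum f t + f (-[1+ 1 ] - V (+ i))
      ≡⟨ cong (λ v → windowSum f t + f v) (trans (e₁ (V (+ i))) (cong (_- 1ℤ) (sym Vt))) ⟩
    windowSum f t + f (V t - 1ℤ)     ≡⟨ sym (windowSum-suc f t) ⟩
    windowSum f (ℤ.suc t) + f (V t)
      ≡⟨ cong₂ (λ s v → windowSum f s + f v) suc-t Vt ⟩
    windowSum f (- + i) + f (-1ℤ - V (+ i))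
      ≡⟨ cong (_+ f (-1ℤ - V (+ i))) (windowSum-− f i) ⟩
    windowSum f 0ℤ + S + f (-1ℤ - V (+ i))
      ≡⟨ e₂ (windowSum f 0ℤ) S (f (-1ℤ - V (+ i))) (f (-[1+ 1 ] - V (+ i))) ⟩
    windowSum f 0ℤ + (S + (f (-1ℤ - V (+ i)) - f (-[1+ 1 ] - V (+ i)))) + f (-[1+ 1 ] - V (+ i)) ∎)
    where
    t = - + suc i
    S = Σ i λ j → f (-1ℤ - V (+ j)) - f (-[1+ 1 ] - V (+ j))
    t≡ : ∀ i → - (1ℤ + i) ≡ -1ℤ - i
    t≡ = solve-∀
    Vt : V t ≡ -1ℤ - V (+ i)
    Vt = trans (cong V (t≡ (+ i))) (reflect (+ i))
    suc-t : ℤ.suc t ≡ - + i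
    suc-t = e (+ i)
      where
      e : ∀ i → 1ℤ + - (1ℤ + i) ≡ - i
      e = solve-∀
    e₁ : ∀ v → -[1+ 1 ] - v ≡ -1ℤ - v - 1ℤ
    e₁ = solve-∀
    e₂ : ∀ w s a b → w + s + a ≡ w + (s + (a - b)) + b
    e₂ = solve-∀

  -- `B` bounds all values on the first period and every further period lowers them by one, so after
  -- `B + 1` periods all are negative.
  horizon : ∃ λ b → ∀ t → b ℤ.≤ t → V t ℤ.< 0ℤ
  horizon = (B + 1ℤ) ℤ.* d , bound
    where
    B = Σ (2 * n) λ j → + ∣ V (+ j) ∣
    i≤∣i∣ : ∀ i → i ℤ.≤ + ∣ i ∣
    i≤∣i∣ (+ _) = ℤ.≤-refl
    i≤∣i∣ -[1+ _ ] = -≤+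
    bound : ∀ t → (B + 1ℤ) ℤ.* d ℤ.≤ t → V t ℤ.< 0ℤ
    bound t ≤t = <-by
      (0≤-gap (i≤∣i∣ (V (+ r))) ⊞ 0≤-gap (Σ-member (2 * n) _ (λ j _ → 0≤+ ∣ V (+ j) ∣) r (n%ℕd<d t (2 * n))) ⊞ 0≤-gap< B<q)
      (trans (cong (λ z → 0ℤ - z - 1ℤ) (trans (cong V (division t)) (drops (+ r) q)))
        (e (V (+ r)) q (+ ∣ V (+ r) ∣) B))
      where
      r = t %ℕ (2 * n)
      q = t /ℕ (2 * n)
      e : ∀ v q a b → 0ℤ - (v - q) - 1ℤ ≡ a - v + (b - a) + (q - b - 1ℤ)
      e = solve-∀
      B<q : B ℤ.< q
      B<q = ℤ.≰⇒> λ q≤B → negative-absurd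
        (0≤-gap (subst (ℤ._≤_ ((B + 1ℤ) ℤ.* d)) (division t) ≤t) ⊞
          ℤ.*-monoʳ-≤-nonNeg d (0≤-gap q≤B) ⊞ 0≤-gap< (+<+ (n%ℕd<d t (2 * n))))
        (e′ B q d (+ r))
        where
        e′ : ∀ b q d r → r + q ℤ.* d - (b + 1ℤ) ℤ.* d + (b - q) ℤ.* d + (d - r - 1ℤ) ≡ -1ℤ
        e′ = solve-∀

  antihorizon : ∃ λ a → ∀ t → t ℤ.≤ a → 0ℤ ℤ.≤ V t
  antihorizon = -1ℤ - b , λ t t≤ → ≤-by
    (0≤-gap< (beyond (-1ℤ - t) (≤-by (0≤-gap t≤) (e₁ t b))))
    (trans (e₂ (V t)) (cong (λ z → 0ℤ - z - 1ℤ) (sym (reflect t))))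
    where
    b = proj₁ horizon
    beyond = proj₂ horizon
    e₁ : ∀ t b → -1ℤ - t - b ≡ -1ℤ - b - t
    e₁ = solve-∀
    e₂ : ∀ v → v - 0ℤ ≡ 0ℤ - (-1ℤ - v) - 1ℤ
    e₂ = solve-∀

  -- Coordinates of the boundary points

  module Boundary {μ : Partition} {dir : ℤ → Direction} (traces : Traces V dir) (q : BoundaryPath μ dir) where
    open Traces traces

    private
      north-run : ∀ m t → (∀ s → s ℤ.< t → dir s ≡ north) →
        (X q (t - + m) ≡ X q t) × (Y q (t - + m) ≡ m ℕ.+ Y q t)
      north-run zero    t _   = cong (X q) (ℤ.+-identityʳ t) , cong (Y q) (ℤ.+-identityʳ t)
      north-run (suc m) t all with north-run m t all | step-north q (t - + suc m)
                                     (all _ (<-by (0≤+ m) (e t (+ m))))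
        where
        e : ∀ t m → t - (t - (1ℤ + m)) - 1ℤ ≡ m
        e = solve-∀
      ... | X-eq , Y-eq | X-step , Y-step =
        trans (sym X-step) (trans (cong (X q) (e t (+ m))) X-eq) ,
        trans Y-step (cong suc (trans (cong (Y q) (e t (+ m))) Y-eq))
        where
        e : ∀ t m → 1ℤ + (t - (1ℤ + m)) ≡ t - m
        e = solve-∀

      east-run : ∀ m t → (∀ s → t ℤ.≤ s → dir s ≡ east) →
        (X q (+ m + t) ≡ m ℕ.+ X q t) × (Y q (+ m + t) ≡ Y q t)
      east-run zero    t _   = cong (X q) (ℤ.+-identityˡ t) , cong (Y q) (ℤ.+-identityˡ t)
      east-run (suc m) t all with east-run m t all | step-east q (+ m + t) (all _ (≤-by (0≤+ m) (e t (+ m))))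
        where
        e : ∀ t m → m + t - t ≡ m
        e = solve-∀
      ... | X-eq , Y-eq | X-step , Y-step =
        trans (cong (X q) (ℤ.+-assoc 1ℤ (+ m) t)) (trans X-step (cong suc X-eq)) ,
        trans (cong (Y q) (ℤ.+-assoc 1ℤ (+ m) t)) (trans Y-step Y-eq)

      -- Going back along more north steps than there are rows leads below the diagram, where the
      -- boundary is the left axis.
      X-vanish : ∀ t → (∀ s → s ℤ.< t → dir s ≡ north) → X q t ≡ 0
      X-vanish t all = go (north-run (suc (numRows μ)) t all) (proj₂ (onBoundary q (t - + suc (numRows μ))))
        where
        go : ∀ {x y} → (x ≡ X q t) × (y ≡ suc (numRows μ) ℕ.+ Y q t) → (y ≡ 0) ⊎ (x ≤ row μ y) → X q t ≡ 0
        go (refl , ()) (inj₁ refl)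
        go (refl , refl) (inj₂ x≤) =
          ℕ.n≤0⇒n≡0 (ℕ.≤-trans x≤ (ℕ.≤-reflexive (row-beyond μ (s≤s (ℕ.m≤m+n (numRows μ) (Y q t))))))

      -- Going on along more east steps than the row above the current height is long would leave
      -- the boundary, unless that height is `0`.
      Y-vanish : ∀ t → (∀ s → t ℤ.≤ s → dir s ≡ east) → Y q t ≡ 0
      Y-vanish t all = go (Y q t) refl
        where
        contra : ∀ {y x y′} → y′ ≡ suc y → x ≡ suc (row μ (suc y)) ℕ.+ X q t → (y′ ≡ 0) ⊎ (x ≤ row μ y′) → ⊥
        contra refl refl (inj₂ x≤) = ℕ.<⇒≱ (s≤s (ℕ.m≤m+n _ (X q t))) x≤
        go : ∀ y → Y q t ≡ y → y ≡ 0
        go zero    _  = refl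
        go (suc y) eq with east-run (suc (row μ (suc y))) t all
        ... | X-eq , Y-eq = ⊥-elim (contra (trans Y-eq eq) X-eq
          (proj₂ (onBoundary q (+ suc (row μ (suc y)) + t))))

    sign-cases : ∀ t → (0ℤ ℤ.≤ V t) ⊎ (V t ℤ.< 0ℤ)
    sign-cases t = ≤-or-> 0ℤ (V t)

    private
      cancel-step : ∀ {w w′ a b} → w′ + a ≡ w + b → b ≡ a → w′ ≡ w
      cancel-step {a = a} eq refl = +-cancelʳ a eq

      +1-step : ∀ {w w′ a b} → w′ + a ≡ w + b → b ≡ 1ℤ + a → w′ ≡ 1ℤ + w
      +1-step {w} {a = a} eq refl = +-cancelʳ a (trans eq (e w a))
        where
        e : ∀ w a → w + (1ℤ + a) ≡ 1ℤ + w + a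
        e = solve-∀

    private
      X-base : ∀ t → t ℤ.≤ proj₁ antihorizon → + X q t ≡ windowSum gapsAbove t
      X-base t t≤a = trans
        (cong +_ (X-vanish t λ s s<t → north-at s (proj₂ antihorizon s (ℤ.≤-trans (ℤ.<⇒≤ s<t) t≤a))))
        (sym (Σ-zero (2 * n) _ λ j j<2n → gapsAbove-0 (low j j<2n)))
        where
        low : ∀ j → j < 2 * n → -1ℤ ℤ.≤ V (t + + j)
        low j j<2n = ≤-by (proj₂ antihorizon (t + + j - d) (ℤ.≤-trans (≤-by (0≤-gap< (+<+ j<2n) ⊞ 0≤+ 1) (e₁ t (+ j) d)) t≤a))
          (trans (cong (_- -1ℤ) (trans (cong V (e₂ t (+ j) d)) (drops (t + + j - d) 1ℤ))) (e₃ (V (t + + j - d))))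
          where
          e₁ : ∀ t j d → t - (t + j - d) ≡ d - j - 1ℤ + 1ℤ
          e₁ = solve-∀
          e₂ : ∀ t j d → t + j ≡ t + j - d + 1ℤ ℤ.* d
          e₂ = solve-∀
          e₃ : ∀ v → v - 1ℤ - -1ℤ ≡ v
          e₃ = solve-∀

      X-next : ∀ t → + X q t ≡ windowSum gapsAbove t → + X q (ℤ.suc t) ≡ windowSum gapsAbove (ℤ.suc t)
      X-next t eq with sign-cases t
      ... | inj₁ 0≤V = trans (cong +_ (proj₁ (step-north q t (north-at t 0≤V)))) (trans eq (sym
        (cancel-step (windowSum-suc gapsAbove t)
          (trans (gapsAbove-0 {V t - 1ℤ} (≤-by 0≤V (e (V t)))) (sym (gapsAbove-0 {V t} (ℤ.≤-trans -≤+ 0≤V)))))))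
        where
        e : ∀ v → v - 1ℤ - -1ℤ ≡ v
        e = solve-∀
      ... | inj₂ V<0 = trans (cong +_ (proj₁ (step-east q t (east-at t V<0)))) (trans (cong (_+_ 1ℤ) eq) (sym
        (+1-step {w = windowSum gapsAbove t} (windowSum-suc gapsAbove t)
          (trans (gapsAbove-neg {V t - 1ℤ} (<-by (0≤-gap< V<0 ⊞ 0≤+ 1) (e₁ (V t))))
            (trans (e₂ (V t)) (cong (_+_ 1ℤ) (sym (gapsAbove-neg V<0))))))))
        where
        e₁ : ∀ v → 0ℤ - (v - 1ℤ) - 1ℤ ≡ 0ℤ - v - 1ℤ + 1ℤ
        e₁ = solve-∀
        e₂ : ∀ v → - (v - 1ℤ) - 1ℤ ≡ 1ℤ + (- v - 1ℤ)
        e₂ = solve-∀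

      <0⇒≤-1 : ∀ {v} → v ℤ.< 0ℤ → v ℤ.≤ -1ℤ
      <0⇒≤-1 {v} v<0 = ≤-by (0≤-gap< v<0) (e v)
        where
        e : ∀ v → -1ℤ - v ≡ 0ℤ - v - 1ℤ
        e = solve-∀

      Y-base : ∀ t → proj₁ horizon ℤ.≤ t → + Y q t ≡ windowSum beadsBelow t
      Y-base t b≤t = trans
        (cong +_ (Y-vanish t λ s t≤s → east-at s (proj₂ horizon s (ℤ.≤-trans b≤t t≤s))))
        (sym (Σ-zero (2 * n) _ λ j _ → beadsBelow-0
          (<0⇒≤-1 (proj₂ horizon (t + + j) (ℤ.≤-trans b≤t (≤-by (0≤+ j) (e t (+ j))))))))
        where
        e : ∀ t j → t + j - t ≡ j
        e = solve-∀

      Y-prev : ∀ t → + Y q (ℤ.suc t) ≡ windowSum beadsBelow (ℤ.suc t) → + Y q t ≡ windowSum beadsBelow t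
      Y-prev t eq with sign-cases t
      ... | inj₁ 0≤V = trans (cong +_ (proj₂ (step-north q t (north-at t 0≤V)))) (trans (cong (_+_ 1ℤ) eq) (sym
        (+1-step {w = windowSum beadsBelow (ℤ.suc t)} (sym (windowSum-suc beadsBelow t))
          (trans (beadsBelow-pos {V t} (ℤ.≤-trans -≤+ 0≤V))
            (trans (e₁ (V t)) (cong (_+_ 1ℤ) (sym (beadsBelow-pos {V t - 1ℤ} (≤-by 0≤V (e₂ (V t)))))))))))
        where
        e₁ : ∀ v → v + 1ℤ ≡ 1ℤ + (v - 1ℤ + 1ℤ)
        e₁ = solve-∀
        e₂ : ∀ v → v - 1ℤ - -1ℤ ≡ v
        e₂ = solve-∀
      ... | inj₂ V<0 = trans (cong +_ (sym (proj₂ (step-east q t (east-at t V<0))))) (trans eq (sym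
        (cancel-step (sym (windowSum-suc beadsBelow t))
          (trans (beadsBelow-0 {V t} (<0⇒≤-1 V<0)) (sym (beadsBelow-0 {V t - 1ℤ} (≤-by (0≤-gap< V<0 ⊞ 0≤+ 1) (e (V t)))))))))
        where
        e : ∀ v → -1ℤ - (v - 1ℤ) ≡ 0ℤ - v - 1ℤ + 1ℤ
        e = solve-∀

    X-windowSum : ∀ t → + X q t ≡ windowSum gapsAbove t
    X-windowSum t with ≤-or-> (proj₁ antihorizon) t
    ... | inj₁ a≤t = induct-up (λ t → + X q t ≡ windowSum gapsAbove t) (X-base _ ℤ.≤-refl) (λ t _ → X-next t) t a≤t
    ... | inj₂ t<a = X-base t (ℤ.<⇒≤ t<a)

    Y-windowSum : ∀ t → + Y q t ≡ windowSum beadsBelow t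
    Y-windowSum t with ≤-or-> t (proj₁ horizon)
    ... | inj₁ t≤b = induct-down (λ t → + Y q t ≡ windowSum beadsBelow t) (Y-base _ ℤ.≤-refl) (λ t _ → Y-prev t) t t≤b
    ... | inj₂ b<t = Y-base t (ℤ.<⇒≤ b<t)

    -- The reflection `t ↦ -1 - t` exchanges the gaps before time `0` with the beads from time `0`
    -- on, so both coordinates agree there. This identifies time with the diagonal.
    content-0 : content q 0ℤ ≡ 0ℤ
    content-0 = trans (cong₂ _-_ (trans (X-windowSum 0ℤ) (trans (windowSum-0 gapsAbove) balanced))
        (trans (Y-windowSum 0ℤ) (windowSum-0 beadsBelow))) (ℤ.+-inverseʳ (Σ n _))
      where
      e₁ : ∀ v → - v - 1ℤ ≡ -[1+ 1 ] - v + 1ℤ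
      e₁ = solve-∀
      e₂ : ∀ v → - (-[1+ 1 ] - v) - 1ℤ ≡ v + 1ℤ
      e₂ = solve-∀
      balanced : Σ n (λ i → gapsAbove (V (+ i)) + gapsAbove (-[1+ 1 ] - V (+ i))) ≡
                 Σ n (λ i → beadsBelow (V (+ i)) + beadsBelow (-[1+ 1 ] - V (+ i)))
      balanced = Σ-cong n λ i _ → trans
        (cong₂ (λ a b → + pos a + + pos b) (e₁ (V (+ i))) (e₂ (V (+ i))))
        (ℤ.+-comm (beadsBelow (-[1+ 1 ] - V (+ i))) (beadsBelow (V (+ i))))

    content-t : ∀ t → content q t ≡ t
    content-t = content-linear q content-0

-- Counting gaps

-- With v = m - 1 for the level m of runner c, the lowest bead on the runners c and
-- N - c lies lift v periods beyond the central window.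
lift : ℤ → ℕ
lift (+ a)    = a
lift -[1+ a ] = a

-- Tells whether the central bead of the runner pair lies on or after diagonal `0`.
indicator : ℤ → ℤ
indicator (+ _)    = 1ℤ
indicator -[1+ _ ] = 0ℤ

g-lift : ∀ v → g (v + 1ℤ) ≡ + lift v
g-lift (+ a)        = cong g (ℤ.+-comm (+ a) 1ℤ)
g-lift -[1+ zero ]  = refl
g-lift -[1+ suc a ] = refl

∣∣-lift : ∀ v → + ∣ v + 1ℤ ∣ ≡ + lift v + indicator v
∣∣-lift (+ a)        = refl
∣∣-lift -[1+ zero ]  = refl
∣∣-lift -[1+ suc a ] = cong +_ (sym (ℕ.+-identityʳ (suc a)))

-- At most one term is nonzero: the first for negative `v`, the second for `v > 1`. In `pair-gaps`
-- the two terms come from the two rows of a pair of indices.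
g-gaps : ∀ v → g v ≡ gapsAbove (v - 1ℤ) + gapsAbove (- v)
g-gaps v = trans (go v) (cong₂ (λ a b → + pos a + + pos b) (e₁ v) (e₂ v))
  where
  e₁ : ∀ v → - v ≡ - (v - 1ℤ) - 1ℤ
  e₁ = solve-∀
  e₂ : ∀ v → v - 1ℤ ≡ - (- v) - 1ℤ
  e₂ = solve-∀
  go : ∀ v → g v ≡ + pos (- v) + + pos (v - 1ℤ)
  go (+ zero)  = refl
  go +[1+ k ]  = refl
  go -[1+ k ]  = cong +_ (sym (ℕ.+-identityʳ (suc k)))

gapsAbove-at : ∀ {v} k → v ≡ -1ℤ - + k → gapsAbove v ≡ + k
gapsAbove-at {v} k eq = trans (cong (λ z → + pos z) (trans (cong (λ z → - z - 1ℤ) eq) (e (+ k)))) refl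
  where
  e : ∀ k → - (-1ℤ - k) - 1ℤ ≡ k
  e = solve-∀

gapsAbove-none : ∀ {v} k → v ≡ + k - 1ℤ → gapsAbove v ≡ 0ℤ
gapsAbove-none {v} k eq = gapsAbove-0 {v} (≤-by (0≤+ k) (trans (cong (_- -1ℤ) eq) (e (+ k))))
  where
  e : ∀ k → k - 1ℤ - -1ℤ ≡ k
  e = solve-∀

-- The gaps on one runner that are passed while the reading advances by `k` periods from an entry of
-- value `v`.
gapsBetween : ℕ → ℤ → ℤ
gapsBetween k v = gapsAbove (v - + k) - gapsAbove v

-- `a` belongs to the row, `x` to the pair of runners on which gaps are counted. `baseGaps` starts
-- the window at diagonal `0`. `lowerGaps` corrects for moving the start to the central bead,
-- forwards over `i` diagonals or backwards over `i + 1`; `diagonalGaps` is the extra step of the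
-- backward case.
baseGaps lowerGaps diagonalGaps : ℤ → ℤ → ℤ
baseGaps a x = gapsBetween (lift a) x + gapsBetween (lift a) (-[1+ 1 ] - x)
lowerGaps a@(+ _) x      = gapsBetween (lift a) (x - 1ℤ) - gapsBetween (lift a) x
lowerGaps a@(-[1+ _ ]) x = gapsBetween (lift a) (-1ℤ - x) - gapsBetween (lift a) (-[1+ 1 ] - x)
diagonalGaps (+ _) x        = 0ℤ
diagonalGaps a@(-[1+ _ ]) x = lowerGaps a x

private
  neg≡ : ∀ p → -[1+ p ] ≡ -1ℤ - + p
  neg≡ p = e (+ p)
    where
    e : ∀ p → - (1ℤ + p) ≡ -1ℤ - p
    e = solve-∀

  between-high : ∀ k c {v} → v ≡ + c - 1ℤ → gapsBetween k v ≡ gapsAbove (v - + k)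
  between-high k c {v} eq = trans (cong (_-_ (gapsAbove (v - + k))) (gapsAbove-none c eq)) (ℤ.+-identityʳ _)

  between-low : ∀ k c {v} → v ≡ -1ℤ - + c → gapsBetween k v ≡ + k
  between-low k c {v} eq = trans
    (cong₂ _-_ (gapsAbove-at (c ℕ.+ k) (trans (cong (_- + k) eq) (e₁ (+ c) (+ k)))) (gapsAbove-at c eq))
    (e₂ (+ c) (+ k))
    where
    e₁ : ∀ c k → -1ℤ - c - k ≡ -1ℤ - (c + k)
    e₁ = solve-∀
    e₂ : ∀ c k → c + k - c ≡ k
    e₂ = solve-∀

-- Up to its lowest bead the row's own runner has no gaps; the mirrored runner has one in each of
-- the `lift` periods.
diagonal-gaps : ∀ a → baseGaps a a + diagonalGaps a a ≡ + lift a
diagonal-gaps (+ a) = trans (cong (_+ 0ℤ) (cong₂ _+_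
    (trans (between-high a (suc a) (e₁ (+ a))) (gapsAbove-none 1 (e₂ (+ a))))
    (between-low a (suc a) (e₃ (+ a))))) (e₄ (+ a))
  where
  e₁ : ∀ a → a ≡ 1ℤ + a - 1ℤ
  e₁ = solve-∀
  e₂ : ∀ a → a - a ≡ 1ℤ - 1ℤ
  e₂ = solve-∀
  e₃ : ∀ a → -[1+ 1 ] - a ≡ -1ℤ - (1ℤ + a)
  e₃ = solve-∀
  e₄ : ∀ a → 0ℤ + a + 0ℤ ≡ a
  e₄ = solve-∀
diagonal-gaps v@(-[1+ p ]) = begin
  G v + G (-[1+ 1 ] - v) + (G (-1ℤ - v) - G (-[1+ 1 ] - v))
    ≡⟨ e₄ (G v) (G (-[1+ 1 ] - v)) (G (-1ℤ - v)) ⟩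
  G v + G (-1ℤ - v)
    ≡⟨ cong₂ _+_ (between-low p p (neg≡ p))
         (trans (between-high p (suc p) at) (gapsAbove-none 1 (trans (cong (_- + p) at) (e₂ (+ p))))) ⟩
  + p + 0ℤ ≡⟨ ℤ.+-identityʳ (+ p) ⟩
  + p ∎
  where
  G = gapsBetween p
  at : -1ℤ - v ≡ 1ℤ + + p - 1ℤ
  at = trans (cong (_-_ -1ℤ) (neg≡ p)) (e₁ (+ p))
    where
    e₁ : ∀ p → -1ℤ - (-1ℤ - p) ≡ 1ℤ + p - 1ℤ
    e₁ = solve-∀
  e₂ : ∀ p → 1ℤ + p - 1ℤ - p ≡ 1ℤ - 1ℤ
  e₂ = solve-∀
  e₄ : ∀ a b c → a + b + (c - b) ≡ a + c
  e₄ = solve-∀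

private
  A+B-pos : ∀ b x → baseGaps (+ b) x + lowerGaps (+ b) x ≡
    gapsBetween b (x - 1ℤ) + gapsBetween b (-[1+ 1 ] - x)
  A+B-pos b x = e (gapsBetween b x) (gapsBetween b (-[1+ 1 ] - x)) (gapsBetween b (x - 1ℤ))
    where
    e : ∀ p q r → p + q + (r - p) ≡ r + q
    e = solve-∀

  A+B-neg : ∀ b x → baseGaps -[1+ b ] x + lowerGaps -[1+ b ] x ≡
    gapsBetween b x + gapsBetween b (-1ℤ - x)
  A+B-neg b x = e (gapsBetween b x) (gapsBetween b (-[1+ 1 ] - x)) (gapsBetween b (-1ℤ - x))
    where
    e : ∀ p q r → p + q + (r - q) ≡ p + r
    e = solve-∀

  g-gaps-at : ∀ {v u u′} → v - 1ℤ ≡ u → - v ≡ u′ → g v ≡ gapsAbove u + gapsAbove u′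
  g-gaps-at {v} eq eq′ = trans (g-gaps v) (cong₂ (λ a b → gapsAbove a + gapsAbove b) eq eq′)

  g-at-pos : ∀ {v} k → v ≡ + suc k → g v ≡ + k
  g-at-pos k eq = cong g eq

  g-at-neg : ∀ {v} k → v ≡ - + k → g v ≡ + k
  g-at-neg {v} k eq = trans (g-nonpos {v} (≤-by (0≤+ k) (trans (cong (_-_ 0ℤ) eq) (e (+ k)))))
    (trans (cong -_ eq) (ℤ.neg-involutive (+ k)))
    where
    e : ∀ k → 0ℤ - (- k) ≡ k
    e = solve-∀

-- Seen from each row, one of the other two mirrored runners consists of gaps only and contributes
-- the `lift` of the row, while the other contributes `F₁` or `F₂`. By `g-gaps`, `F₁ + F₂` is one
-- term of `pairWeight`; the two lifts and the indicator make up the other. The argument `b` has the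
-- larger index, hence the correction on its side alone.
pair-gaps : ∀ a b → baseGaps a b + (baseGaps b a + lowerGaps b a) + indicator b ≡
  pairWeight (a + 1ℤ) (b + 1ℤ)
pair-gaps (+ a) (+ b) = begin
  baseGaps (+ a) (+ b) + (baseGaps (+ b) (+ a) + lowerGaps (+ b) (+ a)) + 1ℤ
    ≡⟨ cong₂ (λ p q → p + q + 1ℤ)
         (cong₂ _+_ (between-high a (suc b) (e₀ (+ b))) (between-low a (suc b) (e₁ (+ b))))
         (trans (A+B-pos b (+ a)) (cong₂ _+_ (between-high b a refl) (between-low b (suc a) (e₁ (+ a))))) ⟩
  F₁ + + a + (F₂ + + b) + 1ℤ ≡⟨ e₂ F₁ F₂ (+ a) (+ b) ⟩
  F₂ + F₁ + (1ℤ + (+ a + + b))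
    ≡⟨ cong₂ _+_ (sym (g-gaps-at (e₃ (+ a) (+ b)) (e₄ (+ a) (+ b))))
         (sym (g-at-pos (suc (a ℕ.+ b)) (e₅ (+ a) (+ b)))) ⟩
  pairWeight (+ a + 1ℤ) (+ b + 1ℤ) ∎
  where
  F₁ = gapsAbove (+ b - + a)
  F₂ = gapsAbove (+ a - 1ℤ - + b)
  e₀ : ∀ a → a ≡ 1ℤ + a - 1ℤ
  e₀ = solve-∀
  e₁ : ∀ a → -[1+ 1 ] - a ≡ -1ℤ - (1ℤ + a)
  e₁ = solve-∀
  e₂ : ∀ f f′ a b → f + a + (f′ + b) + 1ℤ ≡ f′ + f + (1ℤ + (a + b))
  e₂ = solve-∀
  e₃ : ∀ a b → a + 1ℤ - (b + 1ℤ) - 1ℤ ≡ a - 1ℤ - b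
  e₃ = solve-∀
  e₄ : ∀ a b → - (a + 1ℤ - (b + 1ℤ)) ≡ b - a
  e₄ = solve-∀
  e₅ : ∀ a b → a + 1ℤ + (b + 1ℤ) ≡ 1ℤ + (1ℤ + (a + b))
  e₅ = solve-∀
pair-gaps (+ a) b@(-[1+ q ]) = begin
  baseGaps (+ a) b + (baseGaps b (+ a) + lowerGaps b (+ a)) + 0ℤ
    ≡⟨ cong₂ (λ p q → p + q + 0ℤ)
         (cong₂ _+_ (between-low a q (neg≡ q)) (trans (between-high a q at) (cong (λ z → gapsAbove (z - + a)) at)))
         (trans (A+B-neg q (+ a)) (cong₂ _+_ (between-high q (suc a) (e₀ (+ a))) (between-low q a refl))) ⟩
  + a + F₁ + (F₂ + + q) + 0ℤ ≡⟨ e₂ F₁ F₂ (+ a) (+ q) ⟩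
  + a + + q + (F₂ + F₁)
    ≡⟨ cong₂ _+_ (sym (g-at-pos (a ℕ.+ q) (trans (cong (λ z → + a + 1ℤ - (z + 1ℤ)) (neg≡ q)) (e₃ (+ a) (+ q)))))
         (sym (g-gaps-at (trans (cong (λ z → + a + 1ℤ + (z + 1ℤ) - 1ℤ) (neg≡ q)) (e₄ (+ a) (+ q)))
           (trans (cong (λ z → - (+ a + 1ℤ + (z + 1ℤ))) (neg≡ q)) (e₅ (+ a) (+ q))))) ⟩
  pairWeight (+ a + 1ℤ) (b + 1ℤ) ∎
  where
  F₁ = gapsAbove (+ q - 1ℤ - + a)
  F₂ = gapsAbove (+ a - + q)
  e₀ : ∀ a → a ≡ 1ℤ + a - 1ℤ
  e₀ = solve-∀
  at : -[1+ 1 ] - b ≡ + q - 1ℤ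
  at = trans (cong (_-_ -[1+ 1 ]) (neg≡ q)) (e₁ (+ q))
    where
    e₁ : ∀ q → -[1+ 1 ] - (-1ℤ - q) ≡ q - 1ℤ
    e₁ = solve-∀
  e₂ : ∀ f f′ a b → a + f + (f′ + b) + 0ℤ ≡ a + b + (f′ + f)
  e₂ = solve-∀
  e₃ : ∀ a q → a + 1ℤ - (-1ℤ - q + 1ℤ) ≡ 1ℤ + (a + q)
  e₃ = solve-∀
  e₄ : ∀ a q → a + 1ℤ + (-1ℤ - q + 1ℤ) - 1ℤ ≡ a - q
  e₄ = solve-∀
  e₅ : ∀ a q → - (a + 1ℤ + (-1ℤ - q + 1ℤ)) ≡ q - 1ℤ - a
  e₅ = solve-∀
pair-gaps a@(-[1+ p ]) (+ b) = begin
  baseGaps a (+ b) + (baseGaps (+ b) a + lowerGaps (+ b) a) + 1ℤ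
    ≡⟨ cong₂ (λ p q → p + q + 1ℤ)
         (cong₂ _+_ (between-high p (suc b) (e₀ (+ b))) (between-low p (suc b) (e₁ (+ b))))
         (trans (A+B-pos b a) (cong₂ _+_ (between-low b (suc p) (trans (cong (_- 1ℤ) (neg≡ p)) (e₆ (+ p))))
           (trans (between-high b p at) (cong (λ z → gapsAbove (z - + b)) at)))) ⟩
  F₁ + + p + (+ b + F₂) + 1ℤ ≡⟨ e₂ F₁ F₂ (+ p) (+ b) ⟩
  1ℤ + (+ p + + b) + (F₁ + F₂)
    ≡⟨ cong₂ _+_ (sym (g-at-neg (suc (p ℕ.+ b)) (trans (cong (λ z → z + 1ℤ - (+ b + 1ℤ)) (neg≡ p)) (e₃ (+ p) (+ b)))))
         (sym (g-gaps-at (trans (cong (λ z → z + 1ℤ + (+ b + 1ℤ) - 1ℤ) (neg≡ p)) (e₄ (+ p) (+ b)))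
           (trans (cong (λ z → - (z + 1ℤ + (+ b + 1ℤ))) (neg≡ p)) (e₅ (+ p) (+ b))))) ⟩
  pairWeight (a + 1ℤ) (+ b + 1ℤ) ∎
  where
  F₁ = gapsAbove (+ b - + p)
  F₂ = gapsAbove (+ p - 1ℤ - + b)
  e₀ : ∀ a → a ≡ 1ℤ + a - 1ℤ
  e₀ = solve-∀
  e₁ : ∀ a → -[1+ 1 ] - a ≡ -1ℤ - (1ℤ + a)
  e₁ = solve-∀
  e₆ : ∀ p → -1ℤ - p - 1ℤ ≡ -1ℤ - (1ℤ + p)
  e₆ = solve-∀
  at : -[1+ 1 ] - a ≡ + p - 1ℤ
  at = trans (cong (_-_ -[1+ 1 ]) (neg≡ p)) (e (+ p))
    where
    e : ∀ q → -[1+ 1 ] - (-1ℤ - q) ≡ q - 1ℤ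
    e = solve-∀
  e₂ : ∀ f f′ a b → f + a + (b + f′) + 1ℤ ≡ 1ℤ + (a + b) + (f + f′)
  e₂ = solve-∀
  e₃ : ∀ p b → -1ℤ - p + 1ℤ - (b + 1ℤ) ≡ - (1ℤ + (p + b))
  e₃ = solve-∀
  e₄ : ∀ p b → -1ℤ - p + 1ℤ + (b + 1ℤ) - 1ℤ ≡ b - p
  e₄ = solve-∀
  e₅ : ∀ p b → - (-1ℤ - p + 1ℤ + (b + 1ℤ)) ≡ p - 1ℤ - b
  e₅ = solve-∀
pair-gaps a@(-[1+ p ]) b@(-[1+ q ]) = begin
  baseGaps a b + (baseGaps b a + lowerGaps b a) + 0ℤ
    ≡⟨ cong₂ (λ p q → p + q + 0ℤ)
         (cong₂ _+_ (between-low p q (neg≡ q)) (trans (between-high p q (at₂ q)) (cong (λ z → gapsAbove (z - + p)) (at₂ q))))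
         (trans (A+B-neg q a) (cong₂ _+_ (between-low q p (neg≡ p))
           (trans (between-high q (suc p) (trans at₁ (e₀ (+ p)))) (cong (λ z → gapsAbove (z - + q)) at₁)))) ⟩
  + p + F₁ + (+ q + F₂) + 0ℤ ≡⟨ e₂ F₁ F₂ (+ p) (+ q) ⟩
  F₁ + F₂ + (+ p + + q)
    ≡⟨ cong₂ _+_
         (sym (g-gaps-at (trans (cong₂ (λ z z′ → z + 1ℤ - (z′ + 1ℤ) - 1ℤ) (neg≡ p) (neg≡ q)) (e₄ (+ p) (+ q)))
           (trans (cong₂ (λ z z′ → - (z + 1ℤ - (z′ + 1ℤ))) (neg≡ p) (neg≡ q)) (e₅ (+ p) (+ q)))))
         (sym (g-at-neg (p ℕ.+ q) (trans (cong₂ (λ z z′ → z + 1ℤ + (z′ + 1ℤ)) (neg≡ p) (neg≡ q)) (e₃ (+ p) (+ q))))) ⟩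
  pairWeight (a + 1ℤ) (b + 1ℤ) ∎
  where
  F₁ = gapsAbove (+ q - 1ℤ - + p)
  F₂ = gapsAbove (+ p - + q)
  e₀ : ∀ a → a ≡ 1ℤ + a - 1ℤ
  e₀ = solve-∀
  at₂ : ∀ q → -[1+ 1 ] - -[1+ q ] ≡ + q - 1ℤ
  at₂ q = trans (cong (_-_ -[1+ 1 ]) (neg≡ q)) (e (+ q))
    where
    e : ∀ q → -[1+ 1 ] - (-1ℤ - q) ≡ q - 1ℤ
    e = solve-∀
  at₁ : -1ℤ - a ≡ + p
  at₁ = trans (cong (_-_ -1ℤ) (neg≡ p)) (e (+ p))
    where
    e : ∀ p → -1ℤ - (-1ℤ - p) ≡ p
    e = solve-∀
  e₂ : ∀ f f′ a b → a + f + (b + f′) + 0ℤ ≡ f + f′ + (a + b)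
  e₂ = solve-∀
  e₃ : ∀ p q → -1ℤ - p + 1ℤ + (-1ℤ - q + 1ℤ) ≡ - (p + q)
  e₃ = solve-∀
  e₄ : ∀ p q → -1ℤ - p + 1ℤ - (-1ℤ - q + 1ℤ) - 1ℤ ≡ q - 1ℤ - p
  e₄ = solve-∀
  e₅ : ∀ p q → - (-1ℤ - p + 1ℤ - (-1ℤ - q + 1ℤ)) ≡ p - q
  e₅ = solve-∀

Σ-square : ∀ n (f : ℕ → ℕ → ℤ) →
  Σ n (λ i → Σ n (f i)) ≡ Σ n (λ i → f i i + Σ i (λ j → f j i + f i j))
Σ-square zero    f = refl
Σ-square (suc n) f = begin
  Σ n (λ i → Σ n (f i) + f i n) + (Σ n (f n) + f n n)
    ≡⟨ cong (_+ (Σ n (f n) + f n n)) (Σ-+ n (λ i → Σ n (f i)) (λ i → f i n)) ⟩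
  Σ n (λ i → Σ n (f i)) + Σ n (λ i → f i n) + (Σ n (f n) + f n n)
    ≡⟨ e (Σ n (λ i → Σ n (f i))) (Σ n (λ i → f i n)) (Σ n (f n)) (f n n) ⟩
  Σ n (λ i → Σ n (f i)) + (f n n + (Σ n (λ i → f i n) + Σ n (f n)))
    ≡⟨ cong₂ (λ u v → u + (f n n + v)) (Σ-square n f) (sym (Σ-+ n (λ i → f i n) (f n))) ⟩
  Σ n (λ i → f i i + Σ i (λ j → f j i + f i j)) + (f n n + Σ n (λ j → f j n + f n j)) ∎
  where
  e : ∀ a b c d → a + b + (c + d) ≡ a + (d + (b + c))
  e = solve-∀

Σ-const : ∀ n c → Σ n (λ _ → c) ≡ + n ℤ.* c
Σ-const zero    c = sym (ℤ.*-zeroˡ c)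
Σ-const (suc n) c = trans (cong (_+ c) (Σ-const n c)) (e (+ n) c)
  where
  e : ∀ n c → n ℤ.* c + c ≡ (1ℤ + n) ℤ.* c
  e = solve-∀

-- λ_{R(i+1)} - λ_{r(i+1)}: the gaps on each runner that are read between these rows.
rowGaps : ℕ → (ℕ → ℤ) → ℕ → ℤ
rowGaps n v i =
  Σ n (λ j → baseGaps (v i) (v j)) + Σ i (λ j → lowerGaps (v i) (v j)) + diagonalGaps (v i) (v i)

-- The gaps of a row on its own runners add one `lift` to the `1 + x₀ + xₙ` of them from the
-- diagonal hooks, giving `(1 + x₀) + (1 + xₙ)`. In the last sum the part `i` times the indicator is
-- one unit for each `j < i`, as `pair-gaps` requires; the part `1 + x₀` completes the absolute
-- value in `axisWeight`.
total-weight : ∀ t n (v : ℕ → ℤ) →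
  Σ n (rowGaps n v)
    + (1ℤ + x₀ t + xₙ t) ℤ.* Σ n (λ i → + lift (v i))
    + Σ n (λ i → indicator (v i) ℤ.* (+ i + 1ℤ + x₀ t))
  ≡ coweight t n (λ i → v i + 1ℤ)
total-weight t n v = begin
  Σ n (rowGaps n v) + c ℤ.* Σ n l + Σ n s
    ≡⟨ cong₂ (λ a b → a + b + Σ n s) rows (sym (Σ-* n c l)) ⟩
  Σ n (λ i → A i i + Σ i (λ j → A j i + A i j) + Σ i (B i) + E i) + Σ n (λ i → c ℤ.* l i) + Σ n s
    ≡⟨ sym (trans (Σ-+ n _ s) (cong (_+ Σ n s) (Σ-+ n _ (λ i → c ℤ.* l i)))) ⟩
  Σ n (λ i → A i i + Σ i (λ j → A j i + A i j) + Σ i (B i) + E i + c ℤ.* l i + s i)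
    ≡⟨ Σ-cong n (λ i _ → summand i) ⟩
  coweight t n (λ i → v i + 1ℤ) ∎
  where
  c = 1ℤ + x₀ t + xₙ t
  l s E : ℕ → ℤ
  l i = + lift (v i)
  s i = indicator (v i) ℤ.* (+ i + 1ℤ + x₀ t)
  E i = diagonalGaps (v i) (v i)
  A B : ℕ → ℕ → ℤ
  A i j = baseGaps (v i) (v j)
  B i j = lowerGaps (v i) (v j)
  rows : Σ n (rowGaps n v) ≡ Σ n (λ i → A i i + Σ i (λ j → A j i + A i j) + Σ i (B i) + E i)
  rows = trans (Σ-+ n _ E) (trans (cong (_+ Σ n E) (trans (Σ-+ n _ (λ i → Σ i (B i)))
      (cong (_+ Σ n (λ i → Σ i (B i))) (Σ-square n A))))
    (sym (trans (Σ-+ n _ E) (cong (_+ Σ n E) (Σ-+ n _ (λ i → Σ i (B i)))))))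
  summand : ∀ i →
    A i i + Σ i (λ j → A j i + A i j) + Σ i (B i) + E i + c ℤ.* l i + s i ≡
    axisWeight t (v i + 1ℤ) + Σ i (λ j → pairWeight (v j + 1ℤ) (v i + 1ℤ))
  summand i = begin
    A i i + S₁ + Σ i (B i) + E i + c ℤ.* l i + s i
      ≡⟨ e₁ (A i i) S₁ (Σ i (B i)) (E i) (l i) (indicator (v i)) (+ i) (x₀ t) (xₙ t) ⟩
    A i i + E i + (1ℤ + x₀ t + xₙ t) ℤ.* l i + (1ℤ + x₀ t) ℤ.* indicator (v i)
      + (S₁ + Σ i (B i) + + i ℤ.* indicator (v i))
      ≡⟨ cong₂ (λ a b → a + (1ℤ + x₀ t + xₙ t) ℤ.* l i + (1ℤ + x₀ t) ℤ.* indicator (v i) + b)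
           (diagonal-gaps (v i)) pairs ⟩
    l i + (1ℤ + x₀ t + xₙ t) ℤ.* l i + (1ℤ + x₀ t) ℤ.* indicator (v i) + S₂
      ≡⟨ e₂ (l i) (indicator (v i)) (x₀ t) (xₙ t) S₂ ⟩
    (1ℤ + x₀ t) ℤ.* (l i + indicator (v i)) + (1ℤ + xₙ t) ℤ.* l i + S₂
      ≡⟨ cong₂ (λ a b → (1ℤ + x₀ t) ℤ.* a + (1ℤ + xₙ t) ℤ.* b + S₂)
           (sym (∣∣-lift (v i))) (sym (g-lift (v i))) ⟩
    axisWeight t (v i + 1ℤ) + S₂ ∎
    where
    S₁ = Σ i λ j → A j i + A i j
    S₂ = Σ i λ j → pairWeight (v j + 1ℤ) (v i + 1ℤ)
    pairs : S₁ + Σ i (B i) + + i ℤ.* indicator (v i) ≡ S₂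
    pairs = begin
      S₁ + Σ i (B i) + + i ℤ.* indicator (v i)
        ≡⟨ cong (_+_ (S₁ + Σ i (B i))) (sym (Σ-const i (indicator (v i)))) ⟩
      S₁ + Σ i (B i) + Σ i (λ _ → indicator (v i))
        ≡⟨ sym (trans (Σ-+ i _ (λ _ → indicator (v i))) (cong (_+ Σ i (λ _ → indicator (v i))) (Σ-+ i _ (B i)))) ⟩
      Σ i (λ j → A j i + A i j + B i j + indicator (v i))
        ≡⟨ Σ-cong i (λ j _ → trans (cong (_+ indicator (v i)) (ℤ.+-assoc (A j i) (A i j) (B i j))) (pair-gaps (v j) (v i))) ⟩
      S₂ ∎
    e₁ : ∀ a s b e l ι i x y →
      a + s + b + e + (1ℤ + x + y) ℤ.* l + ι ℤ.* (i + 1ℤ + x) ≡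
      a + e + (1ℤ + x + y) ℤ.* l + (1ℤ + x) ℤ.* ι + (s + b + i ℤ.* ι)
    e₁ = solve-∀
    e₂ : ∀ l ι x y s →
      l + (1ℤ + x + y) ℤ.* l + (1ℤ + x) ℤ.* ι + s ≡
      (1ℤ + x) ℤ.* (l + ι) + (1ℤ + y) ℤ.* l + s
    e₂ = solve-∀

-- Rows of the core

x₀-bounds : ∀ t → (-1ℤ ℤ.≤ x₀ t) × (x₀ t ℤ.≤ 0ℤ)
x₀-bounds CC = -≤+ , ℤ.≤-refl
x₀-bounds BB = ℤ.≤-refl , -≤+
x₀-bounds BD = -≤+ , ℤ.≤-refl
x₀-bounds DD = ℤ.≤-refl , -≤+

Σ-sub : ∀ n f f′ → Σ n (λ i → f i - f′ i) ≡ Σ n f - Σ n f′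
Σ-sub zero    f f′ = refl
Σ-sub (suc n) f f′ = trans (cong (_+ (f n - f′ n)) (Σ-sub n f f′)) (e (Σ n f) (Σ n f′) (f n) (f′ n))
  where
  e : ∀ a b c d → a - b + (c - d) ≡ a + c - (b + d)
  e = solve-∀

-- The diagonal at which the bead of the central window sits on one of the
-- runners i + 1 and N - (i + 1).
centralOf : ℤ → ℕ → ℤ
centralOf (+ _)    i = + i
centralOf -[1+ _ ] i = - + suc i

module Rows {n : ℕ} .{{_ : NonZero (2 * n)}} {V : ℤ → ℤ} (profile : Profile n V)
  {μ : Partition} {dir : ℤ → Direction} (traces : Traces V dir) (q : BoundaryPath μ dir) where
  open Profile profile
  open Traces traces
  open Window profile
  open Boundary traces q

  private
    d : ℤ
    d = + (2 * n)

  on-boundary⇒ : ∀ {x y} → OnBoundary μ (x , y) → point q (+ x - + y) ≡ (x , y)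
  on-boundary⇒ {x} {y} on = sym (boundary-unique μ on (onBoundary q t) (sym (content-t t)))
    where t = + x - + y

  bead-row : ∀ t → 0ℤ ℤ.≤ V t → ∃ λ y → (Y q t ≡ suc y) × (Y q (ℤ.suc t) ≡ y) × (X q (ℤ.suc t) ≡ X q t) ×
    (row μ (suc y) ≡ X q t)
  bead-row t 0≤V with step-north q t (north-at t 0≤V)
  ... | X-eq , Y-eq = Y q (ℤ.suc t) , Y-eq , refl , X-eq ,
    ℕ.≤-antisym (ℕ.≤-trans (proj₁ (onBoundary q (ℤ.suc t))) (ℕ.≤-reflexive X-eq))
      (upper Y-eq (proj₂ (onBoundary q t)))
    where
    upper : ∀ {y x y′} → y ≡ suc y′ → (y ≡ 0) ⊎ (x ≤ row μ y) → x ≤ row μ (suc y′)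
    upper refl (inj₂ x≤) = x≤

  X-at : ∀ a → X q (+ a) ≡ Y q (+ a) ℕ.+ a
  X-at a = ℤ.+-injective (trans (e (+ X q (+ a)) (+ Y q (+ a))) (cong (_+_ (+ Y q (+ a))) (content-t (+ a))))
    where
    e : ∀ x y → x ≡ y + (x - y)
    e = solve-∀

  -- The boundary point on diagonal `a` is `(Y + a , Y)`, and rows are decreasing. The cases `a = 0`
  -- and `a = n` give the diagonal boxes and the long diagonal hooks.
  ≤Y⇒long : ∀ a i → 1 ≤ i → i ≤ Y q (+ a) → i ℕ.+ a ≤ row μ i
  ≤Y⇒long a i 1≤i i≤Y = go (Y q (+ a)) refl (proj₂ (onBoundary q (+ a)))
    where
    go : ∀ y → Y q (+ a) ≡ y → (Y q (+ a) ≡ 0) ⊎ (X q (+ a) ≤ row μ (Y q (+ a))) → i ℕ.+ a ≤ row μ i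
    go _ _ (inj₁ Y≡0) = ⊥-elim (ℕ.n≮0 (ℕ.≤-trans 1≤i (ℕ.≤-trans i≤Y (ℕ.≤-reflexive Y≡0))))
    go _ _ (inj₂ X≤) = ℕ.≤-trans (ℕ.+-monoˡ-≤ a i≤Y) (ℕ.≤-trans (ℕ.≤-reflexive (sym (X-at a)))
      (ℕ.≤-trans X≤ (row-antitone μ 1≤i i≤Y)))

  long⇒≤Y : ∀ a i → 1 ≤ i → i ℕ.+ a ≤ row μ i → i ≤ Y q (+ a)
  long⇒≤Y a i 1≤i long = ℕ.≮⇒≥ λ Y<i → ℕ.<⇒≱ (ℕ.+-monoˡ-< a Y<i)
    (ℕ.≤-trans long (ℕ.≤-trans (row-antitone μ (s≤s z≤n) Y<i)
      (ℕ.≤-trans (proj₁ (onBoundary q (+ a))) (ℕ.≤-reflexive (X-at a)))))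

  Y≤numRows : ∀ a → Y q (+ a) ≤ numRows μ
  Y≤numRows a = go (Y q (+ a)) refl
    where
    go : ∀ y → Y q (+ a) ≡ y → y ≤ numRows μ
    go zero    _  = z≤n
    go (suc y) eq = row-positive⇒≤ μ (ℕ.≤-trans (ℕ.≤-trans (s≤s z≤n) (ℕ.m≤m+n (suc y) a))
      (≤Y⇒long a (suc y) (s≤s z≤n) (ℕ.≤-reflexive (sym eq))))

  diagonalBoxes≡Y : diagonalBoxes μ ≡ Y q 0ℤ
  diagonalBoxes≡Y = length-filter-range (λ i → i ℕ.≤? row μ i) (numRows μ) (Y q 0ℤ) (Y≤numRows 0) λ i 1≤i _ →
    (λ i≤row → long⇒≤Y 0 i 1≤i (subst (_≤ row μ i) (sym (ℕ.+-identityʳ i)) i≤row)) ,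
    λ i≤Y → subst (_≤ row μ i) (ℕ.+-identityʳ i) (≤Y⇒long 0 i 1≤i i≤Y)

  point-0≡centre : point q 0ℤ ≡ centre μ
  point-0≡centre = cong₂ _,_ (trans (trans (X-at 0) (ℕ.+-identityʳ _)) (sym diagonalBoxes≡Y)) (sym diagonalBoxes≡Y)

  -- Self-conjugacy makes arm and leg of a diagonal box equal, so its hook length is twice the arm
  -- plus one, and exceeds `2n` exactly when the arm is at least `n`.
  longDiagonalHooks≡Y : SelfConjugate μ → longDiagonalHooks (2 * n) μ ≡ Y q (+ n)
  longDiagonalHooks≡Y conj = length-filter-range (λ i → (i ℕ.≤? row μ i) ×-dec (2 * n ℕ.<? hook μ i i))
    (numRows μ) (Y q (+ n)) (Y≤numRows n) λ i 1≤i _ →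
    (λ { (i≤row , 2n<) → long⇒≤Y n i 1≤i (arm⇒ i i≤row (half (row μ i ℕ.∸ i) (subst (2 * n <_) (hook≡ i 1≤i) 2n<))) }) ,
    λ i≤Y → ℕ.≤-trans (ℕ.m≤m+n i n) (≤Y⇒long n i 1≤i i≤Y) ,
      subst (2 * n <_) (sym (hook≡ i 1≤i)) (double (row μ i ℕ.∸ i) (⇒arm i (≤Y⇒long n i 1≤i i≤Y)))
    where
    hook≡ : ∀ i → 1 ≤ i → hook μ i i ≡ suc (2 * (row μ i ℕ.∸ i))
    hook≡ i 1≤i = trans (cong (λ c → (row μ i ℕ.∸ i) ℕ.+ (c ℕ.∸ i) ℕ.+ 1) (sym (conj i 1≤i)))
      (trans (ℕ.+-comm _ 1) (cong (λ z → suc ((row μ i ℕ.∸ i) ℕ.+ z)) (sym (ℕ.+-identityʳ _))))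
    half : ∀ a → 2 * n < suc (2 * a) → n ≤ a
    half a (s≤s 2n≤2a) = ℕ.*-cancelˡ-≤ 2 2n≤2a
    double : ∀ a → n ≤ a → 2 * n < suc (2 * a)
    double a n≤a = s≤s (ℕ.*-monoʳ-≤ 2 n≤a)
    arm⇒ : ∀ i → i ≤ row μ i → n ≤ row μ i ℕ.∸ i → i ℕ.+ n ≤ row μ i
    arm⇒ i i≤row n≤ = ℕ.≤-trans (ℕ.+-monoʳ-≤ i n≤) (ℕ.≤-reflexive (ℕ.m+[n∸m]≡n i≤row))
    ⇒arm : ∀ i → i ℕ.+ n ≤ row μ i → n ≤ row μ i ℕ.∸ i
    ⇒arm i ≤row = ℕ.≤-trans (ℕ.≤-reflexive (sym (ℕ.m+n∸m≡n i n))) (ℕ.∸-monoˡ-≤ i ≤row)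

  -- Beads from diagonal `n` on lie beyond the central window, and each pair of runners has `lift`
  -- of them. Hence `d` is the sum of the lifts.
  Y-n : + Y q (+ n) ≡ Σ n (λ i → + lift (V (+ i)))
  Y-n = trans (Y-windowSum (+ n)) (trans (windowSum-+ beadsBelow n)
    (trans (cong (_+ Σ n (λ j → beadsBelow (V (+ j) - 1ℤ) - beadsBelow (V (+ j)))) (windowSum-0 beadsBelow))
      (trans (sym (Σ-+ n _ _)) (Σ-cong n λ i _ → pointwise (V (+ i))))))
    where
    pointwise : ∀ v → beadsBelow v + beadsBelow (-[1+ 1 ] - v) + (beadsBelow (v - 1ℤ) - beadsBelow v) ≡ + lift v
    pointwise v = trans (e (beadsBelow v) (beadsBelow (-[1+ 1 ] - v)) (beadsBelow (v - 1ℤ)))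
      (trans (cong₂ (λ a b → + pos a + + pos b) (e₁ v) (e₂ v)) (go v))
      where
      e : ∀ a b c → a + b + (c - a) ≡ b + c
      e = solve-∀
      e₁ : ∀ v → -[1+ 1 ] - v + 1ℤ ≡ - v - 1ℤ
      e₁ = solve-∀
      e₂ : ∀ v → v - 1ℤ + 1ℤ ≡ v
      e₂ = solve-∀
      go : ∀ v → + pos (- v - 1ℤ) + + pos v ≡ + lift v
      go (+ zero)  = refl
      go +[1+ a ]  = refl
      go -[1+ a ]  = cong +_ (ℕ.+-identityʳ a)

  -- Rows below the centre are shorter than their index and contribute nothing. Passing diagonal `j`
  -- adds a row only at a bead; its length is its index plus `j`, so its excess is `j + 1 + x₀`,
  -- which `x₀ ≥ -1` keeps nonnegative.
  tail-sum : ∀ t j → ∑[ suc (Y q (+ j)) ⋯ numRows μ ] (diagonalExcess t μ) ≡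
    Σ j (λ i → indicator (V (+ i)) ℤ.* (+ i + 1ℤ + x₀ t))
  tail-sum t zero = trans (∑-Σ (Y q 0ℤ) (numRows μ) (diagonalExcess t μ))
    (Σ-zero (numRows μ ℕ.∸ Y q 0ℤ) _ λ i _ → short (suc (Y q 0ℤ) ℕ.+ i) (s≤s (ℕ.m≤m+n (Y q 0ℤ) i)))
    where
    short : ∀ i → Y q 0ℤ < i → diagonalExcess t μ i ≡ 0ℤ
    short i Y<i = ℤ.i≥j⇒i⊔j≡i (≤-by (0≤-gap< (+<+ row<i) ⊞ 0≤-gap (proj₂ (x₀-bounds t))) (e (+ row μ i) (+ i) (x₀ t)))
      where
      row<i : row μ i < i
      row<i = ℕ.≰⇒> λ i≤row → ℕ.<⇒≱ Y<i (long⇒≤Y 0 i (ℕ.≤-trans (s≤s z≤n) Y<i)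
        (subst (_≤ row μ i) (sym (ℕ.+-identityʳ i)) i≤row))
      e : ∀ r i x → 0ℤ - (r - i + 1ℤ + x) ≡ i - r - 1ℤ + (0ℤ - x)
      e = solve-∀
  tail-sum t (suc j) = go (V (+ j)) refl
    where
    term : ℤ → ℤ
    term v = indicator v ℤ.* (+ j + 1ℤ + x₀ t)
    k = numRows μ
    S : ℕ → ℤ
    S y = ∑[ suc y ⋯ k ] (diagonalExcess t μ)
    conclude : S (Y q (+ suc j)) ≡ S (Y q (+ j)) + term (V (+ j)) →
      S (Y q (+ suc j)) ≡ Σ j (λ i → indicator (V (+ i)) ℤ.* (+ i + 1ℤ + x₀ t)) + term (V (+ j))
    conclude eq = trans eq (cong (_+ term (V (+ j))) (tail-sum t j))
    go : ∀ v → V (+ j) ≡ v → S (Y q (+ suc j)) ≡ Σ (suc j) (λ i → indicator (V (+ i)) ℤ.* (+ i + 1ℤ + x₀ t))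
    go -[1+ a ] V≡ = conclude (trans
      (cong S (proj₂ (step-east q (+ j) (east-at (+ j) (subst (ℤ._< 0ℤ) (sym V≡) -<+)))))
      (sym (trans (cong (λ v → S (Y q (+ j)) + term v) V≡) (ℤ.+-identityʳ _))))
    go (+ a) V≡ with bead-row (+ j) (subst (ℤ._≤_ 0ℤ) (sym V≡) (0≤+ a))
    ... | y , Y≡ , Y′≡ , _ , row≡ = conclude (begin
      S (Y q (+ suc j))                            ≡⟨ cong S Y′≡ ⟩
      S y                                          ≡⟨ ∑-suc y k (diagonalExcess t μ) y<k ⟩
      diagonalExcess t μ (suc y) + S (suc y)     ≡⟨ cong₂ _+_ excess≡ (cong S (sym Y≡)) ⟩
      (+ j + 1ℤ + x₀ t) + S (Y q (+ j))      ≡⟨ e₁ (+ j + 1ℤ + x₀ t) (S (Y q (+ j))) ⟩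
      S (Y q (+ j)) + term (+ a)                 ≡⟨ cong (λ v → S (Y q (+ j)) + term v) (sym V≡) ⟩
      S (Y q (+ j)) + term (V (+ j))             ∎)
      where
      e₁ : ∀ a s → a + s ≡ s + 1ℤ ℤ.* a
      e₁ = solve-∀
      row≡′ : row μ (suc y) ≡ suc y ℕ.+ j
      row≡′ = trans row≡ (trans (X-at j) (cong (ℕ._+ j) Y≡))
      y<k : y < k
      y<k = row-positive⇒≤ μ (subst (0 <_) (sym row≡′) (s≤s z≤n))
      excess≡ : diagonalExcess t μ (suc y) ≡ + j + 1ℤ + x₀ t
      excess≡ = trans (cong (ℤ._⊔_ 0ℤ) inner≡)
        (ℤ.i≤j⇒i⊔j≡j (≤-by (0≤+ j ⊞ 0≤-gap (proj₁ (x₀-bounds t))) (e₂ (+ j) (x₀ t))))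
        where
        e₂ : ∀ j x → j + 1ℤ + x - 0ℤ ≡ j + (x - -1ℤ)
        e₂ = solve-∀
        e₃ : ∀ y j x → y + j - y + 1ℤ + x ≡ j + 1ℤ + x
        e₃ = solve-∀
        inner≡ : + row μ (suc y) - + suc y + 1ℤ + x₀ t ≡ + j + 1ℤ + x₀ t
        inner≡ = trans (cong (λ r → + r - + suc y + 1ℤ + x₀ t) row≡′) (e₃ (+ suc y) (+ j) (x₀ t))

  -- The diagonals at which the rows `r(i + 1)` and `R(i + 1)` end.
  central lowest : ℕ → ℤ
  central i = centralOf (V (+ i)) i
  lowest i  = central i + + lift (V (+ i)) ℤ.* d

  V-neg : ∀ i → V (- + suc i) ≡ -1ℤ - V (+ i)
  V-neg i = trans (cong V (e (+ i))) (reflect (+ i))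
    where
    e : ∀ i → - (1ℤ + i) ≡ -1ℤ - i
    e = solve-∀

  V-central : ∀ i → V (central i) ≡ + lift (V (+ i))
  V-central i = go (V (+ i)) refl
    where
    go : ∀ v → V (+ i) ≡ v → V (centralOf v i) ≡ + lift v
    go (+ a)    eq = eq
    go -[1+ a ] eq = trans (V-neg i) (trans (cong (_-_ -1ℤ) eq) (e (+ a)))
      where
      e : ∀ a → -1ℤ - (- (1ℤ + a)) ≡ a
      e = solve-∀

  V-lowest : ∀ i → V (lowest i) ≡ 0ℤ
  V-lowest i = trans (drops (central i) (+ lift (V (+ i)))) (trans (cong (_- + lift (V (+ i))) (V-central i))
    (ℤ.+-inverseʳ (+ lift (V (+ i)))))

  private
    windowSum-base : ∀ a → windowSum (gapsBetween (lift a)) 0ℤ ≡ Σ n λ j → baseGaps a (V (+ j))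
    windowSum-base a = windowSum-0 (gapsBetween (lift a))

  windowSum-central : ∀ i → windowSum (gapsBetween (lift (V (+ i)))) (central i) ≡ rowGaps n (V ∘ +_) i
  windowSum-central i = go (V (+ i)) refl
    where
    go : ∀ v → V (+ i) ≡ v → windowSum (gapsBetween (lift v)) (centralOf v i) ≡
      Σ n (λ j → baseGaps v (V (+ j))) + Σ i (λ j → lowerGaps v (V (+ j))) + diagonalGaps v v
    go v@(+ a) _ = trans (windowSum-+ (gapsBetween a) i)
      (trans (cong (_+ Σ i (λ j → lowerGaps v (V (+ j)))) (windowSum-base v)) (sym (ℤ.+-identityʳ _)))
    go v@(-[1+ a ]) eq = trans (windowSum-− (gapsBetween a) (suc i))
      (trans (cong (_+ Σ (suc i) (λ j → lowerGaps v (V (+ j)))) (windowSum-base v))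
        (trans (cong (λ z → Σ n (λ j → baseGaps v (V (+ j))) + (Σ i (λ j → lowerGaps v (V (+ j))) + lowerGaps v z)) eq)
          (sym (ℤ.+-assoc (Σ n (λ j → baseGaps v (V (+ j)))) (Σ i (λ j → lowerGaps v (V (+ j)))) (lowerGaps v v)))))

  -- The two diagonals differ by whole periods, so both windows meet the runners in the same order,
  -- and the difference becomes a single window sum of `gapsBetween`.
  X-difference : ∀ i → + X q (lowest i) - + X q (central i) ≡ rowGaps n (V ∘ +_) i
  X-difference i = trans
    (cong₂ _-_ (trans (X-windowSum (lowest i)) (windowSum-descend gapsAbove (central i) (+ lift (V (+ i))))) (X-windowSum (central i)))
    (trans (sym (Σ-sub (2 * n) _ _)) (windowSum-central i))

  length-sum : ∀ t → SelfConjugate μ →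
    Σ n (λ i → + X q (lowest i) - + X q (central i))
      + (1ℤ + x₀ t + xₙ t) ℤ.* + longDiagonalHooks (2 * n) μ
      + ∑[ suc (longDiagonalHooks (2 * n) μ) ⋯ numRows μ ] (diagonalExcess t μ)
    ≡ coweight t n (λ i → V (+ i) + 1ℤ)
  length-sum t conj = trans
    (cong₂ _+_
      (cong₂ (λ a b → a + (1ℤ + x₀ t + xₙ t) ℤ.* b) (Σ-cong n λ i _ → X-difference i)
        (trans (cong +_ (longDiagonalHooks≡Y conj)) Y-n))
      (trans (cong (λ y → ∑[ suc y ⋯ numRows μ ] (diagonalExcess t μ)) (longDiagonalHooks≡Y conj)) (tail-sum t n)))
    (total-weight t n (V ∘ +_))

-- The rows R(i) and r(i)

private
  +-double : ∀ n → + (2 * n) ≡ + n + + n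
  +-double n = cong (λ z → + (n ℕ.+ z)) (ℕ.+-identityʳ n)

module Extremal {n : ℕ} .{{_ : NonZero n}} .{{_ : NonZero (2 * n)}} {V : ℤ → ℤ} (profile : Profile n V)
  {μ : Partition} {dir : ℤ → Direction} (traces : Traces V dir) (q : BoundaryPath μ dir) where
  open Profile profile
  open Traces traces
  open Window profile
  open Boundary traces q
  open Rows profile traces q
  open Division (2 * n)

  private
    d : ℤ
    d = + (2 * n)

  row-diagonal : ℕ → ℤ
  row-diagonal b = + row μ b - + b

  row-point : ∀ b → (point q (row-diagonal (suc b)) ≡ (row μ (suc b) , suc b)) ×
    (point q (ℤ.suc (row-diagonal (suc b))) ≡ (row μ (suc b) , b))
  row-point b = on-boundary⇒ (proj₁ on) ,
    trans (cong (point q) (e (+ row μ (suc b)) (+ b))) (on-boundary⇒ (proj₂ on))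
    where
    on = row-end-on-boundary μ b
    e : ∀ r b → 1ℤ + (r - (1ℤ + b)) ≡ r - b
    e = solve-∀

  row-bead : ∀ b → 0ℤ ℤ.≤ V (row-diagonal (suc b))
  row-bead b with sign-cases (row-diagonal (suc b))
  ... | inj₁ 0≤V = 0≤V
  ... | inj₂ V<0 = ⊥-elim (ℕ.1+n≢n (sym (trans (sym (cong proj₂ (proj₂ (row-point b))))
    (trans (proj₂ (step-east q _ (east-at _ V<0))) (cong proj₂ (proj₁ (row-point b)))))))

  record BeadRow (t : ℤ) : Set where
    field
      1≤Y    : 1 ≤ Y q t
      row≡   : row μ (Y q t) ≡ X q t
      next≡  : point q (ℤ.suc t) ≡ (row μ (Y q t) , Y q t ℕ.∸ 1)
      here≡  : point q t ≡ (row μ (Y q t) , Y q t)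
      diag≡  : row-diagonal (Y q t) ≡ t

  beadRow : ∀ t → 0ℤ ℤ.≤ V t → BeadRow t
  beadRow t 0≤V with bead-row t 0≤V
  ... | y , Y≡ , Y′≡ , X′≡ , row≡ = record
    { 1≤Y = subst (1 ≤_) (sym Y≡) (s≤s z≤n)
    ; row≡ = r≡
    ; next≡ = cong₂ _,_ (trans X′≡ (sym r≡)) (trans Y′≡ (sym (cong (ℕ._∸ 1) Y≡)))
    ; here≡ = cong (_, Y q t) (sym r≡)
    ; diag≡ = trans (cong (λ z → + z - + Y q t) r≡) (content-t t) }
    where
    r≡ : row μ (Y q t) ≡ X q t
    r≡ = trans (cong (row μ) Y≡) row≡

  private
    1+i≤2n : ∀ {i} → i < n → suc i ≤ 2 * n
    1+i≤2n i<n = ℕ.≤-trans i<n (ℕ.m≤m+n n _)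

    negative-form : ∀ {i} k → i < n → - + suc i + k ℤ.* d ≡ + (2 * n ℕ.∸ suc i) + (k - 1ℤ) ℤ.* d
    negative-form {i} k i<n = trans (e (+ suc i) k d) (cong (_+ (k - 1ℤ) ℤ.* d)
      (trans (ℤ.m-n≡m⊖n (2 * n) (suc i)) (ℤ.⊖-≥ (1+i≤2n i<n))))
      where
      e : ∀ a k d → - a + k ℤ.* d ≡ d - a + (k - 1ℤ) ℤ.* d
      e = solve-∀

  central-residue : ∀ i → i < n →
    (central i %ℕ (2 * n) ≡ i) ⊎ (suc (central i %ℕ (2 * n)) ≡ N n ℕ.∸ suc i)
  central-residue i i<n = go (V (+ i))
    where
    go : ∀ v → (centralOf v i %ℕ (2 * n) ≡ i) ⊎ (suc (centralOf v i %ℕ (2 * n)) ≡ N n ℕ.∸ suc i)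
    go (+ a)    = inj₁ (%ℕ-unique 0ℤ (1+i≤2n i<n) (e (+ i) d))
      where
      e : ∀ i d → i ≡ i + 0ℤ ℤ.* d
      e = solve-∀
    go -[1+ a ] = inj₂ (trans (cong suc (%ℕ-unique (0ℤ - 1ℤ) (ℕ.∸-monoʳ-< (s≤s z≤n) (1+i≤2n i<n))
      (trans (e (- + suc i) d) (negative-form 0ℤ i<n)))) (sym (ℕ.+-∸-assoc 1 (1+i≤2n i<n))))
      where
      e : ∀ i d → i ≡ i + 0ℤ ℤ.* d
      e = solve-∀

  lowest-residue : ∀ i → lowest i %ℕ (2 * n) ≡ central i %ℕ (2 * n)
  lowest-residue i = %ℕ-shift (central i) (+ lift (V (+ i)))

  central-bounds : ∀ i → i < n → (- + n ℤ.≤ central i) × (central i ℤ.< + n)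
  central-bounds i i<n = go (V (+ i))
    where
    go : ∀ v → (- + n ℤ.≤ centralOf v i) × (centralOf v i ℤ.< + n)
    go (+ a)    = ≤-by (0≤+ i ⊞ 0≤+ n) (e (+ i) (+ n)) , +<+ i<n
      where
      e : ∀ i n → i - (- n) ≡ i + n
      e = solve-∀
    go -[1+ a ] = ℤ.neg-mono-≤ (+≤+ i<n) , ℤ.<-≤-trans -<+ (0≤+ n)

  -- On the runner of the central bead the sign of `V` bounds the number of periods by `lift`. On
  -- the mirrored runner all beads come before the central window.
  bead-≤-lowest : ∀ i → i < n → ∀ k t → 0ℤ ℤ.≤ V t →
    (t ≡ + i + k ℤ.* d) ⊎ (t ≡ - + suc i + k ℤ.* d) → t ℤ.≤ lowest i
  bead-≤-lowest i i<n k t 0≤V eq = go (V (+ i)) refl eq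
    where
    scaled : ∀ {z} → 0ℤ ℤ.≤ z → 0ℤ ℤ.≤ z ℤ.* d
    scaled = ℤ.*-monoʳ-≤-nonNeg d
    on-pos : t ≡ + i + k ℤ.* d → 0ℤ ℤ.≤ V (+ i) - k
    on-pos refl = subst (ℤ._≤_ 0ℤ) (drops (+ i) k) 0≤V
    on-neg : t ≡ - + suc i + k ℤ.* d → 0ℤ ℤ.≤ -1ℤ - V (+ i) - k
    on-neg refl = subst (ℤ._≤_ 0ℤ) (trans (drops (- + suc i) k) (cong (_- k) (V-neg i))) 0≤V
    go : ∀ v → V (+ i) ≡ v → (t ≡ + i + k ℤ.* d) ⊎ (t ≡ - + suc i + k ℤ.* d) →
      t ℤ.≤ centralOf v i + + lift v ℤ.* d
    go (+ a) V≡ (inj₁ t≡) = ≤-by (scaled (subst (λ z → 0ℤ ℤ.≤ z - k) V≡ (on-pos t≡)))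
      (trans (cong (_-_ (+ i + + a ℤ.* d)) t≡) (e (+ i) (+ a) k d))
      where
      e : ∀ i a k d → i + a ℤ.* d - (i + k ℤ.* d) ≡ (a - k) ℤ.* d
      e = solve-∀
    go (+ a) V≡ (inj₂ t≡) = ≤-by
      (scaled (subst (λ z → 0ℤ ℤ.≤ -1ℤ - z - k) V≡ (on-neg t≡) ⊞ 0≤+ (a ℕ.+ a ℕ.+ 1)) ⊞ 0≤+ (i ℕ.+ suc i))
      (trans (cong (_-_ (+ i + + a ℤ.* d)) t≡) (e (+ i) (+ a) k d))
      where
      e : ∀ i a k d → i + a ℤ.* d - (- (1ℤ + i) + k ℤ.* d) ≡
        (-1ℤ - a - k + (a + a + 1ℤ)) ℤ.* d + (i + (1ℤ + i))
      e = solve-∀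
    go -[1+ a ] V≡ (inj₂ t≡) = ≤-by (scaled (subst (λ z → 0ℤ ℤ.≤ -1ℤ - z - k) V≡ (on-neg t≡)))
      (trans (cong (_-_ (- + suc i + + a ℤ.* d)) t≡) (e (- + suc i) (+ a) k d))
      where
      e : ∀ i a k d → i + a ℤ.* d - (i + k ℤ.* d) ≡ (-1ℤ - (- (1ℤ + a)) - k) ℤ.* d
      e = solve-∀
    go -[1+ a ] V≡ (inj₁ t≡) = ≤-by
      (scaled (subst (λ z → 0ℤ ℤ.≤ z - k) V≡ (on-pos t≡) ⊞ 0≤+ (a ℕ.+ a)) ⊞
        (0≤-gap< (+<+ i<n) ⊞ 0≤-gap< (+<+ i<n)) ⊞ 0≤+ 1)
      (trans (cong (_-_ (- + suc i + + a ℤ.* d)) t≡)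
        (trans (e₁ (+ i) (+ a) k d) (trans
          (cong (λ z → (- (1ℤ + + a) - k + (+ a + + a)) ℤ.* d + (z - (1ℤ + (+ i + + i)))) (+-double n))
          (e₂ ((- (1ℤ + + a) - k + (+ a + + a)) ℤ.* d) (+ n) (+ i)))))
      where
      e₁ : ∀ i a k d → - (1ℤ + i) + a ℤ.* d - (i + k ℤ.* d) ≡
        (- (1ℤ + a) - k + (a + a)) ℤ.* d + (d - (1ℤ + (i + i)))
      e₁ = solve-∀
      e₂ : ∀ z n i → z + (n + n - (1ℤ + (i + i))) ≡ z + ((n - i - 1ℤ) + (n - i - 1ℤ)) + 1ℤ
      e₂ = solve-∀

  residue-unique : ∀ {t t′} → - + n ℤ.≤ t → t ℤ.< + n → - + n ℤ.≤ t′ → t′ ℤ.< + n →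
    t %ℕ (2 * n) ≡ t′ %ℕ (2 * n) → t ≡ t′
  residue-unique {t} {t′} l u l′ u′ eq = trans (division t) (trans
    (cong₂ (λ r k → + r + k ℤ.* d) eq (ℤ.≤-antisym (quotient-≤ u l′ eq) (quotient-≤ u′ l (sym eq)))) (sym (division t′)))
    where
    quotient-≤ : ∀ {t t′} → t ℤ.< + n → - + n ℤ.≤ t′ → t %ℕ (2 * n) ≡ t′ %ℕ (2 * n) → t /ℕ (2 * n) ℤ.≤ t′ /ℕ (2 * n)
    quotient-≤ {t} {t′} t<n -n≤t′ eq = ℤ.≮⇒≥ λ k′<k → negative-absurd
      (ℤ.*-monoʳ-≤-nonNeg d (0≤-gap< k′<k) ⊞
        0≤-gap< (subst (ℤ._< + n) (trans (division t) (cong (λ r → + r + k ℤ.* d) eq)) t<n) ⊞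
        0≤-gap (subst (ℤ._≤_ (- + n)) (division t′) -n≤t′))
      (trans (e₁ k k′ d (+ (t′ %ℕ (2 * n))) (+ n)) (trans (cong (λ z → + n + + n - z - 1ℤ) (+-double n)) (e₂ (+ n + + n))))
      where
      k = t /ℕ (2 * n)
      k′ = t′ /ℕ (2 * n)
      e₁ : ∀ k k′ d r n → (k - k′ - 1ℤ) ℤ.* d + (n - (r + k ℤ.* d) - 1ℤ) + (r + k′ ℤ.* d - (- n)) ≡
        n + n - d - 1ℤ
      e₁ = solve-∀
      e₂ : ∀ z → z - z - 1ℤ ≡ -1ℤ
      e₂ = solve-∀

  -- A later bead belongs to a higher and at least equally long row, so the last bead on the two
  -- runners gives the topmost longest row.
  IsR-maximal : ∀ i → i < n → ∀ b → RowOnRunners n μ (suc i) b →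
    (row μ b ≤ row μ (Y q (lowest i))) × (row μ b ≡ row μ (Y q (lowest i)) → Y q (lowest i) ≤ b)
  IsR-maximal i i<n (suc b) (_ , runner) = row-antitone μ R.1≤Y R≤b , λ _ → R≤b
    where
    module R = BeadRow (beadRow (lowest i) (ℤ.≤-reflexive (sym (V-lowest i))))
    t = row-diagonal (suc b)
    k = t /ℕ (2 * n)
    -- The residue `2n - (i + 1)` is `-(i + 1)` one period later, hence `k + 1`.
    on-runner : (t ≡ + i + k ℤ.* d) ⊎ (t ≡ - + suc i + (k + 1ℤ) ℤ.* d)
    on-runner = go runner
      where
      go : (rowRunner n μ (suc b) ≡ suc i) ⊎ (rowRunner n μ (suc b) ≡ N n ℕ.∸ suc i) →
        (t ≡ + i + k ℤ.* d) ⊎ (t ≡ - + suc i + (k + 1ℤ) ℤ.* d)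
      go (inj₁ eq) = inj₁ (trans (division t) (cong (λ r → + r + k ℤ.* d) residue))
        where
        residue : t %ℕ (2 * n) ≡ i
        residue = ℕ.suc-injective eq
      go (inj₂ eq) = inj₂ (trans (division t) (trans
        (cong₂ (λ r k → + r + k ℤ.* d) residue (e k))
        (sym (negative-form (k + 1ℤ) i<n))))
        where
        residue : t %ℕ (2 * n) ≡ 2 * n ℕ.∸ suc i
        residue = ℕ.suc-injective (trans eq (ℕ.+-∸-assoc 1 (1+i≤2n i<n)))
        e : ∀ k → k ≡ k + 1ℤ - 1ℤ
        e = solve-∀
    t≤ : t ℤ.≤ row-diagonal (Y q (lowest i))
    t≤ = subst (ℤ._≤_ t) (sym R.diag≡) (bound on-runner)
      where
      bound : (t ≡ + i + k ℤ.* d) ⊎ (t ≡ - + suc i + (k + 1ℤ) ℤ.* d) → t ℤ.≤ lowest i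
      bound (inj₁ eq) = bead-≤-lowest i i<n k t (row-bead b) (inj₁ eq)
      bound (inj₂ eq) = bead-≤-lowest i i<n (k + 1ℤ) t (row-bead b) (inj₂ eq)
    R≤b : Y q (lowest i) ≤ suc b
    R≤b = ℕ.≮⇒≥ λ b<R → negative-absurd
      (0≤-gap t≤ ⊞ 0≤-gap (+≤+ (row-antitone μ (s≤s z≤n) (ℕ.<⇒≤ b<R))) ⊞ 0≤-gap< (+<+ b<R))
      (e (+ row μ (suc b)) (+ suc b) (+ row μ (Y q (lowest i))) (+ Y q (lowest i)))
      where
      e : ∀ r b r′ b′ → r′ - b′ - (r - b) + (r - r′) + (b′ - b - 1ℤ) ≡ -1ℤ
      e = solve-∀

  module _ (n<row : n < row μ 1) where
    -- The first row ends with a bead at diagonal `row μ 1 - 1`, which reflects to a gap at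
    -- `- row μ 1`, before the central window. Thus a part exceeding `n` makes all rows ending in
    -- the central window nonempty, and `r(i)` exists.
    X-positive : ∀ t → - + n ℤ.≤ t → 1 ≤ X q t
    X-positive t -n≤t = induct-up (λ t → 1 ≤ X q t) base next t (ℤ.≤-trans start≤ -n≤t)
      where
      s = -1ℤ - row-diagonal 1
      V<0 : V s ℤ.< 0ℤ
      V<0 = <-by (row-bead 0) (trans (cong (λ z → 0ℤ - z - 1ℤ) (reflect (row-diagonal 1))) (e (V (row-diagonal 1))))
        where
        e : ∀ v → 0ℤ - (-1ℤ - v) - 1ℤ ≡ v
        e = solve-∀
      base : 1 ≤ X q (ℤ.suc s)
      base = subst (1 ≤_) (sym (proj₁ (step-east q s (east-at s V<0)))) (s≤s z≤n)
      next : ∀ t → ℤ.suc s ℤ.≤ t → 1 ≤ X q t → 1 ≤ X q (ℤ.suc t)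
      next t _ 1≤X with sign-cases t
      ... | inj₁ 0≤V = subst (1 ≤_) (sym (proj₁ (step-north q t (north-at t 0≤V)))) 1≤X
      ... | inj₂ V<0 = subst (1 ≤_) (sym (proj₁ (step-east q t (east-at t V<0)))) (s≤s z≤n)
      start≤ : ℤ.suc s ℤ.≤ - + n
      start≤ = ≤-by (0≤-gap< (+<+ n<row)) (e (+ n) (+ row μ 1))
        where
        e : ∀ n r → - n - (1ℤ + (-1ℤ - (r - 1ℤ))) ≡ r - n - 1ℤ
        e = solve-∀

    bead-IsRow : ∀ t → 0ℤ ℤ.≤ V t → - + n ℤ.≤ t → IsRow μ (Y q t)
    bead-IsRow t 0≤V -n≤t = 1≤Y , row-positive⇒≤ μ (subst (0 <_) (sym row≡) (X-positive t -n≤t))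
      where open BeadRow (beadRow t 0≤V)

    private
      V-lowest≥0 : ∀ i → 0ℤ ℤ.≤ V (lowest i)
      V-lowest≥0 i = ℤ.≤-reflexive (sym (V-lowest i))

      V-central≥0 : ∀ i → 0ℤ ℤ.≤ V (central i)
      V-central≥0 i = subst (ℤ._≤_ 0ℤ) (sym (V-central i)) (0≤+ _)

      central≤lowest : ∀ i → central i ℤ.≤ lowest i
      central≤lowest i = ≤-by (ℤ.*-monoʳ-≤-nonNeg d (0≤+ (lift (V (+ i))))) (e (central i) (+ lift (V (+ i)) ℤ.* d))
        where
        e : ∀ a b → a + b - a ≡ b
        e = solve-∀

      runner-of : ∀ t → 0ℤ ℤ.≤ V t → rowRunner n μ (Y q t) ≡ suc (t %ℕ (2 * n))
      runner-of t 0≤V = cong runner (BeadRow.diag≡ (beadRow t 0≤V))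
        where
        runner : ℤ → ℕ
        runner s = suc (s %ℕ (2 * n))

      runner-lowest : ∀ i → rowRunner n μ (Y q (lowest i)) ≡ suc (central i %ℕ (2 * n))
      runner-lowest i = trans (runner-of (lowest i) (V-lowest≥0 i)) (cong suc (lowest-residue i))

    isR : ∀ i → i < n → IsR n μ (suc i) (Y q (lowest i))
    isR i i<n = (bead-IsRow (lowest i) (V-lowest≥0 i) (ℤ.≤-trans (proj₁ (central-bounds i i<n)) (central≤lowest i)) ,
        runner (central-residue i i<n)) , IsR-maximal i i<n
      where
      runner : (central i %ℕ (2 * n) ≡ i) ⊎ (suc (central i %ℕ (2 * n)) ≡ N n ℕ.∸ suc i) →
        (rowRunner n μ (Y q (lowest i)) ≡ suc i) ⊎ (rowRunner n μ (Y q (lowest i)) ≡ N n ℕ.∸ suc i)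
      runner (inj₁ eq) = inj₁ (trans (runner-lowest i) (cong suc eq))
      runner (inj₂ eq) = inj₂ (trans (runner-lowest i) eq)

    isr : ∀ i → i < n → Isr n μ (Y q (lowest i)) (Y q (central i))
    isr i i<n = (bead-IsRow c (V-central≥0 i) (proj₁ (central-bounds i i<n)) ,
        (dir , q , point-0≡centre , c , proj₁ (central-bounds i i<n) , proj₂ (central-bounds i i<n) , here≡ , next≡) ,
        trans (runner-of c (V-central≥0 i)) (sym (runner-lowest i))) , unique
      where
      c = central i
      open BeadRow (beadRow c (V-central≥0 i))
      unique : ∀ b → CentralRowOnRunner n μ (rowRunner n μ (Y q (lowest i))) b → b ≡ Y q c
      -- The competing row comes with its own path `p`. Passing the centre at time `0`, it has
      -- content `t` at time `t`, so it agrees with `q`; equal runners in the central window then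
      -- force equal times.
      unique b (_ , (_ , p , p0 , t , -n≤t , t<n , pt , _) , runner) = begin
        b             ≡⟨ cong proj₂ (sym pt) ⟩
        Y p t         ≡⟨ cong proj₂ (sym (on-boundary⇒ (onBoundary p t))) ⟩
        Y q (content p t) ≡⟨ cong (Y q) (trans content-p t≡c) ⟩
        Y q c         ∎
        where
        content-p : content p t ≡ t
        content-p = content-linear p
          (trans (cong (λ z → + proj₁ z - + proj₂ z) p0) (ℤ.+-inverseʳ (+ diagonalBoxes μ))) t
        diag-b : row-diagonal b ≡ t
        diag-b = trans (cong (λ z → + proj₁ z - + proj₂ z) (sym pt)) content-p
        t≡c : t ≡ c
        t≡c = residue-unique -n≤t t<n (proj₁ (central-bounds i i<n)) (proj₂ (central-bounds i i<n))
          (trans (cong residue (sym diag-b)) (ℕ.suc-injective (trans runner (runner-lowest i))))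
          where
          residue : ℤ → ℕ
          residue s = s %ℕ (2 * n)

  -- No row reaches beyond diagonal `n`, so the sum of the lifts, which are nonnegative, is zero.
  short-lift : row μ 1 ≤ n → ∀ i → i < n → lift (V (+ i)) ≡ 0
  short-lift row≤n i i<n = ℕ.n≤0⇒n≡0 (ℤ.drop‿+≤+ (subst (ℤ._≤_ (+ lift (V (+ i)))) (trans (sym Y-n) (cong +_ Y≡0))
    (Σ-member n (λ i → + lift (V (+ i))) (λ j _ → 0≤+ (lift (V (+ j)))) i i<n)))
    where
    Y≡0 : Y q (+ n) ≡ 0
    Y≡0 = go (Y q (+ n)) refl
      where
      go : ∀ y → Y q (+ n) ≡ y → y ≡ 0
      go zero    _  = refl
      go (suc y) eq = ⊥-elim (ℕ.<⇒≱ (≤Y⇒long n 1 ℕ.≤-refl (subst (1 ≤_) (sym eq) (s≤s z≤n))) row≤n)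

  -- Without lifts `R(i)` and `r(i)` end at the same diagonal and `d` is zero, so the long formula
  -- degenerates to the short one.
  short-sum : ∀ t → SelfConjugate μ → row μ 1 ≤ n →
    ∑[ 1 ⋯ numRows μ ] (diagonalExcess t μ) ≡ coweight t n (λ i → V (+ i) + 1ℤ)
  short-sum t conj row≤n = trans (sym (begin
    Σ n (λ i → + X q (lowest i) - + X q (central i)) + c ℤ.* + h + S h
      ≡⟨ cong₂ (λ a b → a + c ℤ.* + b + S b) (Σ-zero n _ λ i i<n → trans (cong (λ s → + X q s - + X q (central i)) (lowest≡ i i<n)) (ℤ.+-inverseʳ (+ X q (central i)))) h≡0 ⟩
    0ℤ + c ℤ.* + 0 + S 0 ≡⟨ e c (S 0) ⟩
    S 0 ∎)) (length-sum t conj)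
    where
    c = 1ℤ + x₀ t + xₙ t
    h = longDiagonalHooks (2 * n) μ
    S : ℕ → ℤ
    S y = ∑[ suc y ⋯ numRows μ ] (diagonalExcess t μ)
    h≡0 : h ≡ 0
    h≡0 = trans (longDiagonalHooks≡Y conj) (ℤ.+-injective (trans Y-n (Σ-zero n _ λ i i<n → cong +_ (short-lift row≤n i i<n))))
    lowest≡ : ∀ i → i < n → lowest i ≡ central i
    lowest≡ i i<n = trans (cong (λ l → central i + + l ℤ.* d) (short-lift row≤n i i<n)) (ℤ.+-identityʳ (central i))
    e : ∀ c s → 0ℤ + c ℤ.* 0ℤ + s ≡ s
    e = solve-∀

-- Abaci

module Abaci {n : ℕ} .{{_ : NonZero n}} (p : Perm n) where
  private
    instance
      2n≢0 : NonZero (2 * n)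
      2n≢0 = ℕ.m*n≢0 2 n

    u : ℤ → ℤ
    u = from p
    d : ℤ
    d = + (2 * n)
    lev : ℕ → ℤ
    lev r = level n u (+ suc r)
  open Division (2 * n)

  -- The abacus is symmetric about the label `N`, between the levels `0` and `1`; the final `- 1`
  -- places diagonal `0` at the first entry of level `1`.
  profile : ℤ → ℤ
  profile t = lev (t %ℕ (2 * n)) - t /ℕ (2 * n) - 1ℤ

  private
    profile-at : ∀ {t r} k → r < 2 * n → t ≡ + r + k ℤ.* d → profile t ≡ lev r - k - 1ℤ
    profile-at k r<2n eq = cong₂ (λ r k → lev r - k - 1ℤ) (%ℕ-unique k r<2n eq) (/ℕ-unique k r<2n eq)

    lev-mirror-low : ∀ c → c < n → lev (2 * n ℕ.∸ suc c) ≡ - lev c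
    lev-mirror-low c c<n = trans (cong (level n u) (mirror-label c c<n)) (trans (level-end p c c<n) (ℤ.+-identityˡ _))

    lev-mirror : ∀ r → r < 2 * n → lev (2 * n ℕ.∸ suc r) ≡ - lev r
    lev-mirror r r<2n with r ℕ.<? n
    ... | yes r<n = lev-mirror-low r r<n
    ... | no r≮n = trans (sym (ℤ.neg-involutive (lev c))) (cong -_ (trans (sym (lev-mirror-low c c<n)) (cong lev back)))
      where
      c = 2 * n ℕ.∸ suc r
      back : 2 * n ℕ.∸ suc c ≡ r
      back = trans (cong (ℕ._∸_ (2 * n)) (sym (ℕ.+-∸-assoc 1 r<2n))) (ℕ.m∸[m∸n]≡n (ℕ.<⇒≤ r<2n))
      c<n : c < n
      c<n = ℕ.+-cancelʳ-< r c n (ℕ.<-≤-trans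
        (ℕ.≤-reflexive (trans (sym (ℕ.+-suc c r)) (ℕ.m∸n+n≡m r<2n)))
        (ℕ.≤-trans (ℕ.≤-reflexive (cong (ℕ._+_ n) (ℕ.+-identityʳ n))) (ℕ.+-monoʳ-≤ n (ℕ.≮⇒≥ r≮n))))

  profile-Profile : Profile n profile
  profile-Profile .Profile.drops t k = trans
    (cong₂ (λ r q → lev r - q - 1ℤ) (%ℕ-shift t k) (/ℕ-shift t k)) (e (lev (t %ℕ (2 * n))) (t /ℕ (2 * n)) k)
    where
    e : ∀ a q k → a - (q + k) - 1ℤ ≡ a - q - 1ℤ - k
    e = solve-∀
  profile-Profile .Profile.reflect t = trans
    (profile-at (-1ℤ - q) (ℕ.∸-monoʳ-< (s≤s z≤n) r<2n) decomposed)
    (trans (cong (λ z → z - (-1ℤ - q) - 1ℤ) (lev-mirror r r<2n)) (e₂ (lev r) q))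
    where
    r = t %ℕ (2 * n)
    q = t /ℕ (2 * n)
    r<2n : r < 2 * n
    r<2n = n%ℕd<d t (2 * n)
    e₁ : ∀ r q d → -1ℤ - (r + q ℤ.* d) ≡ d - (1ℤ + r) + (-1ℤ - q) ℤ.* d
    e₁ = solve-∀
    e₂ : ∀ a q → - a - (-1ℤ - q) - 1ℤ ≡ -1ℤ - (a - q - 1ℤ)
    e₂ = solve-∀
    decomposed : -1ℤ - t ≡ + (2 * n ℕ.∸ suc r) + (-1ℤ - q) ℤ.* d
    decomposed = trans (cong (_-_ -1ℤ) (division t)) (trans (e₁ (+ r) q d)
      (cong (_+ (-1ℤ - q) ℤ.* d) (trans (ℤ.m-n≡m⊖n (2 * n) (suc r)) (ℤ.⊖-≥ r<2n))))

  profile-level : ∀ i → i < n → profile (+ i) + 1ℤ ≡ lev i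
  profile-level i i<n = trans
    (cong (_+ 1ℤ) (profile-at 0ℤ (ℕ.≤-trans i<n (ℕ.m≤m+n n _)) (e₁ (+ i) d))) (e₂ (lev i))
    where
    e₁ : ∀ i d → i ≡ i + 0ℤ ℤ.* d
    e₁ = solve-∀
    e₂ : ∀ a → a - 0ℤ - 1ℤ + 1ℤ ≡ a
    e₂ = solve-∀

  private
    -- `w⁻¹` sends the label of the lowest bead to some `j` in `1, …, 2n`, where the floor is `-1`;
    -- periodicity carries this over `m` levels to the window.
    level-of-label : ∀ (r : Fin (2 * n)) m j → 1 ≤ j → j ≤ 2 * n → label n r m ≡ to p (+ j) → lev (toℕ r) ≡ m
    level-of-label r m (suc j) _ j<2n eq = trans
      (cong (λ z → 1ℤ + floorShift n 0ℤ z) (begin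
        u (+ suc (toℕ r))                                ≡⟨ cong u (e₁ m (+ N n) (+ suc (toℕ r))) ⟩
        u (label n r m + (- m) ℤ.* + N n)              ≡⟨ shift (mirrored-from p) (label n r m) (- m) ⟩
        u (label n r m) + (- m) ℤ.* + N n
          ≡⟨ cong (_+ (- m) ℤ.* + N n) (trans (cong u eq) (from-to p (+ suc j))) ⟩
        + suc j + (- m) ℤ.* + N n                      ∎))
      (trans (cong (_+_ 1ℤ) (DN./ℕ-unique (-1ℤ + m) (s≤s (ℕ.m∸n≤m (2 * n) j))
          (trans (e₂ (+ suc j) m (+ N n)) (cong (_+ (-1ℤ + m) ℤ.* + N n)
            (trans (ℤ.m-n≡m⊖n (N n) (suc j)) (ℤ.⊖-≥ (ℕ.m≤n⇒m≤1+n j<2n))))))) (e₃ m))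
      where
      module DN = Division (N n)
      e₁ : ∀ m d r → r ≡ m ℤ.* d + r + (- m) ℤ.* d
      e₁ = solve-∀
      e₂ : ∀ j m d → 0ℤ - (j + (- m) ℤ.* d) ≡ d - j + (-1ℤ + m) ℤ.* d
      e₂ = solve-∀
      e₃ : ∀ m → 1ℤ + (-1ℤ + m) ≡ m
      e₃ = solve-∀

  module _ {A : Abacus n} (isA : IsAbacusOf n (to p) A) where
    private
      bead-≤ : ∀ r l → l ℤ.≤ lev (toℕ r) → A r l ≡ bead
      bead-≤ r l l≤ with proj₂ isA r
      ... | m , (bead-m , _) , j , 1≤j , j≤2n , eq = go (subst (ℤ._≤_ l) (level-of-label r m j 1≤j j≤2n eq) l≤)
        where
        go : l ℤ.≤ m → A r l ≡ bead
        go l≤m with l ℤ.≟ m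
        ... | yes refl = bead-m
        ... | no l≢m   = proj₁ isA r (ℤ.≤∧≢⇒< l≤m l≢m) bead-m

      gap-> : ∀ r l → lev (toℕ r) ℤ.< l → A r l ≡ gap
      gap-> r l <l with proj₂ isA r
      ... | m , (_ , lowest-m) , j , 1≤j , j≤2n , eq = go (A r l) refl
        where
        go : ∀ a → A r l ≡ a → A r l ≡ gap
        go gap  a≡ = a≡
        go bead a≡ = ⊥-elim (ℤ.<⇒≱ <l (ℤ.≤-trans (lowest-m l a≡) (ℤ.≤-reflexive (sym (level-of-label r m j 1≤j j≤2n eq)))))

      runner : ℤ → Fin (2 * n)
      runner t = fromℕ< (n%ℕd<d (t + d) (2 * n))

      shift-1 : ∀ t → t + d ≡ t + 1ℤ ℤ.* d
      shift-1 t = cong (_+_ t) (sym (ℤ.*-identityˡ d))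

      runner≡ : ∀ t → toℕ (runner t) ≡ t %ℕ (2 * n)
      runner≡ t = trans (Fin.toℕ-fromℕ< _) (trans (cong residue (shift-1 t)) (%ℕ-shift t 1ℤ))
        where
        residue : ℤ → ℕ
        residue s = s %ℕ (2 * n)

      level≡ : ∀ t → (t + d) /ℕ (2 * n) ≡ t /ℕ (2 * n) + 1ℤ
      level≡ t = trans (cong quotient (shift-1 t)) (/ℕ-shift t 1ℤ)
        where
        quotient : ℤ → ℤ
        quotient s = s /ℕ (2 * n)

      gap-between : ∀ t → lev (toℕ (runner t)) - (t + d) /ℕ (2 * n) ≡ profile t
      gap-between t = trans (cong₂ (λ r l → lev r - l) (runner≡ t) (level≡ t)) (e (lev (t %ℕ (2 * n))) (t /ℕ (2 * n)))
        where
        e : ∀ a q → a - (q + 1ℤ) ≡ a - q - 1ℤ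
        e = solve-∀

    -- Reading time 2n + t corresponds to the diagonal t.
    traces : Traces profile (λ t → stepFor (readingOrder n A (t + d)))
    traces .Traces.north-at t 0≤V = cong stepFor
      (bead-≤ (runner t) ((t + d) /ℕ (2 * n)) (≤-by 0≤V (gap-between t)))
    traces .Traces.east-at t V<0 = cong stepFor
      (gap-> (runner t) ((t + d) /ℕ (2 * n)) (<-by (0≤-gap< V<0)
        (trans (e (lev (toℕ (runner t))) ((t + d) /ℕ (2 * n))) (cong (λ z → 0ℤ - z - 1ℤ) (gap-between t)))))
      where
      e : ∀ a b → b - a - 1ℤ ≡ 0ℤ - (a - b) - 1ℤ
      e = solve-∀

2≤minRank : ∀ t → 2 ≤ minRank t
2≤minRank CC = s≤s (s≤s z≤n)
2≤minRank BB = s≤s (s≤s z≤n)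
2≤minRank BD = s≤s (s≤s z≤n)
2≤minRank DD = s≤s (s≤s z≤n)

3≤minRank : ∀ t → endShape t ≡ D → 3 ≤ minRank t
3≤minRank BD _ = s≤s (s≤s (s≤s z≤n))
3≤minRank DD _ = s≤s (s≤s (s≤s z≤n))

representative-length : ∀ t {n} → minRank t ≤ n → ∀ {w} (rep : MinimalRepresentative t n w) →
  LengthIs t n w (coweight t n (state (level n (from (perm t (proj₁ rep))))))
representative-length t {n} rank≤n {w} (w∈ , shortest) with perm-parity t 2≤n w∈
  where 2≤n = ℕ.≤-trans (2≤minRank t) rank≤n
... | to≡w , parity = subst (λ v → LengthIs t n v (coweight t n (state (level n (from p))))) to≡w
  (length-formula t 2≤n (λ eq → ℕ.≤-trans (3≤minRank t eq) rank≤n) p parity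
    λ u u∈ has-a has-b → shortest u u∈ (subst (λ v → HasLength t n v _) to≡w has-a)
      (subst (λ v → HasLength t n (v ∘ u) _) to≡w has-b))
  where
  2≤n = ℕ.≤-trans (2≤minRank t) rank≤n
  p = perm t w∈

proposition8p3 : (t : AffineType) (n : ℕ) .{{_ : NonZero n}} → minRank t ≤ n →
    (μ : Partition) → SymmetricCore (2 * n) μ →
    (w : ℤ → ℤ) → MinimalRepresentative t n w → IsPartitionOf n w μ →
    (All (_≤ n) (parts μ) →
    LengthIs t n w (∑[ 1 ⋯ numRows μ ] (diagonalExcess t μ)))
    ×
    (¬ All (_≤ n) (parts μ) →
    ∃₂ λ (R r : ℕ → ℕ) →
    (∀ i → 1 ≤ i → i ≤ n → IsR n μ i (R i) × Isr n μ (R i) (r i)) ×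
    LengthIs t n w
    (∑[ 1 ⋯ n ] (λ i → + row μ (R i) ℤ.- + row μ (r i))
    ℤ.+ (1ℤ ℤ.+ x₀ t ℤ.+ xₙ t) ℤ.* + longDiagonalHooks (2 * n) μ
    ℤ.+ ∑[ suc (longDiagonalHooks (2 * n) μ) ⋯ numRows μ ] (diagonalExcess t μ)))
proposition8p3 t n rank≤n μ (conj , _) w rep@(w∈ , _) (A , isA , path) = short , long
  where
  instance
    2n≢0 : NonZero (2 * n)
    2n≢0 = ℕ.m*n≢0 2 n
  p : Perm n
  p = perm t w∈
  open Abaci p
  isA′ : IsAbacusOf n (to p) A
  isA′ = subst (λ v → IsAbacusOf n v A) (sym (proj₁ (perm-parity t (ℕ.≤-trans (2≤minRank t) rank≤n) w∈))) isA
  q : BoundaryPath μ (λ s → stepFor (readingOrder n A (s + + (2 * n))))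
  q = shiftPath path (+ (2 * n))
  open Rows profile-Profile (traces isA′) q
  open Extremal profile-Profile (traces isA′) q
  length-coweight : LengthIs t n w (coweight t n (λ i → profile (+ i) + 1ℤ))
  length-coweight = subst (LengthIs t n w) (sym (weight-cong n profile-level)) (representative-length t rank≤n rep)
    where open Weight (axisWeight t) pairWeight
  short : All (_≤ n) (parts μ) → LengthIs t n w (∑[ 1 ⋯ numRows μ ] (diagonalExcess t μ))
  short all = subst (LengthIs t n w) (sym (short-sum t conj (parts-≤⇒ μ all))) length-coweight
  R r : ℕ → ℕ
  -- The theorem numbers runners from `1`, whereas `lowest` and `central` count from `0`.
  R i = Y q (lowest (i ℕ.∸ 1))
  r i = Y q (central (i ℕ.∸ 1))
  long : ¬ All (_≤ n) (parts μ) → ∃₂ λ (R r : ℕ → ℕ) →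
    (∀ i → 1 ≤ i → i ≤ n → IsR n μ i (R i) × Isr n μ (R i) (r i)) ×
    LengthIs t n w
      (∑[ 1 ⋯ n ] (λ i → + row μ (R i) - + row μ (r i))
        + (1ℤ + x₀ t + xₙ t) ℤ.* + longDiagonalHooks (2 * n) μ
        + ∑[ suc (longDiagonalHooks (2 * n) μ) ⋯ numRows μ ] (diagonalExcess t μ))
  long ¬all = R , r , (λ { (suc i) _ i<n → isR n<row i i<n , isr n<row i i<n }) ,
    subst (LengthIs t n w) (sym (trans
      (cong (λ z → z + (1ℤ + x₀ t + xₙ t) ℤ.* + longDiagonalHooks (2 * n) μ
        + ∑[ suc (longDiagonalHooks (2 * n) μ) ⋯ numRows μ ] (diagonalExcess t μ))
        (trans (∑-Σ 0 n (λ i → + row μ (R i) - + row μ (r i))) (Σ-cong n λ i _ → cong₂ (λ a b → + a - + b)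
          (BeadRow.row≡ (beadRow (lowest i) (ℤ.≤-reflexive (sym (V-lowest i)))))
          (BeadRow.row≡ (beadRow (central i) (subst (ℤ._≤_ 0ℤ) (sym (V-central i)) (0≤+ _)))))))
      (length-sum t conj))) length-coweight
    where
    n<row : n < row μ 1
    n<row = ¬parts-≤⇒ μ ¬all
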